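{- Let $S$ be a centred Catalan set. Then $w_l(S)$ (for positive integers $l$) is given by a polynomial in $l$ of degree $|\lambda(S)/\mu(S)|=\operatorname{area}(\mathbf{M}(S))$ with leading coefficient $\dfrac{f^{\lambda(S)/\mu(S)}}{|\lambda(S)/\mu(S)|!}$.
   Context: A centred Catalan set of size $n$ is an $n$-subset $S$ of $\{ -n+1,\dots,n-1\}$ with $|S\cap\{ -i,\dots,i\}|\ge i+1$ for all $0\le i\le n-1$. For $S$ of size $n+1$, $\mathbf{M}(S)=(m_1,\dots,m_n)$ with $m_i=|\{ -i,i\}\cap S|-1$ is a Motzkin path (steps $(1,m_i)$, staying weakly above the $x$-axis, from $(0,0)$ to $(n,0)$), and $\operatorname{area}(\mathbf{M}(S))$ is the area of the region between this path and the $x$-axis. Write $S=\{s_1,\dots,s_u,0,s_{u+1},\dots,s_n\}$ with $s_1<\dots<s_u<0<s_{u+1}<\dots<s_n$. Define Young diagrams $\lambda(S)=(u+1-s_{u+1},\,u+2-s_{u+2},\dots,n-s_n)'$ (where $'$ denotes the conjugate partition) and $\mu(S)=(-s_1-u,\,-s_2-u+1,\dots,-s_u-1)$ (the $i$-th part being $-s_i-(u+1-i)$); then $\mu(S)\subseteq\lambda(S)$. $f^{\lambda/\mu}$ denotes the number of standard Young tableaux of skew shape $\lambda/\mu$, and $|\lambda/\mu|$ its number of cells. Let $n,l$ be positive integers. An $(n,l)$-AS-trapezoid is an array of $n$ centred rows, the $i$-th row from the bottom having $l+2i-1$ entries from $\{ -1,0,1\}$, such that all row sums are $1$, the column sums of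 the central $l-1$ columns are $0$, the nonzero entries in every row and in every column alternate in sign, and in every column the first nonzero entry from the top is positive. Label the columns $-n+1,\dots,l+n-1$ from left to right. $\mathcal{S}(A)$ is $\{0\}\cup\{c-1: c\le 0,\ \text{column } c\text{ has positive sum}\}\cup\{c-(l-1): c\ge1,\ \text{column } c\text{ has positive sum}\}$. For a centred Catalan set $S$ of size $n+1$, $w_l(S)$ is the number of $(n,l)$-AS-trapezoids $A$ with $\mathcal{S}(A)=S$. -}

module Defs where

open import Data.Bool using (Bool; true; false; _∧_; _∨_; not; if_then_else_)
open import Data.Nat as ℕ using (ℕ; zero; suc; _!; _⊔_)
open import Data.Nat.Properties using (_!≢0)
open import Data.Integer as ℤ using (ℤ; +_; -_; ∣_∣; -[1+_])
open import Data.Integer.Properties using () renaming (_≟_ to _≟ℤ_)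
open import Data.Rational as ℚ using (ℚ; _/_; 0ℚ)
open import Data.List using (List; []; _∷_; [_]; length; map; filter; filterᵇ; upTo; zip; foldr; concatMap; scanl)
open import Data.Bool.ListAction using (all; any)
open import Data.List.Relation.Unary.AllPairs using (AllPairs)
open import Data.List.Relation.Unary.All using (All)
open import Data.Vec as Vec using (Vec; []; _∷_)
open import Data.Product using (_×_; _,_)
open import Relation.Nullary using (does)
open import Relation.Binary.PropositionalEquality using (_≡_)

infix 4 _≡ᶻ_ _≤ᶻ_ _<ᶻ_ _∈ᶻ_

_≡ᶻ_ : ℤ → ℤ → Bool
x ≡ᶻ y = does (x ≟ℤ y)

_≤ᶻ_ : ℤ → ℤ → Bool
x ≤ᶻ y = x ℤ.≤ᵇ y

_<ᶻ_ : ℤ → ℤ → Bool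
x <ᶻ y = (x ℤ.+ + 1) ℤ.≤ᵇ y

sumℤ : List ℤ → ℤ
sumℤ = foldr ℤ._+_ (+ 0)

indexed : ∀ {A : Set} → List A → List (ℕ × A)
indexed xs = zip (upTo (length xs)) xs

vecsOver : ∀ {A : Set} → List A → (k : ℕ) → List (Vec A k)
vecsOver xs zero    = [ [] ]
vecsOver xs (suc k) = concatMap (λ x → map (x ∷_) (vecsOver xs k)) xs

-- Centred Catalan sets.  A finite set S ⊆ ℤ is represented by the list
-- of its elements in strictly increasing order.

record CentredCatalan (N : ℕ) (S : List ℤ) : Set where
  field
    increasing : AllPairs ℤ._<_ S
    size       : length S ≡ N
    inRange    : All (λ z → ((- (+ N)) ℤ.+ + 1) ℤ.≤ z × z ℤ.≤ (+ N ℤ.- + 1)) S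
    catalan    : ∀ i → i ℕ.< N →
                 suc i ℕ.≤ length (filter (λ z → ∣ z ∣ ℕ.≤? i) S)

-- (n,l)-AS-trapezoids.
-- An array is stored as n rows (index 0 = bottom row) of width l+2n-1;
-- position j of a row lies in column with label  j - n + 1,  so the
-- labels run over -n+1, ..., l+n-1.  Row r (0-based from the bottom,
-- i.e. the paper's row i = r+1) occupies the centred columns
-- -r, ..., l+r (that is l+2i-1 entries); positions outside the row must
-- carry 0 (so arrays correspond bijectively to the ragged arrays).

width : ℕ → ℕ → ℕ
width n l = n ℕ.+ n ℕ.+ l ℕ.∸ 1

Array : ℕ → ℕ → Set
Array n l = Vec (Vec ℤ (width n l)) n

entries : List ℤ
entries = -[1+ 0 ] ∷ + 0 ∷ + 1 ∷ []

allArrays : (n l : ℕ) → List (Array n l)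
allArrays n l = vecsOver (vecsOver entries (width n l)) n

colLabel : ℕ → ℕ → ℤ
colLabel n j = (+ j ℤ.- + n) ℤ.+ + 1

inRow : ℕ → ℕ → ℕ → ℕ → Bool
inRow n l r j = ((- (+ r)) ≤ᶻ colLabel n j) ∧ (colLabel n j ≤ᶻ (+ l ℤ.+ + r))

alternating : List ℤ → Bool
alternating xs = go (filterᵇ (λ x → not (x ≡ᶻ + 0)) xs)
  where
  go : List ℤ → Bool
  go (x ∷ y ∷ ys) = ((x ℤ.* y) <ᶻ + 0) ∧ go (y ∷ ys)
  go _            = true

firstNonzeroPositive : List ℤ → Bool
firstNonzeroPositive []       = true
firstNonzeroPositive (x ∷ xs) = if x ≡ᶻ + 0 then firstNonzeroPositive xs else (+ 0 <ᶻ x)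

rowsOf : ∀ {n l} → Array n l → List (List ℤ)
rowsOf A = map Vec.toList (Vec.toList A)

-- columns, each listed bottom-to-top
colsOf : ∀ {n l} → Array n l → List (List ℤ)
colsOf A = map Vec.toList (Vec.toList (Vec.transpose A))

reverseℤ : List ℤ → List ℤ
reverseℤ = Data.List.reverse
  where import Data.List

zeroOutside : ∀ n l → Array n l → Bool
zeroOutside n l A =
  all (λ { (r , row) → all (λ { (j , x) → inRow n l r j ∨ (x ≡ᶻ + 0) }) (indexed row) })
      (indexed (rowsOf A))

isCentral : ℕ → ℕ → ℕ → Bool
isCentral n l j = (+ 1 ≤ᶻ colLabel n j) ∧ (colLabel n j ≤ᶻ (+ l ℤ.- + 1))

isASTrapezoid : ∀ n l → Array n l → Bool
isASTrapezoid n l A =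
  zeroOutside n l A
  ∧ all (λ row → sumℤ row ≡ᶻ + 1) (rowsOf A)
  ∧ all (λ { (j , col) → not (isCentral n l j) ∨ (sumℤ col ≡ᶻ + 0) }) (indexed (colsOf A))
  ∧ all alternating (rowsOf A)
  ∧ all alternating (colsOf A)
  ∧ all (λ col → firstNonzeroPositive (reverseℤ col)) (colsOf A)

𝒮 : ∀ n l → Array n l → List ℤ
𝒮 n l A =
  + 0 ∷ map (λ { (j , _) → shift (colLabel n j) })
            (filterᵇ (λ { (j , col) → + 0 <ᶻ sumℤ col }) (indexed (colsOf A)))
  where
  shift : ℤ → ℤ
  shift c = if c ≤ᶻ + 0 then c ℤ.- + 1 else c ℤ.- (+ l ℤ.- + 1)

_∈ᶻ_ : ℤ → List ℤ → Bool
z ∈ᶻ xs = any (λ y → z ≡ᶻ y) xs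

sameSet : List ℤ → List ℤ → Bool
sameSet xs ys = all (_∈ᶻ ys) xs ∧ all (_∈ᶻ xs) ys

-- w_l(S) for S of size n+1: number of (n,l)-AS-trapezoids A with 𝒮(A) = S
w : ℕ → ℕ → List ℤ → ℕ
w n l S = length (filterᵇ (λ A → isASTrapezoid n l A ∧ sameSet (𝒮 n l A) S) (allArrays n l))

negatives positives : List ℤ → List ℤ
negatives S = filterᵇ (λ z → z <ᶻ + 0) S   -- s_1 < ... < s_u
positives S = filterᵇ (λ z → + 0 <ᶻ z) S   -- s_{u+1} < ... < s_n

uOf : List ℤ → ℕ
uOf S = length (negatives S)

conjugate : List ℕ → List ℕ
conjugate ν = map (λ r → length (filterᵇ (λ x → r ℕ.<ᵇ x) ν)) (upTo (foldr _⊔_ 0 ν))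

-- (u+1-s_{u+1}, ..., n-s_n); the k-th (0-based) entry is (u+1+k) - s_{u+1+k}
-- (these are nonnegative for centred Catalan sets)
λ-conj : List ℤ → List ℕ
λ-conj S = map (λ { (k , s) → ∣ + (uOf S ℕ.+ 1 ℕ.+ k) ℤ.- s ∣ }) (indexed (positives S))

λ⟨_⟩ : List ℤ → List ℕ
λ⟨ S ⟩ = conjugate (λ-conj S)

-- i-th part -s_i-(u+1-i); 0-based k = i-1 gives -s_{k+1} - (u-k)  (nonnegative)
μ⟨_⟩ : List ℤ → List ℕ
μ⟨ S ⟩ = map (λ { (k , s) → ∣ (- s) ℤ.- + (uOf S ℕ.∸ k) ∣ }) (indexed (negatives S))

partAt : List ℕ → ℕ → ℕ
partAt []       r       = 0
partAt (x ∷ xs) zero    = x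
partAt (x ∷ xs) (suc r) = partAt xs r

skewCells : List ℕ → List ℕ → List (ℕ × ℕ)
skewCells lam mu =
  concatMap (λ { (r , lr) → map (r ,_) (filterᵇ (λ c → partAt mu r ℕ.≤ᵇ c) (upTo lr)) })
            (indexed lam)

skewSize : List ℕ → List ℕ → ℕ
skewSize lam mu = length (skewCells lam mu)

pairwiseDistinct : List ℕ → Bool
pairwiseDistinct []       = true
pairwiseDistinct (x ∷ xs) = all (λ y → not (x ℕ.≡ᵇ y)) xs ∧ pairwiseDistinct xs

rightOrBelow : ℕ × ℕ → ℕ × ℕ → Bool
rightOrBelow (r , c) (r' , c') =
  ((r ℕ.≡ᵇ r') ∧ (suc c ℕ.≡ᵇ c')) ∨ ((suc r ℕ.≡ᵇ r') ∧ (c ℕ.≡ᵇ c'))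

isStandard : List (ℕ × ℕ) → List ℕ → Bool
isStandard cells vals =
  pairwiseDistinct vals ∧
  all (λ { (p , a) → all (λ { (q , b) → not (rightOrBelow p q) ∨ (a ℕ.<ᵇ b) }) cv }) cv
  where cv = zip cells vals

numSYT : List ℕ → List ℕ → ℕ
numSYT lam mu =
  length (filterᵇ (λ v → isStandard cells (Vec.toList v))
                  (vecsOver (map suc (upTo N)) N))
  where
  cells = skewCells lam mu
  N = length cells

motzkinStep : List ℤ → ℕ → ℤ
motzkinStep S i = + length (filterᵇ (λ z → (z ≡ᶻ + i) ∨ (z ≡ᶻ - (+ i))) S) ℤ.- + 1

heights : ℕ → List ℤ → List ℤ
heights n S = scanl ℤ._+_ (+ 0) (map (λ k → motzkinStep S (suc k)) (upTo n))

-- area between a lattice path with the given heights and the x-axis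
-- (sum of the trapezoids (h_{k-1}+h_k)/2 under each unit step)
areaUnder : List ℤ → ℚ
areaUnder (a ∷ b ∷ hs) = ((a ℤ.+ b) / 2) ℚ.+ areaUnder (b ∷ hs)
areaUnder _            = 0ℚ

areaM : ℕ → List ℤ → ℚ
areaM n S = areaUnder (heights n S)

-- Polynomials over ℚ as coefficient lists (constant term first)

evalPoly : List ℚ → ℚ → ℚ
evalPoly cs x = foldr (λ c acc → c ℚ.+ x ℚ.* acc) 0ℚ cs

leadingCoeff : ℕ → ℕ → ℚ
leadingCoeff f d = (+ f / (d !)) {{d !≢0}}

{-# OPTIONS --safe #-}
module Submission where

-- Deleting the zero columns among the central columns of a trapezoid keeps it a trapezoid, so that
-- w_{m+1}(S) = Σ_k C(m,k) N_k, where N_k counts the trapezoids with k central columns, none of them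
-- zero.  This is Newton's form of a polynomial in l = m+1; it remains to show N_k = 0 for
-- k > d = |λ/μ| and N_d = f^{λ/μ}.
--
-- Put A_i = |S ∩ {-i,…,-1}|, B_i = |S ∩ {1,…,i}|, and let h_x(i) be the sum of the entries in the
-- lowest i rows over the left columns and the first x central columns.  A nonzero central column
-- lowers at least one h(i) by one and raises none, while h_0(i) ≤ A_i and h_k(i) ≥ i - B_i.
-- Hence k ≤ Σ_i (A_i + B_i - i) = area(M(S)).
--
-- In the extremal case h runs from A_i to i - B_i in unit steps, with h(i+1) - h(i) ∈ {0,1}
-- throughout.  The cells of λ/μ are the pairs (i,t) with i - B_i < t ≤ A_i (antidiagonal i, t-th row
-- from below), and recording the step at which h(i) falls below t yields a standard Young tableau.

-- Alternation enters only through partial sums. For entries 0, 1 and -1, a row alternates and has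
-- sum 1 exactly when its sums from the left stay in {0,1} and end at 1; a column alternates with
-- positive topmost nonzero entry exactly when its sums from the top stay in {0,1}. A central column
-- has sum 0, so its lowest i entries sum to minus such a sum from the top, that is to 0 or -1;
-- hence it cannot raise h(i), nor lower it by more than one. A side column at distance c from the
-- centre has a prescribed sum and no entry in the lowest c rows, which gives the bounds by A_i and
-- i - B_i. Summed over i, the losses caused by the central columns and the slack in these bounds
-- add up to the area. In the extremal case there is no slack, which determines the side columns,
-- and each central column lowers exactly one h(i): one cell per column. The inequality 0 ≤ h(i+1) -
-- h(i) ≤ 1 is the row condition; its two halves become the increase along the rows and down the
-- columns of the tableau.

open import Defs
open import Data.Bool using (Bool; true; false; _∧_; _∨_; not; if_then_else_)
open import Data.Bool.ListAction using (all; any)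
open import Data.Bool.Properties using (T-≡)
open import Data.Empty using (⊥; ⊥-elim)
open import Data.Fin using (Fin; zero; suc; toℕ; fromℕ<)
open import Data.Integer as ℤ using (ℤ; +_; -[1+_])
open import Data.List using (List; []; _∷_; _++_; length; map; filter; filterᵇ; upTo; applyUpTo; zip; zipWith; scanl; concat; concatMap; cartesianProduct; cartesianProductWith; reverse; take; drop)
open import Data.List.Membership.Propositional using (_∈_; _∉_)
open import Data.List.Membership.Propositional.Properties
open import Data.List.Relation.Unary.All as All using (All; []; _∷_)
open import Data.List.Relation.Unary.AllPairs as AllPairs using (AllPairs; []; _∷_)
open import Data.List.Relation.Unary.Any using (here; there)
open import Data.List.Relation.Unary.Unique.Propositional using (Unique)
open import Data.Nat using (ℕ; zero; suc; _+_; _*_; _∸_; _⊓_; _⊔_; _!; _≤_; _<_; _<ᵇ_; _≤ᵇ_; _≡ᵇ_; NonZero; z≤n; s≤s; s<s; z<s)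
open import Data.Nat.Combinatorics using (nCk+nC[k+1]≡[n+1]C[k+1]; nCk≡nC[n∸k]; nCn≡1; nC1≡n; k>n⇒nCk≡0) renaming (_C_ to _choose_)
open import Data.Nat.ListAction using (sum)
open import Data.Nat.ListAction.Properties using (sum-++)
open import Data.Nat.Properties using (_!≢0)
open import Data.Product using (Σ; ∃; _×_; _,_; proj₁; proj₂)
open import Data.Rational as ℚ using (ℚ; _/_; 0ℚ; 1ℚ; fromℚᵘ)
open import Data.Rational.Unnormalised as ℚᵘ using (mkℚᵘ; *≡*)
open import Data.Sum using (_⊎_; inj₁; inj₂)
open import Data.Unit using (⊤; tt)
open import Data.Vec as Vec using (Vec; []; _∷_)
open import Function using (_∘_; id; case_of_; _⇔_; mk⇔; Equivalence)
open import Relation.Binary.Definitions using (tri<; tri≈; tri>)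
open import Relation.Binary.PropositionalEquality using (_≡_; _≢_; refl; sym; trans; cong; cong₂; subst; subst₂; module ≡-Reasoning)
open import Relation.Nullary using (¬_; Dec; yes; no; contradiction; does)
open import Relation.Nullary.Decidable using (_×-dec_; _⊎-dec_; _→-dec_; ¬?; dec-true; dec-false)
open import Relation.Unary using (Decidable)
import Data.Bool.Properties as Boolₚ
import Data.Fin.Properties as Finₚ
import Data.Integer.Properties as ℤₚ
import Data.Integer.Solver
import Data.List.Properties as Listₚ
import Data.List.Relation.Unary.All.Properties as Allₚ
import Data.List.Relation.Unary.AllPairs.Properties as AllPairsₚ
import Data.List.Relation.Unary.Unique.Propositional.Properties as Uniqueₚ
import Data.Nat.Properties as ℕₚ
import Data.Nat.Solver
import Data.Product.Properties as Productₚ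
import Data.Rational.Properties as ℚₚ
import Data.Rational.Solver
import Data.Rational.Unnormalised.Properties as ℚᵘₚ
import Data.Vec.Properties as Vecₚ
open Equivalence using (to; from)

-- Counting by injections and by inserting letters

-- Induction on `xs`: one occurrence of `f x` is removed from `ys`, and injectivity keeps the images
-- of the remaining elements in what is left.
length-mono-injection : ∀ {A B : Set} (f : A → B) (xs : List A) (ys : List B) → Unique xs →
  (∀ {x} → x ∈ xs → f x ∈ ys) →
  (∀ {x y} → x ∈ xs → y ∈ xs → f x ≡ f y → x ≡ y) →
  length xs ≤ length ys
length-mono-injection f [] ys _ _ _ = z≤n
length-mono-injection f (x ∷ xs) ys (x∉xs ∷ xs!) into inj with ∈-∃++ (into (here refl))
... | as , bs , refl = begin
  suc (length xs)            ≤⟨ s≤s (length-mono-injection f xs (as ++ bs) xs! into′ λ p q →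
    inj (there p) (there q)) ⟩
  suc (length (as ++ bs))    ≡⟨ cong suc (Listₚ.length-++ as) ⟩
  suc (length as + length bs) ≡⟨ ℕₚ.+-suc (length as) (length bs) ⟨
  length as + suc (length bs) ≡⟨ Listₚ.length-++ as ⟨
  length (as ++ f x ∷ bs)    ∎
  where
  open ℕₚ.≤-Reasoning
  into′ : ∀ {y} → y ∈ xs → f y ∈ as ++ bs
  into′ y∈xs with ∈-++⁻ as (into (there y∈xs))
  ... | inj₁ p = ∈-++⁺ˡ p
  ... | inj₂ (there p) = ∈-++⁺ʳ as p
  ... | inj₂ (here eq) = contradiction (inj (here refl) (there y∈xs) (sym eq)) (All.lookup x∉xs y∈xs)

-- Two injections between finite sets settle the equality of their sizes, so none of the
-- correspondences below has to be shown inverse to another.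
length-≡-injections : ∀ {A B : Set} {xs : List A} {ys : List B} (f : A → B) (g : B → A) →
  Unique xs → Unique ys →
  (∀ {x} → x ∈ xs → f x ∈ ys) → (∀ {x y} → x ∈ xs → y ∈ xs → f x ≡ f y → x ≡ y) →
  (∀ {y} → y ∈ ys → g y ∈ xs) → (∀ {x y} → x ∈ ys → y ∈ ys → g x ≡ g y → x ≡ y) →
  length xs ≡ length ys
length-≡-injections f g xs! ys! f∈ f-inj g∈ g-inj =
  ℕₚ.≤-antisym (length-mono-injection f _ _ xs! f∈ f-inj) (length-mono-injection g _ _ ys! g∈ g-inj)

-- If `y` were missed, `f` would inject `xs` into `ys` with `y` removed, a list shorter by one. It
-- serves to show that a standard filling takes every value.
injective⇒surjective : ∀ {A B : Set} (f : A → B) (xs : List A) (ys : List B) → Unique xs → Unique ys →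
  length xs ≡ length ys → (∀ {x} → x ∈ xs → f x ∈ ys) →
  (∀ {x y} → x ∈ xs → y ∈ xs → f x ≡ f y → x ≡ y) →
  ∀ {y} → y ∈ ys → (∀ {x} → x ∈ xs → f x ≢ y) → ⊥
injective⇒surjective f xs ys xs! ys! eq into inj y∈ys missed with ∈-∃++ y∈ys
... | as , bs , refl = ℕₚ.<-irrefl eq (begin-strict
  length xs          ≤⟨ length-mono-injection f xs (as ++ bs) xs! into′ inj ⟩
  length (as ++ bs)  ≡⟨ Listₚ.length-++ as ⟩
  length as + length bs <⟨ ℕₚ.n<1+n _ ⟩
  suc (length as + length bs) ≡⟨ ℕₚ.+-suc (length as) (length bs) ⟨
  length as + suc (length bs) ≡⟨ Listₚ.length-++ as ⟨
  length (as ++ _ ∷ bs)    ∎)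
  where
  open ℕₚ.≤-Reasoning
  into′ : ∀ {x} → x ∈ xs → f x ∈ as ++ bs
  into′ x∈xs with ∈-++⁻ as (into x∈xs)
  ... | inj₁ p = ∈-++⁺ˡ p
  ... | inj₂ (there p) = ∈-++⁺ʳ as p
  ... | inj₂ (here eq) = ⊥-elim (missed x∈xs eq)

concatMap-cartesian : ∀ {A B C : Set} (f : A → B → C) (xs : List A) (ys : List B) →
  concatMap (λ x → map (f x) ys) xs ≡ cartesianProductWith f xs ys
concatMap-cartesian f [] ys = refl
concatMap-cartesian f (x ∷ xs) ys = cong (map (f x) ys ++_) (concatMap-cartesian f xs ys)

vecsOver-unique : ∀ {A : Set} {xs : List A} → Unique xs → ∀ k → Unique (vecsOver xs k)
vecsOver-unique xs! zero = [] ∷ []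
vecsOver-unique {xs = xs} xs! (suc k) = subst Unique (sym (concatMap-cartesian _∷_ xs (vecsOver xs k)))
  (Uniqueₚ.cartesianProductWith⁺ _∷_ (λ { refl → refl , refl }) xs! (vecsOver-unique xs! k))

∈-vecsOver⁺ : ∀ {A : Set} {xs : List A} {k} (v : Vec A k) → (∀ i → Vec.lookup v i ∈ xs) → v ∈ vecsOver xs k
∈-vecsOver⁺ [] _ = here refl
∈-vecsOver⁺ {xs = xs} {suc k} (x ∷ v) all = subst (x ∷ v ∈_) (sym (concatMap-cartesian _∷_ xs (vecsOver xs k)))
  (∈-cartesianProductWith⁺ _∷_ (all zero) (∈-vecsOver⁺ v (all ∘ suc)))

∈-vecsOver⁻ : ∀ {A : Set} {xs : List A} {k} {v : Vec A k} → v ∈ vecsOver xs k → ∀ i → Vec.lookup v i ∈ xs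
∈-vecsOver⁻ {xs = xs} {suc k} {v} v∈ i
  with ∈-cartesianProductWith⁻ _∷_ xs (vecsOver xs k) (subst (v ∈_) (concatMap-cartesian _∷_ xs (vecsOver xs k)) v∈)
∈-vecsOver⁻ v∈ zero    | _ , _ , a∈ , _ , refl = a∈
∈-vecsOver⁻ v∈ (suc i) | _ , _ , _ , b∈ , refl = ∈-vecsOver⁻ b∈ i

words : ∀ {A : Set} → List A → ℕ → List (List A)
words xs zero    = [] ∷ []
words xs (suc k) = cartesianProductWith _∷_ xs (words xs k)

words-unique : ∀ {A : Set} {xs : List A} → Unique xs → ∀ k → Unique (words xs k)
words-unique xs! zero = [] ∷ []
words-unique xs! (suc k) =
  Uniqueₚ.cartesianProductWith⁺ _∷_ (λ { refl → refl , refl }) xs! (words-unique xs! k)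

∈-words⁺ : ∀ {A : Set} {xs : List A} (v : List A) → All (_∈ xs) v → v ∈ words xs (length v)
∈-words⁺ [] _ = here refl
∈-words⁺ (x ∷ v) (x∈ ∷ v∈) = ∈-cartesianProductWith⁺ _∷_ x∈ (∈-words⁺ v v∈)

∈-words⁻ : ∀ {A : Set} {xs : List A} k {v} → v ∈ words xs k → length v ≡ k × All (_∈ xs) v
∈-words⁻ zero (here refl) = refl , []
∈-words⁻ {xs = xs} (suc k) v∈ with ∈-cartesianProductWith⁻ _∷_ xs (words xs k) v∈
... | _ , _ , a∈ , b∈ , refl with ∈-words⁻ k b∈
... | len , all = cong suc len , a∈ ∷ all

-- The sum of `p` over all words, unfolded at the first letter: `p` absorbs the letters already
-- chosen, and Pascal's rule can be applied one letter at a time.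
total : ∀ {A : Set} → List A → ℕ → (List A → ℕ) → ℕ
total zs zero    p = p []
total zs (suc m) p = sum (map (λ z → total zs m (p ∘ (z ∷_))) zs)

total-cong : ∀ {A : Set} (zs : List A) m {p q : List A → ℕ} → (∀ c → p c ≡ q c) → total zs m p ≡ total zs m q
total-cong zs zero    p≗q = p≗q []
total-cong zs (suc m) p≗q = cong sum (Listₚ.map-cong (λ z → total-cong zs m (p≗q ∘ (z ∷_))) zs)

sum-map-cartesian : ∀ {A B C : Set} (f : A → B → C) (p : C → ℕ) (xs : List A) (ys : List B) →
  sum (map p (cartesianProductWith f xs ys)) ≡ sum (map (λ x → sum (map (p ∘ f x) ys)) xs)
sum-map-cartesian f p [] ys = refl
sum-map-cartesian f p (x ∷ xs) ys = begin
  sum (map p (map (f x) ys ++ cartesianProductWith f xs ys))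
    ≡⟨ cong sum (Listₚ.map-++ p (map (f x) ys) _) ⟩
  sum (map p (map (f x) ys) ++ map p (cartesianProductWith f xs ys))
    ≡⟨ sum-++ (map p (map (f x) ys)) _ ⟩
  sum (map p (map (f x) ys)) + sum (map p (cartesianProductWith f xs ys))
    ≡⟨ cong₂ _+_ (cong sum (sym (Listₚ.map-∘ ys))) (sum-map-cartesian f p xs ys) ⟩
  sum (map (p ∘ f x) ys) + sum (map (λ x → sum (map (p ∘ f x) ys)) xs) ∎
  where
  open ≡-Reasoning

total-words : ∀ {A : Set} (zs : List A) m (p : List A → ℕ) → sum (map p (words zs m)) ≡ total zs m p
total-words zs zero    p = ℕₚ.+-identityʳ _
total-words zs (suc m) p = trans (sum-map-cartesian _∷_ p zs (words zs m))
  (cong sum (Listₚ.map-cong (λ z → total-words zs m (p ∘ (z ∷_))) zs))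

length-filter-map : ∀ {A B : Set} (f : A → B) {P : B → Set} (P? : Decidable P) xs →
  length (filter P? (map f xs)) ≡ length (filter (P? ∘ f) xs)
length-filter-map f P? [] = refl
length-filter-map f P? (x ∷ xs) with does (P? (f x))
... | false = length-filter-map f P? xs
... | true  = cong suc (length-filter-map f P? xs)

length-filter-product : ∀ {A B : Set} {P : A × B → Set} (P? : Decidable P) (xs : List A) (ys : List B) →
  length (filter P? (cartesianProduct xs ys)) ≡ sum (map (λ x → length (filter (λ y → P? (x , y)) ys)) xs)
length-filter-product P? [] ys = refl
length-filter-product P? (x ∷ xs) ys = begin
  length (filter P? (map (x ,_) ys ++ cartesianProduct xs ys))
    ≡⟨ cong length (Listₚ.filter-++ P? (map (x ,_) ys) _) ⟩
  length (filter P? (map (x ,_) ys) ++ filter P? (cartesianProduct xs ys))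
    ≡⟨ Listₚ.length-++ (filter P? (map (x ,_) ys)) ⟩
  length (filter P? (map (x ,_) ys)) + length (filter P? (cartesianProduct xs ys))
    ≡⟨ cong₂ _+_ (length-filter-map (x ,_) P? ys) (length-filter-product P? xs ys) ⟩
  length (filter (λ y → P? (x , y)) ys) + sum (map (λ x → length (filter (λ y → P? (x , y)) ys)) xs) ∎
  where open ≡-Reasoning

Σ< : ℕ → (ℕ → ℕ) → ℕ
Σ< zero    f = 0
Σ< (suc k) f = f 0 + Σ< k (f ∘ suc)

Σ<-cong : ∀ k {f g : ℕ → ℕ} → (∀ i → i < k → f i ≡ g i) → Σ< k f ≡ Σ< k g
Σ<-cong zero    eq = refl
Σ<-cong (suc k) eq = cong₂ _+_ (eq 0 z<s) (Σ<-cong k (λ i i<k → eq (suc i) (s<s i<k)))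

Σ<-+ : ∀ k (f g : ℕ → ℕ) → Σ< k (λ i → f i + g i) ≡ Σ< k f + Σ< k g
Σ<-+ zero    f g = refl
Σ<-+ (suc k) f g = trans (cong (_+_ (f 0 + g 0)) (Σ<-+ k (f ∘ suc) (g ∘ suc)))
  (solve 4 (λ a b c d → a :+ b :+ (c :+ d) := a :+ c :+ (b :+ d)) refl (f 0) (g 0) (Σ< k (f ∘ suc)) (Σ< k (g ∘ suc)))
  where open Data.Nat.Solver.+-*-Solver

Σ<-zero : ∀ k {f : ℕ → ℕ} → (∀ i → i < k → f i ≡ 0) → Σ< k f ≡ 0
Σ<-zero zero    eq = refl
Σ<-zero (suc k) eq = cong₂ _+_ (eq 0 z<s) (Σ<-zero k (λ i i<k → eq (suc i) (s<s i<k)))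

Σ<-*ˡ : ∀ k c (f : ℕ → ℕ) → Σ< k (λ i → c * f i) ≡ c * Σ< k f
Σ<-*ˡ zero    c f = sym (ℕₚ.*-zeroʳ c)
Σ<-*ˡ (suc k) c f = trans (cong (_+_ (c * f 0)) (Σ<-*ˡ k c (f ∘ suc))) (sym (ℕₚ.*-distribˡ-+ c (f 0) _))

Σ<-truncate : ∀ a b (f : ℕ → ℕ) → (∀ i → a ≤ i → f i ≡ 0) → Σ< (a + b) f ≡ Σ< a f
Σ<-truncate zero    b f eq = Σ<-zero b (λ i _ → eq i z≤n)
Σ<-truncate (suc a) b f eq = cong (_+_ (f 0)) (Σ<-truncate a b (f ∘ suc) (λ i a≤i → eq (suc i) (s≤s a≤i)))

sum-Σ<-swap : ∀ {A : Set} (zs : List A) k (f : A → ℕ → ℕ) →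
  sum (map (λ z → Σ< k (f z)) zs) ≡ Σ< k (λ i → sum (map (λ z → f z i) zs))
sum-Σ<-swap []       k f = sym (Σ<-zero k (λ _ _ → refl))
sum-Σ<-swap (z ∷ zs) k f = trans (cong (_+_ (Σ< k (f z))) (sum-Σ<-swap zs k f)) (sym (Σ<-+ k (f z) _))

sum-map-*ˡ : ∀ {A : Set} (zs : List A) c (f : A → ℕ) → sum (map (λ z → c * f z) zs) ≡ c * sum (map f zs)
sum-map-*ˡ []       c f = sym (ℕₚ.*-zeroʳ c)
sum-map-*ˡ (z ∷ zs) c f = trans (cong (_+_ (c * f z)) (sum-map-*ˡ zs c f)) (sym (ℕₚ.*-distribˡ-+ c (f z) _))

nC0≡1 : ∀ n → n choose 0 ≡ 1
nC0≡1 n = trans (nCk≡nC[n∸k] {0} {n} z≤n) (nCn≡1 n)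

-- A word over z₀ ∷ zs is a word over zs with some letters z₀ inserted.
total-insert : ∀ {A : Set} (z₀ : A) (zs : List A) m k (p : List A → ℕ) → m < k →
  (∀ xs ys → p (xs ++ z₀ ∷ ys) ≡ p (xs ++ ys)) →
  total (z₀ ∷ zs) m p ≡ Σ< k (λ i → (m choose i) * total zs i p)
total-insert z₀ zs zero (suc k) p _ inv = sym (begin
  (0 choose 0) * p [] + Σ< k (λ i → (0 choose suc i) * total zs (suc i) p)
    ≡⟨ cong₂ _+_ (trans (cong (_* p []) (nC0≡1 0)) (ℕₚ.*-identityˡ (p [])))
         (Σ<-zero k (λ i _ → cong (_* total zs (suc i) p) (k>n⇒nCk≡0 {0} {suc i} z<s))) ⟩
  p [] + 0 ≡⟨ ℕₚ.+-identityʳ (p []) ⟩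
  p [] ∎)
  where open ≡-Reasoning
total-insert z₀ zs (suc m) (suc k) p (s≤s m<k) inv = begin
  total (z₀ ∷ zs) m (p ∘ (z₀ ∷_)) + sum (map (λ z → total (z₀ ∷ zs) m (p ∘ (z ∷_))) zs)
    -- Words that start with `z₀` lose this letter by `inv`; for any other first letter `z` the
    -- weight `p ∘ (z ∷_)` satisfies `inv` again. The two groups give the two terms of Pascal's
    -- rule.
    ≡⟨ cong₂ _+_
         (trans (total-cong (z₀ ∷ zs) m (inv []))
                (total-insert z₀ zs m (suc k) p (ℕₚ.m≤n⇒m≤1+n m<k) inv))
         (cong sum (Listₚ.map-cong (λ z → total-insert z₀ zs m k (p ∘ (z ∷_)) m<k (λ xs → inv (z ∷ xs))) zs)) ⟩
  (m choose 0) * g 0 + Σ< k (λ i → (m choose suc i) * g (suc i)) + sum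
    (map (λ z → Σ< k (λ i → (m choose i) * total zs i (p ∘ (z ∷_)))) zs)
    ≡⟨ cong₂ _+_ (cong (λ c → c * g 0 + Σ< k (λ i → (m choose suc i) * g (suc i)))
      (trans (nC0≡1 m) (sym (nC0≡1 (suc m)))))
         (trans (sum-Σ<-swap zs k (λ z i → (m choose i) * total zs i (p ∘ (z ∷_))))
                (Σ<-cong k (λ i _ → sum-map-*ˡ zs (m choose i) (λ z → total zs i (p ∘ (z ∷_)))))) ⟩
  (suc m choose 0) * g 0 + Σ< k (λ i → (m choose suc i) * g (suc i)) + Σ< k (λ i → (m choose i) * g (suc i))
    ≡⟨ ℕₚ.+-assoc ((suc m choose 0) * g 0) _ _ ⟩
  (suc m choose 0) * g 0 + (Σ< k (λ i → (m choose suc i) * g (suc i)) + Σ< k (λ i → (m choose i) * g (suc i)))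
    ≡⟨ cong (_+_ ((suc m choose 0) * g 0))
      (sym (Σ<-+ k (λ i → (m choose suc i) * g (suc i)) (λ i → (m choose i) * g (suc i)))) ⟩
  (suc m choose 0) * g 0 + Σ< k (λ i → (m choose suc i) * g (suc i) + (m choose i) * g (suc i))
    ≡⟨ cong (_+_ ((suc m choose 0) * g 0)) (Σ<-cong k (λ i _ → pascal i)) ⟩
  (suc m choose 0) * g 0 + Σ< k (λ i → (suc m choose suc i) * g (suc i)) ∎
  where
  open ≡-Reasoning
  g : ℕ → ℕ
  g i = total zs i p
  pascal : ∀ i → (m choose suc i) * g (suc i) + (m choose i) * g (suc i) ≡ (suc m choose suc i) * g (suc i)
  pascal i = trans (sym (ℕₚ.*-distribʳ-+ (g (suc i)) (m choose suc i) (m choose i)))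
    (cong (_* g (suc i)) (trans (ℕₚ.+-comm (m choose suc i) (m choose i)) (nCk+nC[k+1]≡[n+1]C[k+1] m i)))

-- Alternating sequences and partial sums

Bit : ℤ → Set
Bit z = z ≡ + 0 ⊎ z ≡ + 1

-- Started at 0 and ending at 1, this is the alternation of a row with sum 1, read from the left.
Walk : ℤ → List ℤ → Set
Walk s []       = ⊤
Walk s (x ∷ xs) = Bit (s ℤ.+ x) × Walk (s ℤ.+ x) xs

-- Columns are listed from the bottom, so suffix sums are sums from the top. The condition captures
-- alternation together with a positive topmost nonzero entry.
BitSuffixes : List ℤ → Set
BitSuffixes []       = ⊤
BitSuffixes (x ∷ xs) = Bit (sumℤ (x ∷ xs)) × BitSuffixes xs

nonzeros : List ℤ → List ℤ
nonzeros = filterᵇ (λ x → not (x ≡ᶻ + 0))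

opposite : List ℤ → Bool
opposite (x ∷ y ∷ ys) = ((x ℤ.* y) <ᶻ + 0) ∧ opposite (y ∷ ys)
opposite _            = true

-- The local function of `alternating` has no name outside Defs; the
-- underscore is solved to it by the use in alternating-spec.
mutual
  alternating-spec : (xs : List ℤ) → alternating xs ≡ opposite (nonzeros xs)
  alternating-spec xs with filterᵇ (λ x → not (x ≡ᶻ + 0)) xs
  ... | ys = alternating-local xs ys

  alternating-local : (xs ys : List ℤ) → _ ≡ opposite ys
  alternating-local xs []           = refl
  alternating-local xs (x ∷ [])     = refl
  alternating-local xs (x ∷ y ∷ ys) = cong (_ ∧_) (alternating-local xs (y ∷ ys))

true≢false : true ≢ false
true≢false ()

∧-true⁻ : ∀ {a b} → a ∧ b ≡ true → a ≡ true × b ≡ true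
∧-true⁻ {true} eq = refl , eq

∧-true⁺ : ∀ {a b} → a ≡ true → b ≡ true → a ∧ b ≡ true
∧-true⁺ refl refl = refl

does-true⁻ : ∀ {P : Set} (d : Dec P) → does d ≡ true → P
does-true⁻ (yes p) _ = p

does-true⁺ : ∀ {P : Set} (d : Dec P) → P → does d ≡ true
does-true⁺ (yes _) _ = refl
does-true⁺ (no ¬p) p = contradiction p ¬p

0+ : ∀ z → + 0 ℤ.+ z ≡ z
0+ = ℤₚ.+-identityˡ

cancel : ∀ s x → (s ℤ.+ x) ℤ.- s ≡ x
cancel s x = trans (cong (ℤ._- s) (ℤₚ.+-comm s x))
  (trans (ℤₚ.+-assoc x s (ℤ.- s)) (trans (cong (ℤ._+_ x) (ℤₚ.+-inverseʳ s)) (ℤₚ.+-identityʳ x)))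

bit-step : ∀ {s x} → Bit s → Bit (s ℤ.+ x) → x ∈ entries
bit-step {s} {x} b c = subst (_∈ entries) (cancel s x) (go b c)
  where
  go : ∀ {s t} → Bit s → Bit t → t ℤ.- s ∈ entries
  go (inj₁ refl) (inj₁ refl) = there (here refl)
  go (inj₁ refl) (inj₂ refl) = there (there (here refl))
  go (inj₂ refl) (inj₁ refl) = here refl
  go (inj₂ refl) (inj₂ refl) = there (here refl)

walk-entries : ∀ {s} xs → Bit s → Walk s xs → All (_∈ entries) xs
walk-entries []       _ _       = []
walk-entries (x ∷ xs) b (c , w) = bit-step {_} {x} b c ∷ walk-entries xs c w

suffix-head : ∀ xs → BitSuffixes xs → Bit (sumℤ xs)
suffix-head []       _ = inj₁ refl
suffix-head (x ∷ xs) w = proj₁ w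

suffix-entries : ∀ xs → BitSuffixes xs → All (_∈ entries) xs
suffix-entries []       _       = []
suffix-entries (x ∷ xs) (b , w) =
  bit-step {sumℤ xs} {x} (suffix-head xs w) (subst Bit (ℤₚ.+-comm x (sumℤ xs)) b) ∷ suffix-entries xs w

walk-sum : ∀ {s} xs → Bit s → Walk s xs → Bit (s ℤ.+ sumℤ xs)
walk-sum {s} []       b _       = subst Bit (sym (ℤₚ.+-identityʳ s)) b
walk-sum {s} (x ∷ xs) b (c , w) = subst Bit (ℤₚ.+-assoc s x (sumℤ xs)) (walk-sum xs c w)

-- The last nonzero entry read determines the current partial sum: 1 after +1 and 0 after -1.
-- Prepending that entry to `nonzeros xs` therefore encodes the starting point of the walk.
opposite⇒walk : ∀ {xs} → All (_∈ entries) xs →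
  (opposite (+ 1 ∷ nonzeros xs) ≡ true → Walk (+ 1) xs) ×
  (opposite (-[1+ 0 ] ∷ nonzeros xs) ≡ true → Walk (+ 0) xs)
opposite⇒walk [] = (λ _ → tt) , λ _ → tt
opposite⇒walk (here refl ∷ es) = (λ eq → inj₁ refl , proj₂ (opposite⇒walk es) eq) , λ ()
opposite⇒walk (there (here refl) ∷ es) =
  (λ eq → inj₂ refl , proj₁ (opposite⇒walk es) eq) , (λ eq → inj₁ refl , proj₂ (opposite⇒walk es) eq)
opposite⇒walk (there (there (here refl)) ∷ es) = (λ ()) , λ eq → inj₂ refl , proj₁ (opposite⇒walk es) eq

walk⇒opposite : ∀ xs →
  (Walk (+ 1) xs → opposite (+ 1 ∷ nonzeros xs) ≡ true) ×
  (Walk (+ 0) xs → opposite (-[1+ 0 ] ∷ nonzeros xs) ≡ true)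
walk⇒opposite [] = (λ _ → refl) , λ _ → refl
walk⇒opposite (x ∷ xs) = one , nought
  where
  one : Walk (+ 1) (x ∷ xs) → opposite (+ 1 ∷ nonzeros (x ∷ xs)) ≡ true
  one (b , w) with bit-step {+ 1} {x} (inj₂ refl) b | b
  ... | here refl                 | _ = proj₂ (walk⇒opposite xs) w
  ... | there (here refl)         | _ = proj₁ (walk⇒opposite xs) w
  ... | there (there (here refl)) | inj₁ ()
  ... | there (there (here refl)) | inj₂ ()
  nought : Walk (+ 0) (x ∷ xs) → opposite (-[1+ 0 ] ∷ nonzeros (x ∷ xs)) ≡ true
  nought (b , w) with bit-step {+ 0} {x} (inj₁ refl) b | b
  ... | here refl                 | inj₁ ()
  ... | here refl                 | inj₂ ()
  ... | there (here refl)         | _ = proj₂ (walk⇒opposite xs) w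
  ... | there (there (here refl)) | _ = proj₁ (walk⇒opposite xs) w

row⇒walk : ∀ {xs} → All (_∈ entries) xs → alternating xs ≡ true → sumℤ xs ≡ + 1 → Walk (+ 0) xs
row⇒walk {xs} es alt = go es (trans (sym (alternating-spec xs)) alt)
  where
  go : ∀ {xs} → All (_∈ entries) xs → opposite (nonzeros xs) ≡ true → sumℤ xs ≡ + 1 → Walk (+ 0) xs
  go [] _ ()
  -- A leading -1 cannot occur: what follows it sums to at most 1, so the row would sum to at most
  -- 0.
  go {_ ∷ xs} (here refl ∷ es) alt s
    with sumℤ xs | walk-sum xs (inj₁ refl) (proj₂ (opposite⇒walk es) alt)
  ... | t | b with trans (sym (0+ t)) (trans (sym (cancel (-[1+ 0 ]) (+ 0 ℤ.+ t)))
    (cong (ℤ._- -[1+ 0 ]) (trans (cong (ℤ._+_ -[1+ 0 ]) (0+ t)) s)))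
  ... | refl with b
  ... | inj₁ ()
  ... | inj₂ ()
  go {_ ∷ xs} (there (here refl) ∷ es) alt s = inj₁ refl , go es alt (trans (sym (0+ (sumℤ xs))) s)
  go (there (there (here refl)) ∷ es) alt s = inj₂ refl , proj₁ (opposite⇒walk es) alt

-- A fictitious -1 in front of the row stands for the starting value 0; dropping it preserves
-- alternation.
walk⇒row : ∀ xs → Walk (+ 0) xs → alternating xs ≡ true
walk⇒row xs w = trans (alternating-spec xs) (tail (nonzeros xs) (proj₂ (walk⇒opposite xs) w))
  where
  tail : ∀ ys → opposite (-[1+ 0 ] ∷ ys) ≡ true → opposite ys ≡ true
  tail []       _  = refl
  tail (y ∷ ys) eq = proj₂ (∧-true⁻ eq)

-- In an alternating column with positive topmost nonzero entry, the lowest nonzero entry determines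
-- the sum: 1 for +1, and 0 for -1 or a zero column. The induction adds entries from below and needs
-- this to decide which entry may come next.
data Lead (xs : List ℤ) : Set where
  lead-plus  : ∀ {ys} → sumℤ xs ≡ + 1 → nonzeros xs ≡ + 1 ∷ ys → Lead xs
  lead-minus : ∀ {ys} → sumℤ xs ≡ + 0 → nonzeros xs ≡ -[1+ 0 ] ∷ ys → Lead xs
  lead-none  : sumℤ xs ≡ + 0 → nonzeros xs ≡ [] → All (_≡ + 0) xs → Lead xs

lead-0∷ : ∀ {xs} → Lead xs → Lead (+ 0 ∷ xs)
lead-0∷ {xs} (lead-plus s f)   = lead-plus (trans (0+ (sumℤ xs)) s) f
lead-0∷ {xs} (lead-minus s f)  = lead-minus (trans (0+ (sumℤ xs)) s) f
lead-0∷ {xs} (lead-none s f z) = lead-none (trans (0+ (sumℤ xs)) s) f (refl ∷ z)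

firstNonzero-zeros : ∀ {ys} x → All (_≡ + 0) ys → firstNonzeroPositive (ys ++ x ∷ []) ≡ firstNonzeroPositive (x ∷ [])
firstNonzero-zeros x [] = refl
firstNonzero-zeros x (refl ∷ z) = firstNonzero-zeros x z

firstNonzero-init : ∀ ys x → firstNonzeroPositive (ys ++ x ∷ []) ≡ true → firstNonzeroPositive ys ≡ true
firstNonzero-init []       x eq = refl
firstNonzero-init (y ∷ ys) x eq with y ≡ᶻ + 0
... | true  = firstNonzero-init ys x eq
... | false = eq

firstNonzero-snoc : ∀ ys x → firstNonzeroPositive ys ≡ true → (All (_≡ + 0) ys → firstNonzeroPositive (x ∷ []) ≡ true)
  →
  firstNonzeroPositive (ys ++ x ∷ []) ≡ true
firstNonzero-snoc []       x _  imp = imp []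
firstNonzero-snoc (y ∷ ys) x eq imp with y ℤ.≟ + 0
... | yes y≡0 = firstNonzero-snoc ys x eq (λ z → imp (y≡0 ∷ z))
... | no  _   = eq

all-reverse : ∀ {A : Set} {P : A → Set} {xs} → All P xs → All P (reverse xs)
all-reverse [] = []
all-reverse {xs = x ∷ xs} (p ∷ ps) = subst (All _) (sym (Listₚ.unfold-reverse x xs))
  (Allₚ.++⁺ (all-reverse ps) (p ∷ []))

column⇒suffixes : ∀ {xs} → All (_∈ entries) xs → alternating xs ≡ true →
  firstNonzeroPositive (reverseℤ xs) ≡ true → BitSuffixes xs
column⇒suffixes {xs} es alt pos = proj₁ (go es (trans (sym (alternating-spec xs)) alt) pos)
  where
  tail : ∀ y ys → opposite (y ∷ ys) ≡ true → opposite ys ≡ true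
  tail y []       _  = refl
  tail y (_ ∷ ys) eq = proj₂ (∧-true⁻ eq)
  init : ∀ x xs → firstNonzeroPositive (reverseℤ (x ∷ xs)) ≡ true → firstNonzeroPositive (reverseℤ xs) ≡ true
  init x xs eq = firstNonzero-init (reverse xs) x (trans (cong firstNonzeroPositive (sym (Listₚ.unfold-reverse x xs)))
    eq)
  go : ∀ {xs} → All (_∈ entries) xs → opposite (nonzeros xs) ≡ true →
    firstNonzeroPositive (reverseℤ xs) ≡ true → BitSuffixes xs × Lead xs
  go [] _ _ = tt , lead-none refl refl []
  go {_ ∷ xs} (there (here refl) ∷ es) alt pos with go es alt (init (+ 0) xs pos)
  ... | w , l = (subst Bit (sym (0+ (sumℤ xs))) (suffix-head xs w) , w) , lead-0∷ l
  go {_ ∷ xs} (here refl ∷ es) alt pos with go es (tail _ (nonzeros xs) alt) (init _ xs pos)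
  ... | w , lead-plus s f = (inj₁ (cong (ℤ._+_ -[1+ 0 ]) s) , w) , lead-minus (cong (ℤ._+_ -[1+ 0 ]) s) refl
  ... | w , lead-minus s f with () ← trans (sym alt) (cong (opposite ∘ (-[1+ 0 ] ∷_)) f)
  -- A -1 with only zeros above it would be the topmost nonzero entry.
  ... | w , lead-none s f z with () ← trans (sym pos)
    (trans (cong firstNonzeroPositive (Listₚ.unfold-reverse -[1+ 0 ] xs))
                                  (firstNonzero-zeros -[1+ 0 ] (all-reverse z)))
  go {_ ∷ xs} (there (there (here refl)) ∷ es) alt pos with go es (tail _ (nonzeros xs) alt) (init _ xs pos)
  ... | w , lead-plus s f with () ← trans (sym alt) (cong (opposite ∘ (+ 1 ∷_)) f)
  ... | w , lead-minus s f = (inj₂ (cong (ℤ._+_ (+ 1)) s) , w) , lead-plus (cong (ℤ._+_ (+ 1)) s) refl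
  ... | w , lead-none s f z = (inj₂ (cong (ℤ._+_ (+ 1)) s) , w) , lead-plus (cong (ℤ._+_ (+ 1)) s) refl

suffixes⇒column : ∀ xs → BitSuffixes xs → alternating xs ≡ true × firstNonzeroPositive (reverseℤ xs) ≡ true
suffixes⇒column xs w with go xs w
  where
  snoc : ∀ x xs → firstNonzeroPositive (reverseℤ xs) ≡ true →
    (All (_≡ + 0) xs → firstNonzeroPositive (x ∷ []) ≡ true) → firstNonzeroPositive (reverseℤ (x ∷ xs)) ≡ true
  snoc x xs pos imp = trans (cong firstNonzeroPositive (Listₚ.unfold-reverse x xs))
    (firstNonzero-snoc (reverse xs) x pos (λ z → imp (subst (All _) (Listₚ.reverse-involutive xs) (all-reverse z))))
  zeros-nonzeros : ∀ {xs} → All (_≡ + 0) xs → nonzeros xs ≡ []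
  zeros-nonzeros [] = refl
  zeros-nonzeros (refl ∷ z) = zeros-nonzeros z
  nonempty : ∀ {xs y ys} → nonzeros xs ≡ y ∷ ys → ¬ All (_≡ + 0) xs
  nonempty f z with () ← trans (sym f) (zeros-nonzeros z)
  go : ∀ xs → BitSuffixes xs → opposite (nonzeros xs) ≡ true × firstNonzeroPositive (reverseℤ xs) ≡ true × Lead xs
  go [] _ = refl , refl , lead-none refl refl []
  go (x ∷ xs) (b , w) with bit-step {sumℤ xs} {x} (suffix-head xs w) (subst Bit (ℤₚ.+-comm x (sumℤ xs)) b) | go xs w |
    b
  ... | there (here refl) | alt , pos , l | _ = alt , snoc (+ 0) xs pos (λ _ → refl) , lead-0∷ l
  ... | here refl | alt , pos , lead-plus s f | _ =
    trans (cong (opposite ∘ (-[1+ 0 ] ∷_)) f) (trans (cong opposite (sym f)) alt) ,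
    snoc _ xs pos (⊥-elim ∘ nonempty f) , lead-minus (cong (ℤ._+_ -[1+ 0 ]) s) refl
  ... | here refl | alt , pos , lead-minus s f | b′ with subst (Bit ∘ (ℤ._+_ -[1+ 0 ])) s b′
  ... | inj₁ ()
  ... | inj₂ ()
  go (x ∷ xs) (b , w) | here refl | alt , pos , lead-none s f z | b′ with subst (Bit ∘ (ℤ._+_ -[1+ 0 ])) s b′
  ... | inj₁ ()
  ... | inj₂ ()
  go (x ∷ xs) (b , w) | there (there (here refl)) | alt , pos , lead-plus s f | b′ with subst (Bit ∘ (ℤ._+_ (+ 1))) s
    b′
  ... | inj₁ ()
  ... | inj₂ ()
  go (x ∷ xs) (b , w) | there (there (here refl)) | alt , pos , lead-minus s f | b′ =
    trans (cong (opposite ∘ (+ 1 ∷_)) f) (trans (cong opposite (sym f)) alt) ,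
    snoc _ xs pos (λ _ → refl) , lead-plus (cong (ℤ._+_ (+ 1)) s) refl
  go (x ∷ xs) (b , w) | there (there (here refl)) | alt , pos , lead-none s f z | b′ =
    cong (opposite ∘ (+ 1 ∷_)) f , snoc _ xs pos (λ _ → refl) , lead-plus (cong (ℤ._+_ (+ 1)) s) refl
... | alt , pos , _ = trans (alternating-spec xs) alt , pos

-- Quantifiers over indexed lists, vectors and transposed matrices

all-zip : ∀ {B : Set} (p : ℕ × B → Bool) (s : ℕ) (f : ℕ → ℕ) → (∀ k → f k ≡ s + k) → ∀ {k} (v : Vec B k) →
  all p (zip (applyUpTo f (length (Vec.toList v))) (Vec.toList v)) ≡ true ⇔
  (∀ i → p (s + toℕ i , Vec.lookup v i) ≡ true)
all-zip p s f f≗ [] = mk⇔ (λ _ ()) (λ _ → refl)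
all-zip p s f f≗ (x ∷ v) = mk⇔
  (λ eq → λ { zero    → trans (cong (λ j → p (j , x)) (sym (f≗ 0))) (proj₁ (∧-true⁻ eq))
            ; (suc i) → trans (cong (λ j → p (j , Vec.lookup v i)) (ℕₚ.+-suc s (toℕ i)))
                              (to ih (proj₂ (∧-true⁻ {p (f 0 , x)} eq)) i) })
  (λ h → ∧-true⁺ (trans (cong (λ j → p (j , x)) (f≗ 0)) (h zero))
    (from ih (λ i → trans (cong (λ j → p (j , Vec.lookup v i)) (sym (ℕₚ.+-suc s (toℕ i)))) (h (suc i)))))
  where ih = all-zip p (suc s) (f ∘ suc) (λ k → trans (f≗ (suc k)) (ℕₚ.+-suc s k)) v

all-indexed : ∀ {A B : Set} (p : ℕ × B → Bool) (f : A → B) {k} (v : Vec A k) →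
  all p (indexed (map f (Vec.toList v))) ≡ true ⇔ (∀ i → p (toℕ i , f (Vec.lookup v i)) ≡ true)
all-indexed p f v = mk⇔
  (λ eq i → trans (cong (λ b → p (toℕ i , b)) (sym (Vecₚ.lookup-map i f v)))
    (to (all-zip p 0 id (λ _ → refl) (Vec.map f v)) (trans (cong (all p ∘ indexed) (Vecₚ.toList-map f v)) eq) i))
  (λ h → trans (cong (all p ∘ indexed) (sym (Vecₚ.toList-map f v)))
    (from (all-zip p 0 id (λ _ → refl) (Vec.map f v))
      (λ i → trans (cong (λ b → p (toℕ i , b)) (Vecₚ.lookup-map i f v)) (h i))))

all-lookup : ∀ {A B : Set} (p : B → Bool) (f : A → B) {k} (v : Vec A k) →
  all p (map f (Vec.toList v)) ≡ true ⇔ (∀ i → p (f (Vec.lookup v i)) ≡ true)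
all-lookup p f [] = mk⇔ (λ _ ()) (λ _ → refl)
all-lookup p f (x ∷ v) = mk⇔
  (λ eq → λ { zero → proj₁ (∧-true⁻ eq) ; (suc i) → to (all-lookup p f v) (proj₂ (∧-true⁻ {p (f x)} eq)) i })
  (λ h → ∧-true⁺ (h zero) (from (all-lookup p f v) (h ∘ suc)))

lookup-transpose : ∀ {A : Set} {n k} (M : Vec (Vec A k) n) j →
  Vec.lookup (Vec.transpose M) j ≡ Vec.map (λ row → Vec.lookup row j) M
lookup-transpose [] j = Vecₚ.lookup-replicate j []
lookup-transpose {A} {suc n} {k} (row ∷ M) j = begin
  Vec.lookup ((Vec.replicate k cons Vec.⊛ row) Vec.⊛ Vec.transpose M) j
    ≡⟨ Vecₚ.lookup-⊛ j (Vec.replicate k cons Vec.⊛ row) (Vec.transpose M) ⟩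
  Vec.lookup (Vec.replicate k cons Vec.⊛ row) j (Vec.lookup (Vec.transpose M) j)
    ≡⟨ cong (λ f → f (Vec.lookup (Vec.transpose M) j)) (Vecₚ.lookup-⊛ j (Vec.replicate k cons) row) ⟩
  Vec.lookup (Vec.replicate k cons) j (Vec.lookup row j) (Vec.lookup (Vec.transpose M) j)
    ≡⟨ cong (λ f → f (Vec.lookup row j) (Vec.lookup (Vec.transpose M) j)) (Vecₚ.lookup-replicate j cons) ⟩
  cons (Vec.lookup row j) (Vec.lookup (Vec.transpose M) j)
    ≡⟨ cong (cons (Vec.lookup row j)) (lookup-transpose M j) ⟩
  cons (Vec.lookup row j) (Vec.map (λ row → Vec.lookup row j) M) ∎
  where
  open ≡-Reasoning
  cons : A → Vec A n → Vec A (suc n)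
  cons = _∷_

lookup-lookup-transpose : ∀ {A : Set} {n k} (M : Vec (Vec A k) n) j r →
  Vec.lookup (Vec.lookup (Vec.transpose M) j) r ≡ Vec.lookup (Vec.lookup M r) j
lookup-lookup-transpose M j r =
  trans (cong (λ x → Vec.lookup x r) (lookup-transpose M j)) (Vecₚ.lookup-map r _ M)

vec-ext : ∀ {A : Set} {k} {v w : Vec A k} → (∀ i → Vec.lookup v i ≡ Vec.lookup w i) → v ≡ w
vec-ext {v = []}    {[]}    eq = refl
vec-ext {v = x ∷ v} {y ∷ w} eq = cong₂ _∷_ (eq zero) (vec-ext (eq ∘ suc))

≤ᶻ-true⁻ : ∀ {x y} → (x ≤ᶻ y) ≡ true → x ℤ.≤ y
≤ᶻ-true⁻ eq = ℤₚ.≤ᵇ⇒≤ (from T-≡ eq)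

≤ᶻ-true⁺ : ∀ {x y} → x ℤ.≤ y → (x ≤ᶻ y) ≡ true
≤ᶻ-true⁺ le = to T-≡ (ℤₚ.≤⇒≤ᵇ le)

≡ᶻ-true⁻ : ∀ {x y} → (x ≡ᶻ y) ≡ true → x ≡ y
≡ᶻ-true⁻ {x} {y} = does-true⁻ (x ℤ.≟ y)

≡ᶻ-true⁺ : ∀ {x y} → x ≡ y → (x ≡ᶻ y) ≡ true
≡ᶻ-true⁺ {x} {y} = does-true⁺ (x ℤ.≟ y)

not-true⇒false : ∀ {b} → (b ≡ true → ⊥) → b ≡ false
not-true⇒false {false} _ = refl
not-true⇒false {true}  h = ⊥-elim (h refl)

any⁻ : ∀ {A : Set} (p : A → Bool) xs → any p xs ≡ true → ∃ λ x → x ∈ xs × p x ≡ true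
any⁻ p (x ∷ xs) eq with p x in px
... | true  = x , here refl , px
... | false with any⁻ p xs eq
... | y , y∈ , py = y , there y∈ , py

any⁺ : ∀ {A : Set} (p : A → Bool) {x xs} → x ∈ xs → p x ≡ true → any p xs ≡ true
any⁺ p {xs = x ∷ xs} (here refl) px rewrite px = refl
any⁺ p {xs = y ∷ xs} (there x∈) px with p y
... | true  = refl
... | false = any⁺ p x∈ px

all⁻ : ∀ {A : Set} (p : A → Bool) {x} xs → all p xs ≡ true → x ∈ xs → p x ≡ true
all⁻ p (x ∷ xs) eq (here refl) = proj₁ (∧-true⁻ eq)
all⁻ p (x ∷ xs) eq (there x∈)  = all⁻ p xs (proj₂ (∧-true⁻ {p x} eq)) x∈

all⁺ : ∀ {A : Set} (p : A → Bool) xs → (∀ {x} → x ∈ xs → p x ≡ true) → all p xs ≡ true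
all⁺ p []       h = refl
all⁺ p (x ∷ xs) h = ∧-true⁺ (h (here refl)) (all⁺ p xs (h ∘ there))

∈ᶻ⁻ : ∀ {z xs} → (z ∈ᶻ xs) ≡ true → z ∈ xs
∈ᶻ⁻ {z} {xs} eq with any⁻ (λ y → z ≡ᶻ y) xs eq
... | y , y∈ , e = subst (_∈ xs) (sym (≡ᶻ-true⁻ {z} {y} e)) y∈

∈ᶻ⁺ : ∀ {z xs} → z ∈ xs → (z ∈ᶻ xs) ≡ true
∈ᶻ⁺ {z} z∈ = any⁺ (λ y → z ≡ᶻ y) z∈ (≡ᶻ-true⁺ {z} refl)

sameSet⇔ : ∀ {xs ys} → sameSet xs ys ≡ true ⇔ ((∀ z → z ∈ xs → z ∈ ys) × (∀ z → z ∈ ys → z ∈ xs))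
sameSet⇔ {xs} {ys} = mk⇔
  (λ eq → (λ _ z∈ → ∈ᶻ⁻ (all⁻ (_∈ᶻ ys) xs (proj₁ (∧-true⁻ eq)) z∈)) ,
          (λ _ z∈ → ∈ᶻ⁻ (all⁻ (_∈ᶻ xs) ys (proj₂ (∧-true⁻ {all (_∈ᶻ ys) xs} eq)) z∈)))
  (λ hk → ∧-true⁺ (all⁺ (_∈ᶻ ys) xs (λ z∈ → ∈ᶻ⁺ (proj₁ hk _ z∈))) (all⁺ (_∈ᶻ xs) ys (λ z∈ → ∈ᶻ⁺ (proj₂ hk _ z∈))))

member : List ℤ → ℤ → ℕ
member S z = if z ∈ᶻ S then 1 else 0

member-bit : ∀ S z → Bit (+ member S z)
member-bit S z with z ∈ᶻ S
... | true  = inj₂ refl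
... | false = inj₁ refl

member⁺ : ∀ {S z} → z ∈ S → member S z ≡ 1
member⁺ {S} {z} z∈ rewrite ∈ᶻ⁺ z∈ = refl

member⁻ : ∀ {S z} → member S z ≡ 1 → z ∈ S
member⁻ {S} {z} eq with z ∈ᶻ S in e
... | true = ∈ᶻ⁻ e

-- Trapezoids by columns

colSum : ∀ {n} → Vec ℤ n → ℤ
colSum x = sumℤ (Vec.toList x)

-- A non-central column at distance c from the central block.
SideColumn : ∀ {n} → (ℕ → ℕ) → ℕ → Vec ℤ n → Set
SideColumn τ c x = BitSuffixes (Vec.toList x) × colSum x ≡ + τ c × (∀ r → toℕ r < c → Vec.lookup x r ≡ + 0)

Side : ∀ {n} → (ℕ → ℕ) → ℕ → List (Vec ℤ n) → Set
Side τ c []       = ⊤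
Side τ c (x ∷ xs) = SideColumn τ c x × Side τ (suc c) xs

Central : ∀ {n} → Vec ℤ n → Set
Central x = BitSuffixes (Vec.toList x) × colSum x ≡ + 0

row : ∀ {n} → Fin n → List (Vec ℤ n) → List ℤ
row r = map (λ x → Vec.lookup x r)

Rows : ∀ {n} → List (Vec ℤ n) → Set
Rows X = ∀ r → Walk (+ 0) (row r X) × sumℤ (row r X) ≡ + 1

-- A trapezoid, column by column: the central columns, the left columns
-- (listed outwards) and the right columns.
Trapezoid : ℕ → Set
Trapezoid n = List (Vec ℤ n) × List (Vec ℤ n) × List (Vec ℤ n)

columns : ∀ {n} → Trapezoid n → List (Vec ℤ n)
columns (C , L , R) = reverse L ++ (C ++ R)

-- The set `S` enters only through `α` and `β`, the prescribed sums of the side columns, indexed by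
-- the distance from the central block.
Good : ∀ {n} → (α β : ℕ → ℕ) → Trapezoid n → Set
Good α β (C , L , R) = Rows (columns (C , L , R)) × Side α 0 L × All Central C × Side β 0 R

bit? : Decidable Bit
bit? z = (z ℤ.≟ + 0) ⊎-dec (z ℤ.≟ + 1)

walk? : ∀ s xs → Dec (Walk s xs)
walk? s []       = yes tt
walk? s (x ∷ xs) = bit? (s ℤ.+ x) ×-dec walk? (s ℤ.+ x) xs

bitSuffixes? : Decidable BitSuffixes
bitSuffixes? []       = yes tt
bitSuffixes? (x ∷ xs) = bit? (sumℤ (x ∷ xs)) ×-dec bitSuffixes? xs

side? : ∀ {n} τ c → Decidable (Side {n} τ c)
side? τ c []       = yes tt
side? τ c (x ∷ xs) = (bitSuffixes? (Vec.toList x) ×-dec (colSum x ℤ.≟ + τ c) ×-dec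
  Finₚ.all? (λ r → toℕ r ℕₚ.<? c →-dec (Vec.lookup x r ℤ.≟ + 0))) ×-dec side? τ (suc c) xs

good? : ∀ {n} α β → Decidable (Good {n} α β)
good? α β (C , L , R) =
  Finₚ.all? (λ r → walk? (+ 0) (row r X) ×-dec (sumℤ (row r X) ℤ.≟ + 1)) ×-dec
  side? α 0 L ×-dec All.all? (λ x → bitSuffixes? (Vec.toList x) ×-dec (colSum x ℤ.≟ + 0)) C ×-dec side? β 0 R
  where X = columns (C , L , R)

columnsOver : ∀ n → List (Vec ℤ n)
columnsOver n = vecsOver entries n

zeroColumn : ∀ n → Vec ℤ n
zeroColumn n = Vec.replicate n (+ 0)

nonzero? : ∀ {n} → Decidable (λ (x : Vec ℤ n) → x ≢ zeroColumn n)
nonzero? {n} x = ¬? (Vecₚ.≡-dec ℤ._≟_ x (zeroColumn n))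

nonzeroColumns : ∀ n → List (Vec ℤ n)
nonzeroColumns n = filter nonzero? (columnsOver n)

candidates : ∀ n → List (Vec ℤ n) → ℕ → List (Trapezoid n)
candidates n zs m = cartesianProduct (words zs m) (cartesianProduct (words (columnsOver n) n)
  (words (columnsOver n) n))

goodOver : ∀ n → (α β : ℕ → ℕ) → List (Vec ℤ n) → ℕ → List (Trapezoid n)
goodOver n α β zs m = filter (good? α β) (candidates n zs m)

-- Labels, positions, and the conditions on an array read column by column

left-label : ∀ n j c → j + suc c ≡ n → colLabel n j ≡ ℤ.- (+ c)
left-label n j c refl = trans (cong (λ z → (+ j ℤ.- z) ℤ.+ + 1)
  (trans (ℤₚ.pos-+ j (suc c)) (cong (ℤ._+_ (+ j)) (ℤₚ.pos-+ 1 c))))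
  (solve 2 (λ j c → (j :- (j :+ (con (+ 1) :+ c))) :+ con (+ 1) := :- c) refl (+ j) (+ c))
  where open Data.Integer.Solver.+-*-Solver

right-label : ∀ n q → colLabel n (n + q) ≡ + suc q
right-label n q = trans (cong (λ z → (z ℤ.- + n) ℤ.+ + 1) (ℤₚ.pos-+ n q))
  (trans (solve 2 (λ n q → ((n :+ q) :- n) :+ con (+ 1) := q :+ con (+ 1)) refl (+ n) (+ q))
    (trans (sym (ℤₚ.pos-+ q 1)) (cong +_ (ℕₚ.+-comm q 1))))
  where open Data.Integer.Solver.+-*-Solver

shiftLabel : ℕ → ℤ → ℤ
shiftLabel l c = if c ≤ᶻ + 0 then c ℤ.- + 1 else c ℤ.- (+ l ℤ.- + 1)

left-inRow : ∀ n l r j c → j + suc c ≡ n → inRow n l r j ≡ true ⇔ c ≤ r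
left-inRow n l r j c eq rewrite left-label n j c eq = mk⇔
  (λ e → ℤₚ.drop‿+≤+ (ℤₚ.neg-cancel-≤ (≤ᶻ-true⁻ (proj₁ (∧-true⁻ e)))))
  (λ c≤r → ∧-true⁺ (≤ᶻ-true⁺ (ℤₚ.neg-mono-≤ (ℤ.+≤+ c≤r))) (≤ᶻ-true⁺ (ℤₚ.≤-trans (ℤₚ.neg-≤-pos {c} {0}) (ℤ.+≤+ z≤n))))

right-inRow : ∀ n m r c → inRow n (suc m) r (n + (m + c)) ≡ true ⇔ c ≤ r
right-inRow n m r c rewrite right-label n (m + c) = mk⇔
  (λ e → ℕₚ.+-cancelˡ-≤ (suc m) c r (ℤₚ.drop‿+≤+ (≤ᶻ-true⁻ (proj₂ (∧-true⁻ {(ℤ.- (+ r)) ≤ᶻ + suc (m + c)} e)))))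
  (λ c≤r → ∧-true⁺ (≤ᶻ-true⁺ (ℤₚ.neg-≤-pos {r})) (≤ᶻ-true⁺ (ℤ.+≤+ (ℕₚ.+-monoʳ-≤ (suc m) c≤r))))

central-inRow : ∀ n m r q → q < m → inRow n (suc m) r (n + q) ≡ true
central-inRow n m r q q<m rewrite right-label n q =
  ∧-true⁺ (≤ᶻ-true⁺ (ℤₚ.neg-≤-pos {r}))
    (≤ᶻ-true⁺ (ℤ.+≤+ (ℕₚ.≤-trans (ℕₚ.≤-trans q<m (ℕₚ.n≤1+n m)) (ℕₚ.m≤m+n (suc m) r))))

left-noncentral : ∀ n l j c → j + suc c ≡ n → isCentral n l j ≡ false
left-noncentral n l j c eq rewrite left-label n j c eq =
  not-true⇒false (λ e → absurd c (≤ᶻ-true⁻ (proj₁ (∧-true⁻ e))))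
  where
  absurd : ∀ c → + 1 ℤ.≤ ℤ.- (+ c) → ⊥
  absurd zero (ℤ.+≤+ ())
  absurd (suc c) ()

right-noncentral : ∀ n m c → isCentral n (suc m) (n + (m + c)) ≡ false
right-noncentral n m c rewrite right-label n (m + c) =
  not-true⇒false (λ e → ℕₚ.<⇒≱ (s≤s (ℕₚ.m≤m+n m c))
    (ℤₚ.drop‿+≤+ (≤ᶻ-true⁻ {+ suc (m + c)} {+ m} (proj₂ (∧-true⁻ {+ 1 ≤ᶻ + suc (m + c)} e)))))

central-central : ∀ n m q → q < m → isCentral n (suc m) (n + q) ≡ true
central-central n m q q<m rewrite right-label n q = ∧-true⁺ (≤ᶻ-true⁺ {+ 1} {+ suc q} (ℤ.+≤+ (s≤s z≤n)))
  (≤ᶻ-true⁺ {+ suc q} {+ m} (ℤ.+≤+ q<m))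

left-shift : ∀ n l j c → j + suc c ≡ n → shiftLabel l (colLabel n j) ≡ -[1+ c ]
left-shift n l j c eq rewrite left-label n j c eq | ≤ᶻ-true⁺ (ℤₚ.neg-≤-pos {c} {0}) = go c
  where
  go : ∀ c → ℤ.- (+ c) ℤ.- + 1 ≡ -[1+ c ]
  go zero    = refl
  go (suc c) = cong -[1+_] (cong suc (ℕₚ.+-identityʳ c))

right-shift : ∀ n m c → shiftLabel (suc m) (colLabel n (n + (m + c))) ≡ + suc c
right-shift n m c rewrite right-label n (m + c) = begin
  + suc (m + c) ℤ.- + m       ≡⟨ ℤₚ.m-n≡m⊖n (suc (m + c)) m ⟩
  suc (m + c) ℤ.⊖ m           ≡⟨ cong (ℤ._⊖ m) (sym (ℕₚ.+-suc m c)) ⟩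
  (m + suc c) ℤ.⊖ m           ≡⟨ ℤₚ.⊖-≥ (ℕₚ.m≤m+n m (suc c)) ⟩
  + (m + suc c ∸ m)           ≡⟨ cong +_ (ℕₚ.m+n∸m≡n m (suc c)) ⟩
  + suc c ∎
  where open ≡-Reasoning

data Position (n m : ℕ) : ℕ → Set where
  atLeft    : ∀ {j} c → j + suc c ≡ n → Position n m j
  atCentral : ∀ q → q < m → Position n m (n + q)
  atRight   : ∀ c → c < n → Position n m (n + (m + c))

position : ∀ n m j → j < n + (m + n) → Position n m j
position n m j j< with j ℕₚ.<? n
... | yes j<n = atLeft (n ∸ suc j) (trans (ℕₚ.+-suc j (n ∸ suc j)) (ℕₚ.m+[n∸m]≡n j<n))
... | no  j≮n with j ∸ n | ℕₚ.m+[n∸m]≡n (ℕₚ.≮⇒≥ j≮n)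
... | q | refl with q ℕₚ.<? m
... | yes q<m = atCentral q q<m
... | no  q≮m with q ∸ m | ℕₚ.m+[n∸m]≡n (ℕₚ.≮⇒≥ q≮m)
... | c | refl = atRight c (ℕₚ.+-cancelˡ-< m c n (ℕₚ.+-cancelˡ-< n (m + c) (m + n) j<))

width-suc : ∀ n m → width n (suc m) ≡ n + (m + n)
width-suc n m = trans (cong (_∸ 1) (ℕₚ.+-suc (n + n) m)) (trans (ℕₚ.+-assoc n n m) (cong (_+_ n) (ℕₚ.+-comm n m)))

∈-zip⁻ : ∀ {B : Set} (f : ℕ → ℕ) {k} (v : Vec B k) {j b} →
  (j , b) ∈ zip (applyUpTo f (length (Vec.toList v))) (Vec.toList v) → ∃ λ i → j ≡ f (toℕ i) × b ≡ Vec.lookup v i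
∈-zip⁻ f (x ∷ v) (here refl) = zero , refl , refl
∈-zip⁻ f (x ∷ v) (there p) with ∈-zip⁻ (f ∘ suc) v p
... | i , eq , eq′ = suc i , eq , eq′

∈-zip⁺ : ∀ {B : Set} (f : ℕ → ℕ) {k} (v : Vec B k) i →
  (f (toℕ i) , Vec.lookup v i) ∈ zip (applyUpTo f (length (Vec.toList v))) (Vec.toList v)
∈-zip⁺ f (x ∷ v) zero    = here refl
∈-zip⁺ f (x ∷ v) (suc i) = there (∈-zip⁺ (f ∘ suc) v i)

∈-indexed⁻ : ∀ {A B : Set} (g : A → B) {k} (v : Vec A k) {j b} →
  (j , b) ∈ indexed (map g (Vec.toList v)) → ∃ λ i → j ≡ toℕ i × b ≡ g (Vec.lookup v i)
∈-indexed⁻ g v p with ∈-zip⁻ id (Vec.map g v) (subst (λ l → _ ∈ indexed l) (sym (Vecₚ.toList-map g v)) p)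
... | i , eq , eq′ = i , eq , trans eq′ (Vecₚ.lookup-map i g v)

∈-indexed⁺ : ∀ {A B : Set} (g : A → B) {k} (v : Vec A k) i →
  (toℕ i , g (Vec.lookup v i)) ∈ indexed (map g (Vec.toList v))
∈-indexed⁺ g v i = subst₂ (λ b l → (toℕ i , b) ∈ indexed l) (Vecₚ.lookup-map i g v) (Vecₚ.toList-map g v)
  (∈-zip⁺ id (Vec.map g v) i)

all-toList : ∀ {A : Set} {P : A → Set} {k} (v : Vec A k) → (∀ i → P (Vec.lookup v i)) → All P (Vec.toList v)
all-toList []      h = []
all-toList (x ∷ v) h = h zero ∷ all-toList v (h ∘ suc)

lookup-all : ∀ {A : Set} {P : A → Set} {k} (v : Vec A k) → All P (Vec.toList v) → ∀ i → P (Vec.lookup v i)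
lookup-all (x ∷ v) (p ∷ ps) zero    = p
lookup-all (x ∷ v) (p ∷ ps) (suc i) = lookup-all v ps i

AllFrom : ∀ {A : Set} → (ℕ → A → Set) → ℕ → List A → Set
AllFrom P s []       = ⊤
AllFrom P s (x ∷ xs) = P s x × AllFrom P (suc s) xs

allFrom-++ : ∀ {A : Set} (P : ℕ → A → Set) s xs {ys} →
  AllFrom P s (xs ++ ys) ⇔ (AllFrom P s xs × AllFrom P (s + length xs) ys)
allFrom-++ P s [] {ys} = mk⇔ (λ h → tt , subst (λ k → AllFrom P k ys) (sym (ℕₚ.+-identityʳ s)) h)
  (λ (_ , h) → subst (λ k → AllFrom P k ys) (ℕₚ.+-identityʳ s) h)
allFrom-++ P s (x ∷ xs) {ys} = mk⇔
  (λ (p , h) → let (h₁ , h₂) = to (allFrom-++ P (suc s) xs) h in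
    (p , h₁) , subst (λ k → AllFrom P k ys) (sym (ℕₚ.+-suc s (length xs))) h₂)
  (λ ((p , h₁) , h₂) → p , from (allFrom-++ P (suc s) xs) (h₁ , subst (λ k → AllFrom P k ys) (ℕₚ.+-suc s (length xs))
    h₂))

allFrom-lookup : ∀ {A : Set} (P : ℕ → A → Set) s {k} (v : Vec A k) →
  AllFrom P s (Vec.toList v) ⇔ (∀ i → P (s + toℕ i) (Vec.lookup v i))
allFrom-lookup P s [] = mk⇔ (λ _ ()) (λ _ → tt)
allFrom-lookup P s (x ∷ v) = mk⇔
  (λ (p , h) → λ { zero → subst (λ k → P k x) (sym (ℕₚ.+-identityʳ s)) p
                 ; (suc i) → subst (λ k → P k (Vec.lookup v i)) (sym (ℕₚ.+-suc s (toℕ i)))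
                   (to (allFrom-lookup P (suc s) v) h i) })
  (λ h → subst (λ k → P k x) (ℕₚ.+-identityʳ s) (h zero) ,
    from (allFrom-lookup P (suc s) v) (λ i → subst (λ k → P k (Vec.lookup v i)) (ℕₚ.+-suc s (toℕ i)) (h (suc i))))

row-transpose : ∀ {n k} (A : Vec (Vec ℤ k) n) r → row r (Vec.toList (Vec.transpose A)) ≡ Vec.toList (Vec.lookup A r)
row-transpose A r = trans (sym (Vecₚ.toList-map (λ x → Vec.lookup x r) (Vec.transpose A)))
  (cong Vec.toList (vec-ext (λ j → trans (Vecₚ.lookup-map j _ (Vec.transpose A)) (lookup-lookup-transpose A j r))))

positive-bit : ∀ {z} → Bit z → (+ 0 <ᶻ z) ≡ true → z ≡ + 1
positive-bit (inj₁ refl) ()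
positive-bit (inj₂ refl) _ = refl

∨-true⁻ : ∀ {a b} → a ∨ b ≡ true → a ≡ true ⊎ b ≡ true
∨-true⁻ {true}  _  = inj₁ refl
∨-true⁻ {false} eq = inj₂ eq

∨-true⁺ : ∀ {a b} → a ≡ true ⊎ b ≡ true → a ∨ b ≡ true
∨-true⁺ {true}  _           = refl
∨-true⁺ {false} (inj₂ eq) = eq

module ArrayColumns (n m : ℕ) (S : List ℤ) where
  -- `m` is the number of central columns, so `l - 1 = m` and the condition `l ≥ 1` is built in.
  l : ℕ
  l = suc m

  α β : ℕ → ℕ
  α c = member S -[1+ c ]
  β c = member S (+ suc c)

  -- All conditions on a single column, with the equality of `𝒮 n l A` and `S` included: a column
  -- sum is 0 or 1, so outside the centre it has to be the indicator of the shifted label in `S`.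
  ColumnAt : ℕ → Vec ℤ n → Set
  ColumnAt j x = BitSuffixes (Vec.toList x)
    × (∀ r → inRow n l (toℕ r) j ≡ true ⊎ Vec.lookup x r ≡ + 0)
    × (isCentral n l j ≡ true → colSum x ≡ + 0)
    × (isCentral n l j ≡ false → colSum x ≡ + member S (shiftLabel l (colLabel n j)))

  columnAt-side : ∀ τ j c → (∀ r → inRow n l r j ≡ true ⇔ c ≤ r) → isCentral n l j ≡ false →
    member S (shiftLabel l (colLabel n j)) ≡ τ c → ∀ x → ColumnAt j x ⇔ SideColumn τ c x
  columnAt-side τ j c inr nc mem x = mk⇔
    (λ (s , z , _ , t) → s , trans (t nc) (cong +_ mem) , λ r r<c → outside (z r) r<c)
    (λ (s , t , z) → s , (λ r → inside r (z r)) , (λ e → contradiction (trans (sym e) nc) true≢false) ,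
      (λ _ → trans t (cong +_ (sym mem))))
    where
    outside : ∀ {r v} → inRow n l r j ≡ true ⊎ v ≡ + 0 → r < c → v ≡ + 0
    outside (inj₁ e) r<c = contradiction (to (inr _) e) (ℕₚ.<⇒≱ r<c)
    outside (inj₂ e) _   = e
    inside : ∀ r → (toℕ r < c → Vec.lookup x r ≡ + 0) → inRow n l (toℕ r) j ≡ true ⊎ Vec.lookup x r ≡ + 0
    inside r z with toℕ r ℕₚ.<? c
    ... | yes r<c = inj₂ (z r<c)
    ... | no  r≮c = inj₁ (from (inr (toℕ r)) (ℕₚ.≮⇒≥ r≮c))

  columnAt-left : ∀ {j} c → j + suc c ≡ n → ∀ x → ColumnAt j x ⇔ SideColumn α c x
  columnAt-left {j} c eq = columnAt-side α j c (λ r → left-inRow n l r j c eq) (left-noncentral n l j c eq)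
    (cong (member S) (left-shift n l j c eq))

  columnAt-right : ∀ c x → ColumnAt (n + (m + c)) x ⇔ SideColumn β c x
  columnAt-right c = columnAt-side β (n + (m + c)) c (λ r → right-inRow n m r c) (right-noncentral n m c)
    (cong (member S) (right-shift n m c))

  columnAt-central : ∀ {q} → q < m → ∀ x → ColumnAt (n + q) x ⇔ Central x
  columnAt-central {q} q<m x = mk⇔
    (λ (s , _ , t , _) → s , t (central-central n m q q<m))
    (λ (s , t) → s , (λ r → inj₁ (central-inRow n m (toℕ r) q q<m)) , (λ _ → t) ,
      (λ e → contradiction (trans (sym (central-central n m q q<m)) e) true≢false))

  allFrom-left : ∀ L c → length L + c ≡ n → AllFrom ColumnAt 0 (reverse L) ⇔ Side α c L
  allFrom-left [] c eq = mk⇔ (λ _ → tt) (λ _ → tt)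
  allFrom-left (x ∷ L) c eq = mk⇔
    (λ h → let (h₁ , h₂) = to split (subst (AllFrom ColumnAt 0) (Listₚ.unfold-reverse x L) h) in
      to (columnAt-left c eqx x) (proj₁ h₂) , to (allFrom-left L (suc c) eq′) h₁)
    (λ (p , h) → subst (AllFrom ColumnAt 0) (sym (Listₚ.unfold-reverse x L))
      (from split (from (allFrom-left L (suc c) eq′) h , from (columnAt-left c eqx x) p , tt)))
    where
    split = allFrom-++ ColumnAt 0 (reverse L) {x ∷ []}
    eq′ : length L + suc c ≡ n
    eq′ = trans (ℕₚ.+-suc (length L) c) eq
    eqx : length (reverse L) + suc c ≡ n
    eqx = trans (cong (_+ suc c) (Listₚ.length-reverse L)) eq′

  allFrom-central : ∀ C s q → s ≡ n + q → length C + q ≤ m → AllFrom ColumnAt s C ⇔ All Central C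
  allFrom-central [] s q eq le = mk⇔ (λ _ → []) (λ _ → tt)
  allFrom-central (x ∷ C) _ q refl le = mk⇔
    (λ (p , h) → to (columnAt-central q<m x) p ∷ to ih h)
    (λ { (p ∷ h) → from (columnAt-central q<m x) p , from ih h })
    where
    q<m : q < m
    q<m = ℕₚ.≤-trans (s≤s (ℕₚ.m≤n+m q (length C))) le
    ih = allFrom-central C _ (suc q) (sym (ℕₚ.+-suc n q)) (subst (_≤ m) (sym (ℕₚ.+-suc (length C) q)) le)

  allFrom-right : ∀ R s c → s ≡ n + (m + c) → AllFrom ColumnAt s R ⇔ Side β c R
  allFrom-right [] s c eq = mk⇔ (λ _ → tt) (λ _ → tt)
  allFrom-right (x ∷ R) _ c refl = mk⇔
    (λ (p , h) → to (columnAt-right c x) p , to ih h)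
    (λ (p , h) → from (columnAt-right c x) p , from ih h)
    where ih = allFrom-right R _ (suc c) (sym (trans (cong (_+_ n) (ℕₚ.+-suc m c)) (ℕₚ.+-suc n (m + c))))

  allFrom-columns : ∀ C L R → length L ≡ n → length C ≡ m →
    AllFrom ColumnAt 0 (columns (C , L , R)) ⇔ (Side α 0 L × All Central C × Side β 0 R)
  allFrom-columns C L R lenL lenC = mk⇔
    (λ h → let (h₁ , h₂) = to split₁ h ; (h₃ , h₄) = to split₂ h₂ in to isL h₁ , to isC h₃ , to isR h₄)
    (λ (a , b , c) → from split₁ (from isL a , from split₂ (from isC b , from isR c)))
    where
    split₁ = allFrom-++ ColumnAt 0 (reverse L) {C ++ R}
    split₂ = allFrom-++ ColumnAt (length (reverse L)) C {R}
    lenrL : length (reverse L) ≡ n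
    lenrL = trans (Listₚ.length-reverse L) lenL
    isL = allFrom-left L 0 (trans (ℕₚ.+-identityʳ _) lenL)
    isC = allFrom-central C (length (reverse L)) 0 (trans lenrL (sym (ℕₚ.+-identityʳ n)))
            (ℕₚ.≤-reflexive (trans (ℕₚ.+-identityʳ _) lenC))
    isR = allFrom-right R (length (reverse L) + length C) 0 (cong₂ _+_ lenrL (trans lenC (sym (ℕₚ.+-identityʳ m))))

  Valid : Array n l → Set
  Valid A = isASTrapezoid n l A ∧ sameSet (𝒮 n l A) S ≡ true

  ColumnsValid : List (Vec ℤ n) → Set
  ColumnsValid X = Rows X × AllFrom ColumnAt 0 X

  module _ (A : Array n l) where
    V : Vec (Vec ℤ n) (width n l)
    V = Vec.transpose A

    ∈-𝒮⁻ : ∀ {z} → z ∈ 𝒮 n l A → z ≡ + 0 ⊎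
      ∃ λ j → (+ 0 <ᶻ colSum (Vec.lookup V j)) ≡ true × z ≡ shiftLabel l (colLabel n (toℕ j))
    ∈-𝒮⁻ (here eq) = inj₁ eq
    ∈-𝒮⁻ (there z∈) with ∈-map⁻ (λ p → shiftLabel l (colLabel n (proj₁ p))) z∈
    ... | (j , b) , p∈ , eq with ∈-filter⁻ _ {xs = indexed (colsOf A)} p∈
    ... | p∈′ , pos with ∈-indexed⁻ Vec.toList V p∈′
    ... | i , refl , refl = inj₂ (i , to T-≡ pos , eq)

    0∈𝒮 : + 0 ∈ 𝒮 n l A
    0∈𝒮 = here refl

    ∈-𝒮⁺ : ∀ j → (+ 0 <ᶻ colSum (Vec.lookup V j)) ≡ true → shiftLabel l (colLabel n (toℕ j)) ∈ 𝒮 n l A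
    ∈-𝒮⁺ j pos = there (∈-map⁺ (λ p → shiftLabel l (colLabel n (proj₁ p)))
      (∈-filter⁺ _ {xs = indexed (colsOf A)} (∈-indexed⁺ Vec.toList V j) (from T-≡ pos)))

data Ranged (n : ℕ) : ℤ → Set where
  origin   : Ranged n (+ 0)
  negative : ∀ {c} → c < n → Ranged n -[1+ c ]
  positive : ∀ {c} → c < n → Ranged n (+ suc c)

nth : ∀ {n} → List (Vec ℤ n) → ℕ → Vec ℤ n
nth []       _       = zeroColumn _
nth (x ∷ xs) zero    = x
nth (x ∷ xs) (suc j) = nth xs j

toList-nth : ∀ {n k} (X : List (Vec ℤ n)) → length X ≡ k → Vec.toList (Vec.tabulate {n = k} (λ j → nth X (toℕ j))) ≡ X
toList-nth {k = zero}  []      _  = refl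
toList-nth {k = suc k} (x ∷ X) eq = cong (x ∷_) (toList-nth X (ℕₚ.suc-injective eq))

bit-complement : ∀ {z} → Bit z → z ≢ + 1 → z ≡ + 0
bit-complement (inj₁ e) _ = e
bit-complement (inj₂ e) h = contradiction e h

++-injective : ∀ {A : Set} (xs ys : List A) {xs′ ys′} → length xs ≡ length ys →
  xs ++ xs′ ≡ ys ++ ys′ → xs ≡ ys × xs′ ≡ ys′
++-injective []       []       _   eq = refl , eq
++-injective (x ∷ xs) (y ∷ ys) len eq with Listₚ.∷-injective eq
... | refl , eq′ with ++-injective xs ys (ℕₚ.suc-injective len) eq′
... | refl , eq″ = refl , eq″

entries-unique : Unique entries
entries-unique = ((λ ()) ∷ (λ ()) ∷ []) ∷ ((λ ()) ∷ []) ∷ [] ∷ []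

columnsOver-unique : ∀ n → Unique (columnsOver n)
columnsOver-unique = vecsOver-unique entries-unique

nonzeroColumns-unique : ∀ n → Unique (nonzeroColumns n)
nonzeroColumns-unique n = Uniqueₚ.filter⁺ nonzero? (columnsOver-unique n)

allColumns-unique : ∀ n → Unique (zeroColumn n ∷ nonzeroColumns n)
allColumns-unique n = All.tabulate (λ x∈ eq → proj₂ (∈-filter⁻ nonzero? {xs = columnsOver n} x∈) (sym eq)) ∷
  nonzeroColumns-unique n

∈-allColumns⁺ : ∀ {n x} → x ∈ columnsOver n → x ∈ zeroColumn n ∷ nonzeroColumns n
∈-allColumns⁺ {n} {x} x∈ with Vecₚ.≡-dec ℤ._≟_ x (zeroColumn n)
... | yes eq = here eq
... | no neq = there (∈-filter⁺ nonzero? x∈ neq)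

∈-allColumns⁻ : ∀ {n x} → x ∈ zeroColumn n ∷ nonzeroColumns n → x ∈ columnsOver n
∈-allColumns⁻ {n} (here refl) =
  ∈-vecsOver⁺ (zeroColumn n) (λ i → subst (_∈ entries) (sym (Vecₚ.lookup-replicate i (+ 0))) (there (here refl)))
∈-allColumns⁻ (there x∈) = proj₁ (∈-filter⁻ nonzero? x∈)

goodOver-unique : ∀ n α β {zs} m → Unique zs → Unique (goodOver n α β zs m)
goodOver-unique n α β m zs! = Uniqueₚ.filter⁺ (good? α β) (Uniqueₚ.cartesianProduct⁺ (words-unique zs! m)
  (Uniqueₚ.cartesianProduct⁺ (words-unique (columnsOver-unique n) n) (words-unique (columnsOver-unique n) n)))

∈-goodOver⁻ : ∀ {n α β zs m C L R} → (C , L , R) ∈ goodOver n α β zs m → Good α β (C , L , R) ×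
  (length C ≡ m × All (_∈ zs) C) × (length L ≡ n × All (_∈ columnsOver n) L) ×
    (length R ≡ n × All (_∈ columnsOver n) R)
∈-goodOver⁻ {n} {α} {β} {zs} {m} t∈ with ∈-filter⁻ (good? α β) {xs = candidates n zs m} t∈
... | t∈′ , good with ∈-cartesianProduct⁻ (words zs m) _ t∈′
... | C∈ , LR∈ with ∈-cartesianProduct⁻ (words (columnsOver n) n) _ LR∈
... | L∈ , R∈ = good , ∈-words⁻ m C∈ , ∈-words⁻ n L∈ , ∈-words⁻ n R∈

∈-goodOver⁺ : ∀ {n α β zs m} C L R → Good α β (C , L , R) → length C ≡ m → All (_∈ zs) C →
  length L ≡ n → All (_∈ columnsOver n) L → length R ≡ n → All (_∈ columnsOver n) R → (C , L , R) ∈ goodOver n α β zs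
    m
∈-goodOver⁺ {n} {α} {β} C L R good lenC C∈ lenL L∈ lenR R∈ = ∈-filter⁺ (good? α β)
  (∈-cartesianProduct⁺ (subst (λ k → C ∈ words _ k) lenC (∈-words⁺ C C∈))
    (∈-cartesianProduct⁺ (subst (λ k → L ∈ words _ k) lenL (∈-words⁺ L L∈))
      (subst (λ k → R ∈ words _ k) lenR (∈-words⁺ R R∈)))) good

module _ (n m : ℕ) (S : List ℤ) (0∈S : + 0 ∈ S) (ranged : ∀ {z} → z ∈ S → Ranged n z) where
  open ArrayColumns n m S

  -- Left labels shift to negative numbers and right labels to positive ones, so the 0 that `𝒮`
  -- contains by definition never stands for a column.
  noncentral-shift≢0 : ∀ {j} → Position n m j → isCentral n l j ≡ false → shiftLabel l (colLabel n j) ≢ + 0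
  noncentral-shift≢0 (atLeft c eq) _ e with () ← trans (sym (left-shift n l _ c eq)) e
  noncentral-shift≢0 (atCentral q q<m) nc _ = true≢false (trans (sym (central-central n m q q<m)) nc)
  noncentral-shift≢0 (atRight c _) _ e with () ← trans (sym (right-shift n m c)) e

  shift-injective : ∀ {i j} → Position n m i → Position n m j → isCentral n l i ≡ false → isCentral n l j ≡ false →
    shiftLabel l (colLabel n i) ≡ shiftLabel l (colLabel n j) → i ≡ j
  shift-injective {i} {j} (atLeft c eq) (atLeft d eq′) _ _ e
    with refl ← trans (sym (left-shift n l i c eq)) (trans e (left-shift n l j d eq′)) =
      ℕₚ.+-cancelʳ-≡ (suc c) i j (trans eq (sym eq′))
  shift-injective {i} (atLeft c eq) (atRight d _) _ _ e with () ← trans (sym (left-shift n l i c eq))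
    (trans e (right-shift n m d))
  shift-injective {j = j} (atRight c _) (atLeft d eq) _ _ e with () ← trans (sym (right-shift n m c))
    (trans e (left-shift n l j d eq))
  shift-injective (atRight c _) (atRight d _) _ _ e with refl ← trans (sym (right-shift n m c))
    (trans e (right-shift n m d)) = refl
  shift-injective (atCentral q q<m) _ nc _ _ = contradiction (trans (sym (central-central n m q q<m)) nc) true≢false
  shift-injective (atLeft _ _) (atCentral q q<m) _ nc _ = contradiction (trans (sym (central-central n m q q<m)) nc)
    true≢false
  shift-injective (atRight _ _) (atCentral q q<m) _ nc _ = contradiction (trans (sym (central-central n m q q<m)) nc)
    true≢false

  module _ (A : Array n l) where
    positionOf : ∀ (j : Fin (width n l)) → Position n m (toℕ j)
    positionOf j = position n m (toℕ j) (subst (toℕ j <_) (width-suc n m) (Finₚ.toℕ<n j))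

    col : Fin (width n l) → Vec ℤ n
    col = Vec.lookup (V A)

    module _ (bits : ∀ j → BitSuffixes (Vec.toList (col j))) (cen : ∀ j → isCentral n l (toℕ j) ≡ true → colSum (col j) ≡ + 0) where
      sum-bit : ∀ j → Bit (colSum (col j))
      sum-bit j = suffix-head (Vec.toList (col j)) (bits j)

      sum-one⇒noncentral : ∀ j → colSum (col j) ≡ + 1 → isCentral n l (toℕ j) ≡ false
      sum-one⇒noncentral j eq = not-true⇒false (λ c → case trans (sym eq) (cen j c) of λ ())

      -- Sums are 0 or 1. A column of sum 1 has its label in `𝒮`; conversely a nonzero label in `𝒮`
      -- comes from some column of sum 1, and by `shift-injective` that is the column in question.
      sameSet⇒sums : sameSet (𝒮 n l A) S ≡ true →
        ∀ j → isCentral n l (toℕ j) ≡ false → colSum (col j) ≡ + member S (shiftLabel l (colLabel n (toℕ j)))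
      sameSet⇒sums same j nc with member S (shiftLabel l (colLabel n (toℕ j))) in mem | member-bit S
        (shiftLabel l (colLabel n (toℕ j)))
      ... | _ | inj₁ refl = bit-complement (sum-bit j) (λ eq →
        case trans (sym mem) (member⁺ {S} (proj₁ (to (sameSet⇔ {𝒮 n l A} {S}) same) _ (∈-𝒮⁺ A j (cong (+ 0 <ᶻ_) eq))))
          of λ ())
      ... | _ | inj₂ refl with ∈-𝒮⁻ A (proj₂ (to (sameSet⇔ {𝒮 n l A} {S}) same) _ (member⁻ {S} mem))
      ... | inj₁ z≡0 = contradiction z≡0 (noncentral-shift≢0 (positionOf j) nc)
      ... | inj₂ (i , p , eq) = trans (cong (colSum ∘ col) (Finₚ.toℕ-injective
              (shift-injective (positionOf j) (positionOf i) nc (sum-one⇒noncentral i one) eq))) one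
        where
        one : colSum (col i) ≡ + 1
        one = positive-bit (sum-bit i) p

      index : ∀ j → j < n + (m + n) → Fin (width n l)
      index j j< = fromℕ< (subst (j <_) (sym (width-suc n m)) j<)

      -- The inclusion of `S` in `𝒮` rests on `ranged`: each nonzero element of `S` is the shifted
      -- label of an existing column.
      sums⇒sameSet : (∀ j → isCentral n l (toℕ j) ≡ false →
        colSum (col j) ≡ + member S (shiftLabel l (colLabel n (toℕ j)))) →
        sameSet (𝒮 n l A) S ≡ true
      sums⇒sameSet sums = from (sameSet⇔ {𝒮 n l A} {S}) (fwd , λ z z∈ → bwd z∈ (ranged z∈))
        where
        fwd : ∀ z → z ∈ 𝒮 n l A → z ∈ S
        fwd z z∈ with ∈-𝒮⁻ A z∈
        ... | inj₁ refl = 0∈S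
        ... | inj₂ (j , p , refl) = member⁻ (ℤₚ.+-injective (trans (sym (sums j (sum-one⇒noncentral j one))) one))
          where
          one : colSum (col j) ≡ + 1
          one = positive-bit (sum-bit j) p
        at : ∀ {z} j (j< : j < n + (m + n)) → isCentral n l j ≡ false → shiftLabel l (colLabel n j) ≡ z → z ∈ S →
          z ∈ 𝒮 n l A
        at j j< nc eq z∈ = subst (_∈ 𝒮 n l A) (trans (cong (shiftLabel l ∘ colLabel n) toℕ-i) eq)
          (∈-𝒮⁺ A i (cong (+ 0 <ᶻ_) (trans (sums i (trans (cong (isCentral n l) toℕ-i) nc))
            (cong +_ (member⁺ (subst (_∈ S) (sym (trans (cong (shiftLabel l ∘ colLabel n) toℕ-i) eq)) z∈))))))
          where
          i = index j j<
          toℕ-i : toℕ i ≡ j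
          toℕ-i = Finₚ.toℕ-fromℕ< (subst (j <_) (sym (width-suc n m)) j<)
        bwd : ∀ {z} → z ∈ S → Ranged n z → z ∈ 𝒮 n l A
        bwd z∈ origin = 0∈𝒮 A
        bwd z∈ (negative {c} c<n) = at (n ∸ suc c) (ℕₚ.≤-trans (s≤s (ℕₚ.m∸n≤m n (suc c))) n<)
          (left-noncentral n l _ c (ℕₚ.m∸n+n≡m c<n)) (left-shift n l _ c (ℕₚ.m∸n+n≡m c<n)) z∈
          where
          n< : suc n ≤ n + (m + n)
          n< = ℕₚ.≤-trans (ℕₚ.≤-reflexive (ℕₚ.+-comm 1 n))
            (ℕₚ.+-monoʳ-≤ n (ℕₚ.≤-trans (ℕₚ.≤-trans (s≤s z≤n) c<n) (ℕₚ.m≤n+m n m)))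
        bwd z∈ (positive {c} c<n) = at (n + (m + c)) (ℕₚ.+-monoʳ-< n (ℕₚ.+-monoʳ-< m c<n))
          (right-noncentral n m c) (right-shift n m c) z∈

    valid⇒columns : (∀ r j → Vec.lookup (Vec.lookup A r) j ∈ entries) → Valid A → ColumnsValid (Vec.toList (V A))
    valid⇒columns ent valid with ∧-true⁻ {isASTrapezoid n l A} valid
    ... | ast , same with ∧-true⁻ {zeroOutside n l A} ast
    ... | zo , ast₁ with ∧-true⁻ ast₁
    ... | rs , ast₂ with ∧-true⁻ ast₂
    ... | cc , ast₃ with ∧-true⁻ ast₃
    ... | ra , ast₄ with ∧-true⁻ ast₄
    ... | ca , fp = rows , from (allFrom-lookup ColumnAt 0 (V A)) (λ j → bits j , inside j , cen j , sameSet⇒sums bits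
      cen same j)
      where
      rows : Rows (Vec.toList (V A))
      rows r rewrite row-transpose A r = row⇒walk (all-toList (Vec.lookup A r) (ent r))
        (to (all-lookup _ Vec.toList A) ra r) s , s
        where
        s : sumℤ (Vec.toList (Vec.lookup A r)) ≡ + 1
        s = ≡ᶻ-true⁻ (to (all-lookup _ Vec.toList A) rs r)
      bits : ∀ j → BitSuffixes (Vec.toList (col j))
      bits j = column⇒suffixes (all-toList (col j) (λ r → subst (_∈ entries) (sym (lookup-lookup-transpose A j r))
        (ent r j)))
        (to (all-lookup _ Vec.toList (V A)) ca j) (to (all-lookup _ Vec.toList (V A)) fp j)
      cen : ∀ j → isCentral n l (toℕ j) ≡ true → colSum (col j) ≡ + 0
      cen j c with ∨-true⁻ {not (isCentral n l (toℕ j))} (to (all-indexed _ Vec.toList (V A)) cc j)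
      ... | inj₁ e = contradiction (trans (sym e) (cong not c)) true≢false
      ... | inj₂ e = ≡ᶻ-true⁻ e
      inside : ∀ j r → inRow n l (toℕ r) (toℕ j) ≡ true ⊎ Vec.lookup (col j) r ≡ + 0
      inside j r with ∨-true⁻ {inRow n l (toℕ r) (toℕ j)} (to (all-zip _ 0 id (λ _ → refl) (Vec.lookup A r))
        (to (all-indexed _ Vec.toList A) zo r) j)
      ... | inj₁ e = inj₁ e
      ... | inj₂ e = inj₂ (trans (lookup-lookup-transpose A j r) (≡ᶻ-true⁻ e))

    columns⇒valid : ColumnsValid (Vec.toList (V A)) → Valid A
    columns⇒valid (rows , cols) = ∧-true⁺ (∧-true⁺ zo (∧-true⁺ rs (∧-true⁺ cc (∧-true⁺ ra (∧-true⁺ ca fp)))))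
      (sums⇒sameSet bits cen (λ j → proj₂ (proj₂ (proj₂ (at j)))))
      where
      at : ∀ j → ColumnAt (toℕ j) (col j)
      at = to (allFrom-lookup ColumnAt 0 (V A)) cols
      bits : ∀ j → BitSuffixes (Vec.toList (col j))
      bits j = proj₁ (at j)
      cen : ∀ j → isCentral n l (toℕ j) ≡ true → colSum (col j) ≡ + 0
      cen j = proj₁ (proj₂ (proj₂ (at j)))
      zo : zeroOutside n l A ≡ true
      zo = from (all-indexed _ Vec.toList A) (λ r → from (all-zip _ 0 id (λ _ → refl) (Vec.lookup A r))
        (λ j → ∨-true⁺ (inside j r)))
        where
        inside : ∀ j r → inRow n l (toℕ r) (toℕ j) ≡ true ⊎ (Vec.lookup (Vec.lookup A r) j ≡ᶻ + 0) ≡ true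
        inside j r with proj₁ (proj₂ (at j)) r
        ... | inj₁ e = inj₁ e
        ... | inj₂ e = inj₂ (≡ᶻ-true⁺ (trans (sym (lookup-lookup-transpose A j r)) e))
      rs : all (λ row → sumℤ row ≡ᶻ + 1) (rowsOf A) ≡ true
      rs = from (all-lookup _ Vec.toList A)
        (λ r → ≡ᶻ-true⁺ (subst (λ xs → sumℤ xs ≡ + 1) (row-transpose A r) (proj₂ (rows r))))
      cc : all (λ { (j , col) → not (isCentral n l j) ∨ (sumℤ col ≡ᶻ + 0) }) (indexed (colsOf A)) ≡ true
      cc = from (all-indexed _ Vec.toList (V A)) each
        where
        each : ∀ j → not (isCentral n l (toℕ j)) ∨ (colSum (col j) ≡ᶻ + 0) ≡ true
        each j with isCentral n l (toℕ j) in c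
        ... | false = refl
        ... | true  = ≡ᶻ-true⁺ (cen j c)
      ra : all alternating (rowsOf A) ≡ true
      ra = from (all-lookup alternating Vec.toList A)
        (λ r → walk⇒row _ (subst (Walk (+ 0)) (row-transpose A r) (proj₁ (rows r))))
      ca : all alternating (colsOf A) ≡ true
      ca = from (all-lookup alternating Vec.toList (V A)) (λ j → proj₁ (suffixes⇒column _ (bits j)))
      fp : all (λ col → firstNonzeroPositive (reverseℤ col)) (colsOf A) ≡ true
      fp = from (all-lookup _ Vec.toList (V A)) (λ j → proj₂ (suffixes⇒column _ (bits j)))

-- Arrays and trapezoids are equinumerous

length-take-exact : ∀ {A : Set} k {j} (xs : List A) → length xs ≡ k + j → length (take k xs) ≡ k × length (drop k xs)
  ≡ j
length-take-exact zero    xs       eq = refl , eq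
length-take-exact (suc k) (x ∷ xs) eq with length-take-exact k xs (ℕₚ.suc-injective eq)
... | e , e′ = cong suc e , e′

module _ (n m : ℕ) (S : List ℤ) (0∈S : + 0 ∈ S) (ranged : ∀ {z} → z ∈ S → Ranged n z) where
  open ArrayColumns n m S

  toTrapezoid : Array n l → Trapezoid n
  toTrapezoid A = take m (drop n X) , reverse (take n X) , drop m (drop n X)
    where X = Vec.toList (V A)

  columns-toTrapezoid : ∀ A → columns (toTrapezoid A) ≡ Vec.toList (V A)
  columns-toTrapezoid A = trans (cong₂ _++_ (Listₚ.reverse-involutive (take n X)) (Listₚ.take++drop≡id m (drop n X)))
    (Listₚ.take++drop≡id n X)
    where X = Vec.toList (V A)

  toArray : Trapezoid n → Array n l
  toArray t = Vec.tabulate (λ r → Vec.tabulate (λ j → Vec.lookup (nth (columns t) (toℕ j)) r))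

  columns-toArray : ∀ t → length (columns t) ≡ width n l → Vec.toList (V (toArray t)) ≡ columns t
  columns-toArray t len = trans (cong Vec.toList (vec-ext (λ j → vec-ext (λ r → begin
      Vec.lookup (Vec.lookup (V (toArray t)) j) r       ≡⟨ lookup-lookup-transpose (toArray t) j r ⟩
      Vec.lookup (Vec.lookup (toArray t) r) j           ≡⟨ cong (λ v → Vec.lookup v j) (Vecₚ.lookup∘tabulate _ r) ⟩
      Vec.lookup (Vec.tabulate (λ j → Vec.lookup (nth (columns t) (toℕ j)) r)) j ≡⟨ Vecₚ.lookup∘tabulate _ j ⟩
      Vec.lookup (nth (columns t) (toℕ j)) r            ≡⟨ cong (λ v → Vec.lookup v r)
        (Vecₚ.lookup∘tabulate (λ j → nth (columns t) (toℕ j)) j) ⟨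
      Vec.lookup (Vec.lookup (Vec.tabulate (λ j → nth (columns t) (toℕ j))) j) r ∎))))
    (toList-nth (columns t) len)
    where open ≡-Reasoning

  arrays : List (Array n l)
  arrays = filterᵇ (λ A → isASTrapezoid n l A ∧ sameSet (𝒮 n l A) S) (allArrays n l)

  arrays-unique : Unique arrays
  arrays-unique = Uniqueₚ.filter⁺ _ (vecsOver-unique (vecsOver-unique entries-unique (width n l)) n)

  ∈-arrays⁻ : ∀ {A} → A ∈ arrays → Valid A × (∀ r j → Vec.lookup (Vec.lookup A r) j ∈ entries)
  ∈-arrays⁻ A∈ with ∈-filter⁻ _ {xs = allArrays n l} A∈
  ... | A∈′ , v = to T-≡ v , λ r → ∈-vecsOver⁻ (∈-vecsOver⁻ A∈′ r)

  ∈-arrays⁺ : ∀ {A} → Valid A → (∀ r j → Vec.lookup (Vec.lookup A r) j ∈ entries) → A ∈ arrays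
  ∈-arrays⁺ {A} v ent = ∈-filter⁺ _ {xs = allArrays n l} (∈-vecsOver⁺ A (λ r → ∈-vecsOver⁺ _ (ent r))) (from T-≡ v)

  -- The alphabet for central columns lists the zero column separately, so that it can take the part
  -- of `z₀` in `total-insert`.
  trapezoids : List (Trapezoid n)
  trapezoids = goodOver n α β (zeroColumn n ∷ nonzeroColumns n) m

  length-columns : ∀ (C L R : List (Vec ℤ n)) → length C ≡ m → length L ≡ n → length R ≡ n →
    length (columns (C , L , R)) ≡ width n l
  length-columns C L R lenC lenL lenR = trans (Listₚ.length-++ (reverse L)) (trans
    (cong₂ _+_ (trans (Listₚ.length-reverse L) lenL) (trans (Listₚ.length-++ C) (cong₂ _+_ lenC lenR)))
      (sym (width-suc n m)))

  good⇔valid : ∀ C L R → length C ≡ m → length L ≡ n → Good α β (C , L , R) ⇔ ColumnsValid (columns (C , L , R))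
  good⇔valid C L R lenC lenL = mk⇔
    (λ (rows , side) → rows , from (allFrom-columns C L R lenL lenC) side)
    (λ (rows , cols) → rows , to (allFrom-columns C L R lenL lenC) cols)

  toTrapezoid-∈ : ∀ {A} → A ∈ arrays → toTrapezoid A ∈ trapezoids
  toTrapezoid-∈ {A} A∈ with ∈-arrays⁻ A∈
  ... | valid , ent = ∈-goodOver⁺ _ _ _
    (from (good⇔valid _ _ _ lenC lenL) (subst ColumnsValid (sym (columns-toTrapezoid A))
      (valid⇒columns n m S 0∈S ranged A ent valid)))
    lenC (All.map ∈-allColumns⁺ (Allₚ.take⁺ m (Allₚ.drop⁺ n X∈)))
    lenL (all-reverse (Allₚ.take⁺ n X∈))
    lenR (Allₚ.drop⁺ m (Allₚ.drop⁺ n X∈))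
    where
    X = Vec.toList (V A)
    X∈ : All (_∈ columnsOver n) X
    X∈ = all-toList (V A) (λ j → ∈-vecsOver⁺ _ (λ r → subst (_∈ entries) (sym (lookup-lookup-transpose A j r))
      (ent r j)))
    split₁ = length-take-exact n {m + n} X (trans (Vecₚ.length-toList (V A)) (width-suc n m))
    split₂ = length-take-exact m {n} (drop n X) (proj₂ split₁)
    lenL : length (reverse (take n X)) ≡ n
    lenL = trans (Listₚ.length-reverse (take n X)) (proj₁ split₁)
    lenC : length (take m (drop n X)) ≡ m
    lenC = proj₁ split₂
    lenR : length (drop m (drop n X)) ≡ n
    lenR = proj₂ split₂

  toTrapezoid-injective : ∀ {A A′} → toTrapezoid A ≡ toTrapezoid A′ → A ≡ A′
  toTrapezoid-injective {A} {A′} eq = vec-ext (λ r → vec-ext (λ j →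
    trans (sym (lookup-lookup-transpose A j r)) (trans (cong (λ M → Vec.lookup (Vec.lookup M j) r) V≡)
      (lookup-lookup-transpose A′ j r))))
    where
    V≡ : V A ≡ V A′
    V≡ = trans (sym (Vecₚ.cast-is-id refl (V A))) (Vecₚ.toList-injective refl (V A) (V A′)
      (trans (sym (columns-toTrapezoid A)) (trans (cong columns eq) (columns-toTrapezoid A′))))

  toArray-∈ : ∀ {t} → t ∈ trapezoids → toArray t ∈ arrays
  toArray-∈ {C , L , R} t∈ with ∈-goodOver⁻ {n} {α} {β} {zeroColumn n ∷ nonzeroColumns n} {m} t∈
  ... | good , (lenC , C∈) , (lenL , L∈) , (lenR , R∈) = ∈-arrays⁺
    (columns⇒valid n m S 0∈S ranged (toArray t) (subst ColumnsValid (sym (columns-toArray t len))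
      (to (good⇔valid C L R lenC lenL) good)))
    ent
    where
    t = C , L , R
    len = length-columns C L R lenC lenL lenR
    X∈ : All (_∈ columnsOver n) (columns t)
    X∈ = Allₚ.++⁺ (all-reverse L∈) (Allₚ.++⁺ (All.map ∈-allColumns⁻ C∈) R∈)
    ent : ∀ r j → Vec.lookup (Vec.lookup (toArray t) r) j ∈ entries
    ent r j = subst (_∈ entries) (lookup-lookup-transpose (toArray t) j r)
      (∈-vecsOver⁻ (lookup-all (V (toArray t)) (subst (All _) (sym (columns-toArray t len)) X∈) j) r)

  toArray-injective : ∀ {t t′} → t ∈ trapezoids → t′ ∈ trapezoids → toArray t ≡ toArray t′ → t ≡ t′
  toArray-injective {C , L , R} {C′ , L′ , R′} t∈ t′∈ eq with ∈-goodOver⁻ {n} {α} {β}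
    {zeroColumn n ∷ nonzeroColumns n} {m} t∈ | ∈-goodOver⁻ {n} {α} {β} {zeroColumn n ∷ nonzeroColumns n} {m} t′∈
  ... | _ , (lenC , _) , (lenL , _) , (lenR , _) | _ , (lenC′ , _) , (lenL′ , _) , (lenR′ , _)
    with ++-injective (reverse L) (reverse L′)
      (trans (Listₚ.length-reverse L) (trans lenL (sym (trans (Listₚ.length-reverse L′) lenL′))))
      (trans (sym (columns-toArray (C , L , R) (length-columns C L R lenC lenL lenR)))
        (trans (cong (Vec.toList ∘ V) eq)
          (columns-toArray (C′ , L′ , R′) (length-columns C′ L′ R′ lenC′ lenL′ lenR′))))
  ... | eqL , eqCR with ++-injective C C′ (trans lenC (sym lenC′)) eqCR | Listₚ.reverse-injective {x = L} {y = L′} eqL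
  ... | refl , refl | refl = refl

  w≡length-trapezoids : w n l S ≡ length trapezoids
  w≡length-trapezoids = length-≡-injections toTrapezoid toArray arrays-unique
    (goodOver-unique n α β m (allColumns-unique n))
    toTrapezoid-∈ (λ _ _ → toTrapezoid-injective) toArray-∈ toArray-injective

-- Removing zero columns from the central block

length-filter-cong : ∀ {A : Set} {P Q : A → Set} (P? : Decidable P) (Q? : Decidable Q) → (∀ x → P x ⇔ Q x) →
  ∀ xs → length (filter P? xs) ≡ length (filter Q? xs)
length-filter-cong P? Q? P⇔Q [] = refl
length-filter-cong P? Q? P⇔Q (x ∷ xs) with P? x | Q? x
... | yes _ | yes _ = cong suc (length-filter-cong P? Q? P⇔Q xs)
... | no _  | no _  = length-filter-cong P? Q? P⇔Q xs
... | yes p | no ¬q = contradiction (to (P⇔Q x) p) ¬q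
... | no ¬p | yes q = contradiction (from (P⇔Q x) q) ¬p

sumℤ-++ : ∀ xs ys → sumℤ (xs ++ ys) ≡ sumℤ xs ℤ.+ sumℤ ys
sumℤ-++ []       ys = sym (0+ _)
sumℤ-++ (x ∷ xs) ys = trans (cong (ℤ._+_ x) (sumℤ-++ xs ys)) (sym (ℤₚ.+-assoc x _ _))

walk-insert-0 : ∀ {s} as {bs} → Bit s → Walk s (as ++ + 0 ∷ bs) ⇔ Walk s (as ++ bs)
walk-insert-0 {s} [] {bs} b = mk⇔ (λ (_ , h) → subst (λ s → Walk s bs) (ℤₚ.+-identityʳ s) h)
  (λ h → subst (λ s → Bit s × Walk s bs) (sym (ℤₚ.+-identityʳ s)) (b , h))
walk-insert-0 (a ∷ as) b = mk⇔ (λ (c , h) → c , to (walk-insert-0 as c) h) (λ (c , h) → c , from (walk-insert-0 as c)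
  h)

sum-insert-0 : ∀ as bs → sumℤ (as ++ + 0 ∷ bs) ≡ sumℤ (as ++ bs)
sum-insert-0 as bs = trans (sumℤ-++ as (+ 0 ∷ bs)) (trans (cong (ℤ._+_ (sumℤ as)) (0+ _)) (sym (sumℤ-++ as bs)))

zeroColumn-central : ∀ n → Central (zeroColumn n)
zeroColumn-central zero    = tt , refl
zeroColumn-central (suc n) with zeroColumn-central n
... | b , s = (inj₁ (trans (0+ _) s) , b) , trans (0+ _) s

rows-insert-zero : ∀ {n} As {Bs} → Rows (As ++ zeroColumn n ∷ Bs) ⇔ Rows (As ++ Bs)
rows-insert-zero {n} As {Bs} = mk⇔
  (λ h r → let (w , s) = subst (λ xs → Walk (+ 0) xs × sumℤ xs ≡ + 1) (expand r) (h r) in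
    subst (λ xs → Walk (+ 0) xs × sumℤ xs ≡ + 1) (sym (Listₚ.map-++ _ As Bs))
      (to (walk-insert-0 (row r As) (inj₁ refl)) w , trans (sym (sum-insert-0 (row r As) (row r Bs))) s))
  (λ h r → let (w , s) = subst (λ xs → Walk (+ 0) xs × sumℤ xs ≡ + 1) (Listₚ.map-++ _ As Bs) (h r) in
    subst (λ xs → Walk (+ 0) xs × sumℤ xs ≡ + 1) (sym (expand r))
      (from (walk-insert-0 (row r As) (inj₁ refl)) w , trans (sum-insert-0 (row r As) (row r Bs)) s))
  where
  expand : ∀ r → row r (As ++ zeroColumn n ∷ Bs) ≡ row r As ++ + 0 ∷ row r Bs
  expand r = trans (Listₚ.map-++ _ As _) (cong (λ z → row r As ++ z ∷ row r Bs) (Vecₚ.lookup-replicate r (+ 0)))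

-- A zero inserted into a row repeats a partial sum, and the side conditions refer to the distance
-- from the central block, which does not change with its width.
good-insert-zero : ∀ {n} α β xs ys (LR : List (Vec ℤ n) × List (Vec ℤ n)) →
  Good α β (xs ++ zeroColumn n ∷ ys , LR) ⇔ Good α β (xs ++ ys , LR)
good-insert-zero {n} α β xs ys (L , R) = mk⇔
  (λ (rows , a , c , b) → subst Rows (sym assoc) (to (rows-insert-zero (reverse L ++ xs)) (subst Rows assoc₀ rows)) ,
    a ,
    Allₚ.++⁺ (Allₚ.++⁻ˡ xs c) (All.tail (Allₚ.++⁻ʳ xs c)) , b)
  (λ (rows , a , c , b) → subst Rows (sym assoc₀) (from (rows-insert-zero (reverse L ++ xs)) (subst Rows assoc rows))
    , a ,
    Allₚ.++⁺ (Allₚ.++⁻ˡ xs c) (zeroColumn-central n ∷ Allₚ.++⁻ʳ xs c) , b)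
  where
  assoc : columns (xs ++ ys , L , R) ≡ (reverse L ++ xs) ++ (ys ++ R)
  assoc = trans (cong (reverse L ++_) (Listₚ.++-assoc xs ys R)) (sym (Listₚ.++-assoc (reverse L) xs (ys ++ R)))
  assoc₀ : columns (xs ++ zeroColumn n ∷ ys , L , R) ≡ (reverse L ++ xs) ++ zeroColumn n ∷ (ys ++ R)
  assoc₀ = trans (cong (reverse L ++_) (Listₚ.++-assoc xs (zeroColumn n ∷ ys) R))
    (sym (Listₚ.++-assoc (reverse L) xs _))

reduced : ∀ n → (α β : ℕ → ℕ) → ℕ → ℕ
reduced n α β i = length (goodOver n α β (nonzeroColumns n) i)

length-goodOver : ∀ n α β zs m → length (goodOver n α β zs m) ≡
  total zs m (λ C → length (filter (λ LR → good? {n} α β (C , LR)) (cartesianProduct (words (columnsOver n) n)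
    (words (columnsOver n) n))))
length-goodOver n α β zs m = trans (length-filter-product (good? α β) (words zs m) _) (total-words zs m _)

-- Newton's form, the numbers N_i being `reduced n α β i`. The number `k` of terms is left free
-- above `m`, so that the sum can later be cut at the area.
goodOver-insert : ∀ n α β m k → m < k →
  length (goodOver n α β (zeroColumn n ∷ nonzeroColumns n) m) ≡ Σ< k (λ i → (m choose i) * reduced n α β i)
goodOver-insert n α β m k m<k = begin
  length (goodOver n α β (zeroColumn n ∷ nonzeroColumns n) m)
    ≡⟨ length-goodOver n α β _ m ⟩
  total (zeroColumn n ∷ nonzeroColumns n) m weight
    ≡⟨ total-insert (zeroColumn n) (nonzeroColumns n) m k weight m<k
         (λ xs ys → length-filter-cong (λ LR → good? α β (xs ++ zeroColumn n ∷ ys , LR))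
           (λ LR → good? α β (xs ++ ys , LR)) (good-insert-zero α β xs ys) sides) ⟩
  Σ< k (λ i → (m choose i) * total (nonzeroColumns n) i weight)
    ≡⟨ Σ<-cong k (λ i _ → cong (_*_ (m choose i)) (sym (length-goodOver n α β (nonzeroColumns n) i))) ⟩
  Σ< k (λ i → (m choose i) * reduced n α β i) ∎
  where
  open ≡-Reasoning
  sides : List (List (Vec ℤ n) × List (Vec ℤ n))
  sides = cartesianProduct (words (columnsOver n) n) (words (columnsOver n) n)
  weight : List (Vec ℤ n) → ℕ
  weight C = length (filter (λ LR → good? {n} α β (C , LR)) sides)

-- Heights and the bound on the number of nonzero central columns

-- For `α` and `β` these are the counting functions A_i and B_i.
acc : (ℕ → ℕ) → ℕ → ℕ
acc τ zero    = 0
acc τ (suc i) = acc τ i + τ i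

bit-abs : ∀ {z} → Bit z → + ℤ.∣ z ∣ ≡ z
bit-abs (inj₁ refl) = refl
bit-abs (inj₂ refl) = refl

bit-abs≤1 : ∀ {z} → Bit z → ℤ.∣ z ∣ ≤ 1
bit-abs≤1 (inj₁ refl) = z≤n
bit-abs≤1 (inj₂ refl) = s≤s z≤n

below : ∀ {n} → ℕ → Vec ℤ n → ℤ
below i x = sumℤ (take i (Vec.toList x))

-- The partial column sum above level i; it is 0 or 1 for columns of trapezoids.
excess : ∀ {n} → ℕ → Vec ℤ n → ℕ
excess i x = ℤ.∣ sumℤ (drop i (Vec.toList x)) ∣

suffixes-drop : ∀ xs → BitSuffixes xs → ∀ i → Bit (sumℤ (drop i xs))
suffixes-drop xs       b       zero    = suffix-head xs b
suffixes-drop []       b       (suc i) = inj₁ refl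
suffixes-drop (x ∷ xs) (_ , b) (suc i) = suffixes-drop xs b i

below+excess : ∀ {n} (x : Vec ℤ n) → BitSuffixes (Vec.toList x) → ∀ i → below i x ℤ.+ + excess i x ≡ colSum x
below+excess x b i = trans (cong (ℤ._+_ (below i x)) (bit-abs (suffixes-drop (Vec.toList x) b i)))
  (trans (sym (sumℤ-++ (take i (Vec.toList x)) _)) (cong sumℤ (Listₚ.take++drop≡id i (Vec.toList x))))

excess≤1 : ∀ {n} (x : Vec ℤ n) → BitSuffixes (Vec.toList x) → ∀ i → excess i x ≤ 1
excess≤1 x b i = bit-abs≤1 (suffixes-drop (Vec.toList x) b i)

below-suc : ∀ {n} (x : Vec ℤ n) r → below (suc (toℕ r)) x ≡ below (toℕ r) x ℤ.+ Vec.lookup x r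
below-suc (a ∷ x) zero    = trans (ℤₚ.+-identityʳ a) (sym (0+ a))
below-suc (a ∷ x) (suc r) = trans (cong (ℤ._+_ a) (below-suc x r)) (sym (ℤₚ.+-assoc a _ _))

lookup-below : ∀ {n} (x : Vec ℤ n) r → Vec.lookup x r ≡ below (suc (toℕ r)) x ℤ.- below (toℕ r) x
lookup-below x r = sym (trans (cong (ℤ._- below (toℕ r) x) (below-suc x r)) (cancel (below (toℕ r) x) _))

below-ext : ∀ {n} {x y : Vec ℤ n} → (∀ i → i ≤ n → below i x ≡ below i y) → x ≡ y
below-ext {x = x} {y} h = vec-ext (λ r → trans (lookup-below x r)
  (trans (cong₂ ℤ._-_ (h _ (Finₚ.toℕ<n r)) (h _ (ℕₚ.<⇒≤ (Finₚ.toℕ<n r)))) (sym (lookup-below y r))))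

below-zero : ∀ {n} (x : Vec ℤ n) c → (∀ r → toℕ r < c → Vec.lookup x r ≡ + 0) → ∀ i → i ≤ c → i ≤ n → below i x ≡ + 0
below-zero x c z zero    _   _   = refl
below-zero x c z (suc i) i<c i<n = begin
  below (suc i) x                 ≡⟨ cong (λ k → below (suc k) x) (sym r≡i) ⟩
  below (suc (toℕ r)) x           ≡⟨ below-suc x r ⟩
  below (toℕ r) x ℤ.+ Vec.lookup x r ≡⟨ cong₂ ℤ._+_
    (trans (cong (λ k → below k x) r≡i) (below-zero x c z i (ℕₚ.<⇒≤ i<c) (ℕₚ.<⇒≤ i<n)))
                                          (z r (subst (_< c) (sym r≡i) i<c)) ⟩
  + 0 ∎
  where
  open ≡-Reasoning
  r = fromℕ< i<n
  r≡i : toℕ r ≡ i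
  r≡i = Finₚ.toℕ-fromℕ< i<n

below-zeroColumn : ∀ n i → below i (zeroColumn n) ≡ + 0
below-zeroColumn n       zero    = refl
below-zeroColumn zero    (suc i) = refl
below-zeroColumn (suc n) (suc i) = trans (0+ _) (below-zeroColumn n i)

height : ∀ {n} → ℕ → List (Vec ℤ n) → ℤ
height i X = sumℤ (map (below i) X)

sumℤ-map-+ : ∀ {A : Set} (f g : A → ℤ) xs → sumℤ (map (λ x → f x ℤ.+ g x) xs) ≡ sumℤ (map f xs) ℤ.+ sumℤ (map g xs)
sumℤ-map-+ f g [] = refl
sumℤ-map-+ f g (x ∷ xs) = trans (cong (ℤ._+_ (f x ℤ.+ g x)) (sumℤ-map-+ f g xs))
  (solve 4 (λ a b c d → a :+ b :+ (c :+ d) := a :+ c :+ (b :+ d)) refl (f x) (g x) (sumℤ (map f xs))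
    (sumℤ (map g xs)))
  where open Data.Integer.Solver.+-*-Solver

sumℤ-reverse : ∀ xs → sumℤ (reverse xs) ≡ sumℤ xs
sumℤ-reverse [] = refl
sumℤ-reverse (x ∷ xs) = begin
  sumℤ (reverse (x ∷ xs))      ≡⟨ cong sumℤ (Listₚ.unfold-reverse x xs) ⟩
  sumℤ (reverse xs ++ x ∷ [])  ≡⟨ sumℤ-++ (reverse xs) _ ⟩
  sumℤ (reverse xs) ℤ.+ (x ℤ.+ + 0) ≡⟨ cong₂ ℤ._+_ (sumℤ-reverse xs) (ℤₚ.+-identityʳ x) ⟩
  sumℤ xs ℤ.+ x                ≡⟨ ℤₚ.+-comm (sumℤ xs) x ⟩
  x ℤ.+ sumℤ xs ∎
  where open ≡-Reasoning

height-++ : ∀ {n} i (X Y : List (Vec ℤ n)) → height i (X ++ Y) ≡ height i X ℤ.+ height i Y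
height-++ i X Y = trans (cong sumℤ (Listₚ.map-++ (below i) X Y)) (sumℤ-++ (map (below i) X) _)

height-reverse : ∀ {n} i (X : List (Vec ℤ n)) → height i (reverse X) ≡ height i X
height-reverse i X = trans (cong sumℤ (Listₚ.reverse-map (below i) X)) (sumℤ-reverse (map (below i) X))

height-suc : ∀ {n} (X : List (Vec ℤ n)) r → height (suc (toℕ r)) X ≡ height (toℕ r) X ℤ.+ sumℤ (row r X)
height-suc X r = trans (cong sumℤ (Listₚ.map-cong (λ x → below-suc x r) X))
  (sumℤ-map-+ (below (toℕ r)) (λ x → Vec.lookup x r) X)

height-0 : ∀ {n} (X : List (Vec ℤ n)) → height 0 X ≡ + 0
height-0 [] = refl
height-0 (x ∷ X) = trans (0+ _) (height-0 X)

rows⇒height : ∀ {n} {X : List (Vec ℤ n)} → Rows X → ∀ i → i ≤ n → height i X ≡ + i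
rows⇒height {X = X} rows zero    _   = height-0 X
rows⇒height {X = X} rows (suc i) i<n = begin
  height (suc i) X                     ≡⟨ cong (λ k → height (suc k) X) (sym r≡i) ⟩
  height (suc (toℕ r)) X               ≡⟨ height-suc X r ⟩
  height (toℕ r) X ℤ.+ sumℤ (row r X)  ≡⟨ cong₂ ℤ._+_
    (trans (cong (λ k → height k X) r≡i) (rows⇒height {X = X} rows i (ℕₚ.<⇒≤ i<n))) (proj₂ (rows r)) ⟩
  + i ℤ.+ + 1                          ≡⟨ cong +_ (ℕₚ.+-comm i 1) ⟩
  + suc i ∎
  where
  open ≡-Reasoning
  r = fromℕ< i<n
  r≡i : toℕ r ≡ i
  r≡i = Finₚ.toℕ-fromℕ< i<n

-- Side column `c` vanishes in its lowest `c` rows, so for `i ≤ c` its excess at level `i` is the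
-- whole column sum. That is no loss against A_i or B_i, which do not count this column yet, and it
-- is discarded.
cut : ℕ → ℕ → ℕ → ℕ
cut c i e = if does (c ℕₚ.<? i) then e else 0

sideDefect : ∀ {n} → ℕ → ℕ → List (Vec ℤ n) → ℕ
sideDefect i c []       = 0
sideDefect i c (x ∷ xs) = cut c i (excess i x) + sideDefect i (suc c) xs

cut-< : ∀ {c i} e → c < i → cut c i e ≡ e
cut-< {c} {i} e c<i = cong (λ b → if b then e else 0) (dec-true (c ℕₚ.<? i) c<i)

cut-≥ : ∀ {c i} e → i ≤ c → cut c i e ≡ 0
cut-≥ {c} {i} e i≤c = cong (λ b → if b then e else 0) (dec-false (c ℕₚ.<? i) (ℕₚ.≤⇒≯ i≤c))

sideColumn-below : ∀ {n} τ c (x : Vec ℤ n) → SideColumn τ c x → ∀ i → i ≤ n → below i x ℤ.+ + cut c i (excess i x) ≡ +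
  cut c i (τ c)
sideColumn-below τ c x (b , s , z) i i≤n with ℕₚ.≤-<-connex i c
... | inj₂ c<i rewrite cut-< (excess i x) c<i | cut-< (τ c) c<i = trans (below+excess x b i) s
... | inj₁ i≤c rewrite cut-≥ (excess i x) i≤c | cut-≥ (τ c) i≤c =
  trans (ℤₚ.+-identityʳ _) (below-zero x c z i i≤c i≤n)

acc-⊓ : ∀ τ c i → cut c i (τ c) + acc τ (c ⊓ i) ≡ acc τ (suc c ⊓ i)
acc-⊓ τ c i with ℕₚ.≤-<-connex i c
... | inj₂ c<i rewrite cut-< (τ c) c<i | ℕₚ.m≤n⇒m⊓n≡m c<i | ℕₚ.m≤n⇒m⊓n≡m (ℕₚ.<⇒≤ c<i) = ℕₚ.+-comm (τ c) (acc τ c)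
... | inj₁ i≤c rewrite cut-≥ (τ c) i≤c | ℕₚ.m≥n⇒m⊓n≡n i≤c | ℕₚ.m≥n⇒m⊓n≡n (ℕₚ.m≤n⇒m≤1+n i≤c) = refl

-- The term `acc τ (c ⊓ i)` stands for the `c` columns nearer to the centre that the induction has
-- already passed; it vanishes for `c = 0`.
side-balance : ∀ {n} τ c (xs : List (Vec ℤ n)) → Side τ c xs → ∀ i → i ≤ length xs + c → i ≤ n →
  (height i xs ℤ.+ + sideDefect i c xs) ℤ.+ + acc τ (c ⊓ i) ≡ + acc τ i
side-balance τ c [] _ i i≤c _ = cong (λ k → + acc τ k) (ℕₚ.m≥n⇒m⊓n≡n i≤c)
side-balance τ c (x ∷ xs) (sx , sxs) i i≤ i≤n = begin
  ((below i x ℤ.+ height i xs) ℤ.+ + (cut c i (excess i x) + sideDefect i (suc c) xs)) ℤ.+ + acc τ (c ⊓ i)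
    ≡⟨ cong (λ z → ((below i x ℤ.+ height i xs) ℤ.+ z) ℤ.+ + acc τ (c ⊓ i)) (ℤₚ.pos-+ (cut c i (excess i x)) _) ⟩
  ((below i x ℤ.+ height i xs) ℤ.+ (+ cut c i (excess i x) ℤ.+ + sideDefect i (suc c) xs)) ℤ.+ + acc τ (c ⊓ i)
    ≡⟨ solve 5 (λ a b c d e → ((a :+ b) :+ (c :+ d)) :+ e := (b :+ d) :+ ((a :+ c) :+ e)) refl
         (below i x) (height i xs) (+ cut c i (excess i x)) (+ sideDefect i (suc c) xs) (+ acc τ (c ⊓ i)) ⟩
  (height i xs ℤ.+ + sideDefect i (suc c) xs) ℤ.+ ((below i x ℤ.+ + cut c i (excess i x)) ℤ.+ + acc τ (c ⊓ i))
    ≡⟨ cong (ℤ._+_ (height i xs ℤ.+ + sideDefect i (suc c) xs))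
         (trans (cong (ℤ._+ + acc τ (c ⊓ i)) (sideColumn-below τ c x sx i i≤n))
           (trans (sym (ℤₚ.pos-+ (cut c i (τ c)) _)) (cong +_ (acc-⊓ τ c i)))) ⟩
  (height i xs ℤ.+ + sideDefect i (suc c) xs) ℤ.+ + acc τ (suc c ⊓ i)
    ≡⟨ side-balance τ (suc c) xs sxs i (subst (i ≤_) (sym (ℕₚ.+-suc (length xs) c)) i≤) i≤n ⟩
  + acc τ i ∎
  where
  open ≡-Reasoning
  open Data.Integer.Solver.+-*-Solver

side-height : ∀ {n} τ (xs : List (Vec ℤ n)) → length xs ≡ n → Side τ 0 xs → ∀ i → i ≤ n →
  height i xs ℤ.+ + sideDefect i 0 xs ≡ + acc τ i
side-height {n} τ xs len side i i≤n = trans (sym (ℤₚ.+-identityʳ _))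
  (side-balance τ 0 xs side i (subst (i ≤_) (trans (sym len) (sym (ℕₚ.+-identityʳ _))) i≤n) i≤n)

excesses : ∀ {n} → ℕ → List (Vec ℤ n) → ℕ
excesses i C = sum (map (excess i) C)

central-height : ∀ {n} {C : List (Vec ℤ n)} → All Central C → ∀ i → height i C ℤ.+ + excesses i C ≡ + 0
central-height [] i = refl
central-height {C = x ∷ C} ((b , s) ∷ cs) i = begin
  (below i x ℤ.+ height i C) ℤ.+ + (excess i x + excesses i C)
    ≡⟨ cong (ℤ._+_ (below i x ℤ.+ height i C)) (ℤₚ.pos-+ (excess i x) _) ⟩
  (below i x ℤ.+ height i C) ℤ.+ (+ excess i x ℤ.+ + excesses i C)
    ≡⟨ solve 4 (λ a b c d → (a :+ b) :+ (c :+ d) := (a :+ c) :+ (b :+ d)) refl (below i x) (height i C) (+ excess i x)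
      (+ excesses i C) ⟩
  (below i x ℤ.+ + excess i x) ℤ.+ (height i C ℤ.+ + excesses i C)
    ≡⟨ cong₂ ℤ._+_ (trans (below+excess x b i) s) (central-height cs i) ⟩
  + 0 ∎
  where
  open ≡-Reasoning
  open Data.Integer.Solver.+-*-Solver

-- The lowest `i` rows sum to `i`. Added up by columns, the left side gives `acc α i` minus its
-- defect, the centre gives minus its excesses, and the right side gives `acc β i` minus its defect.
level-balance : ∀ {n α β} {C L R : List (Vec ℤ n)} → Good α β (C , L , R) → length L ≡ n → length R ≡ n → ∀ i →
  i ≤ n →
  i + (sideDefect i 0 L + (excesses i C + sideDefect i 0 R)) ≡ acc α i + acc β i
level-balance {n} {α} {β} {C} {L} {R} (rows , sL , sC , sR) lenL lenR i i≤n = ℤₚ.+-injective (begin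
  + (i + (dL + (eC + dR)))
    ≡⟨ trans (ℤₚ.pos-+ i _) (cong (ℤ._+_ (+ i)) (trans (ℤₚ.pos-+ dL _) (cong (ℤ._+_ (+ dL)) (ℤₚ.pos-+ eC dR)))) ⟩
  + i ℤ.+ (+ dL ℤ.+ (+ eC ℤ.+ + dR))
    ≡⟨ cong (ℤ._+ (+ dL ℤ.+ (+ eC ℤ.+ + dR))) (sym total-height) ⟩
  (height i L ℤ.+ (height i C ℤ.+ height i R)) ℤ.+ (+ dL ℤ.+ (+ eC ℤ.+ + dR))
    ≡⟨ solve 6 (λ a b c d e f → (a :+ (b :+ c)) :+ (d :+ (e :+ f)) := (a :+ d) :+ ((b :+ e) :+ (c :+ f))) refl
         (height i L) (height i C) (height i R) (+ dL) (+ eC) (+ dR) ⟩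
  (height i L ℤ.+ + dL) ℤ.+ ((height i C ℤ.+ + eC) ℤ.+ (height i R ℤ.+ + dR))
    ≡⟨ cong₂ ℤ._+_ (side-height α L lenL sL i i≤n)
      (trans (cong₂ ℤ._+_ (central-height sC i) (side-height β R lenR sR i i≤n)) (0+ (+ acc β i))) ⟩
  + acc α i ℤ.+ + acc β i ≡⟨ ℤₚ.pos-+ (acc α i) _ ⟨
  + (acc α i + acc β i) ∎)
  where
  open ≡-Reasoning
  open Data.Integer.Solver.+-*-Solver
  dL = sideDefect i 0 L
  dR = sideDefect i 0 R
  eC = excesses i C
  total-height : height i L ℤ.+ (height i C ℤ.+ height i R) ≡ + i
  total-height = trans (cong₂ ℤ._+_ (sym (height-reverse i L)) (sym (height-++ i C R)))
    (trans (sym (height-++ i (reverse L) (C ++ R))) (rows⇒height {X = columns (C , L , R)} rows i i≤n))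

-- For a central column, the total amount by which it lowers the heights h(i).
columnWeight : ∀ {n} → Vec ℤ n → ℕ
columnWeight {n} x = Σ< (suc n) (λ i → excess i x)

Σ<≡0 : ∀ k (f : ℕ → ℕ) → Σ< k f ≡ 0 → ∀ i → i < k → f i ≡ 0
Σ<≡0 (suc k) f eq zero    _         = ℕₚ.m+n≡0⇒m≡0 (f 0) eq
Σ<≡0 (suc k) f eq (suc i) (s≤s i<k) = Σ<≡0 k (f ∘ suc) (ℕₚ.m+n≡0⇒n≡0 (f 0) eq) i i<k

central-below : ∀ {n} {x : Vec ℤ n} → Central x → ∀ i → below i x ≡ ℤ.- (+ excess i x)
central-below {x = x} (b , s) i = begin
  below i x                                       ≡⟨ cancel (+ excess i x) (below i x) ⟨
  (+ excess i x ℤ.+ below i x) ℤ.- + excess i x   ≡⟨ cong (ℤ._- + excess i x)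
    (trans (ℤₚ.+-comm (+ excess i x) (below i x)) (trans (below+excess x b i) s)) ⟩
  + 0 ℤ.- + excess i x                            ≡⟨ 0+ _ ⟩
  ℤ.- (+ excess i x) ∎
  where open ≡-Reasoning

central-ext : ∀ {n} {x y : Vec ℤ n} → Central x → Central y → (∀ i → i ≤ n → excess i x ≡ excess i y) → x ≡ y
central-ext cx cy eq = below-ext (λ i i≤n → trans (central-below cx i) (trans (cong (λ e → ℤ.- (+ e)) (eq i i≤n))
  (sym (central-below cy i))))

-- If all excesses of a central column vanish, so do its partial sums from below, and these
-- determine its entries.
columnWeight-positive : ∀ {n} (x : Vec ℤ n) → Central x → x ≢ zeroColumn n → 1 ≤ columnWeight x
columnWeight-positive {n} x cx x≢0 = ℕₚ.n≢0⇒n>0 (λ eq → x≢0 (below-ext (λ i i≤n →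
  trans (central-below cx i) (trans (cong (λ e → ℤ.- (+ e)) (Σ<≡0 (suc n) (λ i → excess i x) eq i (s≤s i≤n)))
    (sym (below-zeroColumn n i))))))

Σ<-excesses : ∀ {n} (C : List (Vec ℤ n)) → Σ< (suc n) (λ i → excesses i C) ≡ sum (map columnWeight C)
Σ<-excesses {n} C = sym (sum-Σ<-swap C (suc n) (λ x i → excess i x))

length≤weights : ∀ {A : Set} (f : A → ℕ) C → All (λ x → 1 ≤ f x) C → length C ≤ sum (map f C)
length≤weights f []      []       = z≤n
length≤weights f (x ∷ C) (p ∷ ps) = ℕₚ.+-mono-≤ p (length≤weights f C ps)

weights-tight : ∀ {A : Set} (f : A → ℕ) C → All (λ x → 1 ≤ f x) C → sum (map f C) ≤ length C → All (λ x → f x ≡ 1) C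
weights-tight f []      []       _  = []
weights-tight f (x ∷ C) (p ∷ ps) le = ℕₚ.≤-antisym fx≤1 p ∷ weights-tight f C ps rest
  where
  fx≤1 : f x ≤ 1
  fx≤1 = ℕₚ.+-cancelʳ-≤ (length C) (f x) 1 (ℕₚ.≤-trans (ℕₚ.+-monoʳ-≤ (f x) (length≤weights f C ps)) le)
  rest : sum (map f C) ≤ length C
  rest = ℕₚ.+-cancelˡ-≤ 1 _ _ (ℕₚ.≤-trans (ℕₚ.+-monoˡ-≤ (sum (map f C)) p) le)

-- The sum of the heights A_i + B_i - i of the Motzkin path at the integers. It is the area under
-- the path because both end heights are 0.
area : ℕ → (α β : ℕ → ℕ) → ℕ
area n α β = Σ< (suc n) (λ i → acc α i + acc β i ∸ i)

module Reduced {n α β} {C L R : List (Vec ℤ n)} (good : Good α β (C , L , R)) (lenL : length L ≡ n) (lenR : length R ≡ n)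
  (C≢0 : All (_≢ zeroColumn n) C) where

  heavy : All (λ x → 1 ≤ columnWeight x) C
  heavy = All.zipWith (λ {x} (c , z) → columnWeight-positive x c z) (proj₁ (proj₂ (proj₂ good)) , C≢0)

  dL eC dR : ℕ → ℕ
  dL i = sideDefect i 0 L
  eC i = excesses i C
  dR i = sideDefect i 0 R

  level : ∀ i → i ≤ n → dL i + (eC i + dR i) ≡ acc α i + acc β i ∸ i
  level i i≤n = trans (sym (ℕₚ.m+n∸m≡n i _)) (cong (_∸ i) (level-balance good lenL lenR i i≤n))

  defects : ℕ
  defects = Σ< (suc n) dL + Σ< (suc n) dR

  -- Sum of `level-balance` over all levels: the area is shared between the weights of the central
  -- columns and the defects of the sides.
  area-split : sum (map columnWeight C) + defects ≡ area n α β
  area-split = begin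
    sum (map columnWeight C) + (Σ< (suc n) dL + Σ< (suc n) dR)
      ≡⟨ cong (_+ defects) (sym (Σ<-excesses C)) ⟩
    Σ< (suc n) eC + (Σ< (suc n) dL + Σ< (suc n) dR)
      ≡⟨ solve 3 (λ a b c → a :+ (b :+ c) := b :+ (a :+ c)) refl (Σ< (suc n) eC) (Σ< (suc n) dL) (Σ< (suc n) dR) ⟩
    Σ< (suc n) dL + (Σ< (suc n) eC + Σ< (suc n) dR)
      ≡⟨ sym (trans (Σ<-+ (suc n) dL (λ i → eC i + dR i)) (cong (_+_ (Σ< (suc n) dL)) (Σ<-+ (suc n) eC dR))) ⟩
    Σ< (suc n) (λ i → dL i + (eC i + dR i))
      ≡⟨ Σ<-cong (suc n) (λ i i<sn → level i (ℕₚ.≤-pred i<sn)) ⟩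
    area n α β ∎
    where
    open ≡-Reasoning
    open Data.Nat.Solver.+-*-Solver

  length≤area : length C ≤ area n α β
  length≤area = ℕₚ.≤-trans (length≤weights columnWeight C heavy) (subst (sum (map columnWeight C) ≤_) area-split
    (ℕₚ.m≤m+n _ defects))

  module Tight (tight : length C ≡ area n α β) where
    -- Each of the `length C` columns takes at least one unit of the area, so equality leaves
    -- nothing to the sides. In the same way no column can take more than one unit.
    defects≡0 : defects ≡ 0
    defects≡0 = ℕₚ.n≤0⇒n≡0 (ℕₚ.+-cancelˡ-≤ (sum (map columnWeight C)) _ _ (begin
      sum (map columnWeight C) + defects ≡⟨ trans area-split (sym tight) ⟩
      length C                           ≤⟨ length≤weights columnWeight C heavy ⟩
      sum (map columnWeight C)           ≡⟨ ℕₚ.+-identityʳ _ ⟨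
      sum (map columnWeight C) + 0       ∎))
      where open ℕₚ.≤-Reasoning

    dL≡0 : ∀ i → i ≤ n → dL i ≡ 0
    dL≡0 i i≤n = Σ<≡0 (suc n) dL (ℕₚ.m+n≡0⇒m≡0 _ defects≡0) i (s≤s i≤n)

    dR≡0 : ∀ i → i ≤ n → dR i ≡ 0
    dR≡0 i i≤n = Σ<≡0 (suc n) dR (ℕₚ.m+n≡0⇒n≡0 (Σ< (suc n) dL) defects≡0) i (s≤s i≤n)

    single : All (λ x → columnWeight x ≡ 1) C
    single = weights-tight columnWeight C heavy (ℕₚ.≤-reflexive
      (trans (trans (sym (ℕₚ.+-identityʳ _)) (cong (_+_ (sum (map columnWeight C))) (sym defects≡0)))
        (trans area-split (sym tight))))

    eC-area : ∀ i → i ≤ n → i + eC i ≡ acc α i + acc β i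
    eC-area i i≤n = trans (cong (_+_ i)
      (sym (trans (cong₂ (λ a b → a + (eC i + b)) (dL≡0 i i≤n) (dR≡0 i i≤n)) (ℕₚ.+-identityʳ _))))
      (level-balance good lenL lenR i i≤n)

    height-L : ∀ i → i ≤ n → height i L ≡ + acc α i
    height-L i i≤n = trans (sym (ℤₚ.+-identityʳ _)) (trans (cong (λ d → height i L ℤ.+ + d) (sym (dL≡0 i i≤n)))
      (side-height α L lenL (proj₁ (proj₂ good)) i i≤n))

reduced≡0 : ∀ n α β k → area n α β < k → reduced n α β k ≡ 0
reduced≡0 n α β k area<k with goodOver n α β (nonzeroColumns n) k in eq
... | [] = refl
... | (C , L , R) ∷ _ with ∈-goodOver⁻ {n} {α} {β} {nonzeroColumns n} {k} {C} {L} {R}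
  (subst ((C , L , R) ∈_) (sym eq) (here refl))
... | good , (lenC , C∈) , (lenL , _) , (lenR , _) = contradiction (subst (_≤ area n α β) lenC
    (Reduced.length≤area good lenL lenR (All.map (λ x∈ → proj₂ (∈-filter⁻ nonzero? {xs = columnsOver n} x∈)) C∈)))
      (ℕₚ.<⇒≱ area<k)

-- Without defect the partial sums of side column `c` jump from 0 to `τ c` as soon as they may, in
-- row `c`. This fixes every column.
tight-side-unique : ∀ {n} τ c (xs ys : List (Vec ℤ n)) → length xs ≡ length ys → Side τ c xs → Side τ c ys →
  (∀ i → i ≤ n → sideDefect i c xs ≡ 0) → (∀ i → i ≤ n → sideDefect i c ys ≡ 0) → xs ≡ ys
tight-side-unique τ c [] [] _ _ _ _ _ = refl
tight-side-unique τ c (x ∷ xs) (y ∷ ys) len (sx , sxs) (sy , sys) dx dy = cong₂ _∷_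
  (below-ext (λ i i≤n → trans (tight-below x xs sx dx i i≤n) (sym (tight-below y ys sy dy i i≤n))))
  (tight-side-unique τ (suc c) xs ys (ℕₚ.suc-injective len) sxs sys
    (λ i i≤n → ℕₚ.m+n≡0⇒n≡0 (cut c i (excess i x)) (dx i i≤n)) (λ i i≤n → ℕₚ.m+n≡0⇒n≡0 (cut c i (excess i y))
      (dy i i≤n)))
  where
  tight-below : ∀ x xs → SideColumn τ c x → (∀ i → i ≤ _ → sideDefect i c (x ∷ xs) ≡ 0) → ∀ i → i ≤ _ →
    below i x ≡ + cut c i (τ c)
  tight-below x xs sx dx i i≤n = trans (sym (ℤₚ.+-identityʳ _))
    (trans (cong (λ d → below i x ℤ.+ + d) (sym (ℕₚ.m+n≡0⇒m≡0 (cut c i (excess i x)) (dx i i≤n))))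
      (sideColumn-below τ c x sx i i≤n))

-- Flows and standard fillings

count : ∀ {Q : ℕ → Set} → Decidable Q → ℕ → ℕ
count Q? M = Σ< M (λ x → if does (Q? x) then 1 else 0)

count-none : ∀ {Q : ℕ → Set} (Q? : Decidable Q) M → (∀ x → x < M → ¬ Q x) → count Q? M ≡ 0
count-none Q? M none = Σ<-zero M (λ x x<M → cong (λ b → if b then 1 else 0) (dec-false (Q? x) (none x x<M)))

count≤ : ∀ {Q : ℕ → Set} (Q? : Decidable Q) M → count Q? M ≤ M
count≤ Q? zero    = z≤n
count≤ Q? (suc M) with does (Q? 0)
... | true  = s≤s (count≤ (Q? ∘ suc) M)
... | false = ℕₚ.m≤n⇒m≤1+n (count≤ (Q? ∘ suc) M)

downward : ∀ {Q : ℕ → Set} M → (∀ x → suc x < M → Q (suc x) → Q x) → ∀ x → x < M → Q x → Q 0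
downward M down zero    _   q = q
downward M down (suc x) x<M q = downward M down x (ℕₚ.<⇒≤ x<M) (down x x<M q)

-- A property closed downwards holds on an initial segment, whose length is the count. Both the
-- passage from flows to fillings and the one back are defined by such counts.
threshold : ∀ {Q : ℕ → Set} (Q? : Decidable Q) M → (∀ x → suc x < M → Q (suc x) → Q x) →
  ∀ x → x < M → Q x ⇔ x < count Q? M
threshold {Q} Q? (suc M) down x x<M with Q? 0
... | no ¬q0 = mk⇔ (λ q → contradiction (downward (suc M) down x x<M q) ¬q0)
    (λ x< → contradiction (subst (x <_)
      (count-none (Q? ∘ suc) M (λ y y<M q → ¬q0 (downward (suc M) down (suc y) (s≤s y<M) q))) x<) λ ())
threshold {Q} Q? (suc M) down zero x<M | yes q0 = mk⇔ (λ _ → z<s) (λ _ → q0)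
threshold {Q} Q? (suc M) down (suc x) (s≤s x<M) | yes q0 = mk⇔ (λ q → s≤s (to ih q)) (λ { (s≤s x<) → from ih x< })
  where ih = threshold (Q? ∘ suc) M (λ y y<M → down (suc y) (s≤s y<M)) x x<M

count-≡ : ∀ {Q : ℕ → Set} (Q? : Decidable Q) M p → p ≤ M → (∀ x → x < M → Q x ⇔ x < p) → count Q? M ≡ p
count-≡ {Q} Q? M p p≤M Q⇔ = ℕₚ.≤-antisym
  (ℕₚ.≮⇒≥ (λ p<c → ℕₚ.<-irrefl refl (to (Q⇔ p (ℕₚ.<-≤-trans p<c (count≤ Q? M)))
    (from (thr p (ℕₚ.<-≤-trans p<c (count≤ Q? M))) p<c))))
  (ℕₚ.≮⇒≥ (λ c<p → ℕₚ.<-irrefl refl (to (thr (count Q? M) (ℕₚ.<-≤-trans c<p p≤M))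
    (from (Q⇔ (count Q? M) (ℕₚ.<-≤-trans c<p p≤M)) c<p))))
  where
  thr = threshold Q? M (λ x x<M q → from (Q⇔ x (ℕₚ.<⇒≤ x<M)) (ℕₚ.<⇒≤ (to (Q⇔ (suc x) x<M) q)))

Increment : ℕ → ℕ → Set
Increment a b = b ≡ a ⊎ b ≡ suc a

increment : ∀ {a b} → a ≤ b → b ≤ suc a → Increment a b
increment {a} {b} a≤b b≤sa with ℕₚ.m≤n⇒m<n∨m≡n b≤sa
... | inj₁ b<sa = inj₁ (ℕₚ.≤-antisym (ℕₚ.≤-pred b<sa) a≤b)
... | inj₂ eq   = inj₂ eq

increment-≤ : ∀ {a b} → Increment a b → a ≤ b
increment-≤ (inj₁ refl) = ℕₚ.≤-refl
increment-≤ (inj₂ refl) = ℕₚ.n≤1+n _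

increment-≥ : ∀ {a b} → Increment a b → b ≤ suc a
increment-≥ (inj₁ refl) = ℕₚ.n≤1+n _
increment-≥ (inj₂ refl) = ℕₚ.≤-refl

-- A i and B i count the elements of S in {-i,…,-1} and {1,…,i}.
record Profile (n : ℕ) (A B : ℕ → ℕ) : Set where
  field
    A-zero  : A 0 ≡ 0
    B-zero  : B 0 ≡ 0
    A-inc   : ∀ i → Increment (A i) (A (suc i))
    B-inc   : ∀ i → Increment (B i) (B (suc i))
    bounded : ∀ i → A i + B i ≤ n
    catalan : ∀ i → i ≤ n → i ≤ A i + B i

module Flows {n A B} (profile : Profile n A B) (D : ℕ) where
  open Profile profile

  -- The cell of the skew shape on the i-th antidiagonal, in the t-th row from below.
  Cell : ℕ → ℕ → Set
  Cell i t = 1 ≤ t × t ≤ A i × i < B i + t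

  A≤ : ∀ i → A i ≤ i
  A≤ zero    = ℕₚ.≤-reflexive A-zero
  A≤ (suc i) = ℕₚ.≤-trans (increment-≥ (A-inc i)) (s≤s (A≤ i))

  B≤ : ∀ i → B i ≤ i
  B≤ zero    = ℕₚ.≤-reflexive B-zero
  B≤ (suc i) = ℕₚ.≤-trans (increment-≥ (B-inc i)) (s≤s (B≤ i))

  cell<n : ∀ {i t} → Cell i t → i < n
  cell<n {i} {t} (_ , t≤A , i<) =
    ℕₚ.≤-trans i< (ℕₚ.≤-trans (ℕₚ.+-monoʳ-≤ (B i) t≤A) (subst (_≤ n) (ℕₚ.+-comm (A i) (B i)) (bounded i)))

  -- h x i is the sum of the lowest i rows over the left and the first x central columns.
  record Flow (h : ℕ → ℕ → ℕ) : Set where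
    field
      start : ∀ i → i ≤ n → h 0 i ≡ A i
      end   : ∀ i → i ≤ n → B i + h D i ≡ i
      fall  : ∀ x i → x < D → i ≤ n → Increment (h (suc x) i) (h x i)
      slope : ∀ x i → x ≤ D → i < n → Increment (h x i) (h x (suc i))

    antitone : ∀ i → i ≤ n → ∀ x k → x + k ≤ D → h (x + k) i ≤ h x i
    antitone i i≤n x zero    _  = ℕₚ.≤-reflexive (cong (λ y → h y i) (ℕₚ.+-identityʳ x))
    antitone i i≤n x (suc k) le = ℕₚ.≤-trans
      (subst (λ y → h y i ≤ h (x + k) i) (sym (ℕₚ.+-suc x k))
        (increment-≤ (fall (x + k) i (subst (_≤ D) (ℕₚ.+-suc x k) le) i≤n)))
      (antitone i i≤n x k (ℕₚ.≤-trans (ℕₚ.+-monoʳ-≤ x (ℕₚ.n≤1+n k)) le))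

    upper : ∀ {x i} → x ≤ D → i ≤ n → h x i ≤ A i
    upper {x} {i} x≤D i≤n = subst (h x i ≤_) (start i i≤n) (antitone i i≤n 0 x x≤D)

    lower : ∀ {x i} → x ≤ D → i ≤ n → i ≤ B i + h x i
    lower {x} {i} x≤D i≤n = ℕₚ.≤-trans (ℕₚ.≤-reflexive (sym (end i i≤n))) (ℕₚ.+-monoʳ-≤ (B i)
      (subst (λ y → h y i ≤ h x i) (ℕₚ.m+[n∸m]≡n x≤D) (antitone i i≤n x (D ∸ x) (ℕₚ.≤-reflexive (ℕₚ.m+[n∸m]≡n x≤D)))))

  -- In a step at most one level falls, and by `Flow.fall` only by one: at most one cell is passed
  -- at a time.
  SingleFall : (ℕ → ℕ → ℕ) → Set
  SingleFall h = ∀ x i j → x < D → i ≤ n → j ≤ n → h (suc x) i < h x i → h (suc x) j < h x j → i ≡ j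

  -- In the coordinates `i`, `t` the right neighbour of a cell is `(i+1, t)` and the neighbour above
  -- it is `(i+1, t+1)`, whence the reversed inequality in `colwise`.
  record Standard (V : ℕ → ℕ → ℕ) : Set where
    field
      range    : ∀ i t → Cell i t → 1 ≤ V i t × V i t ≤ D
      rowwise  : ∀ i t → Cell i t → Cell (suc i) t → V i t < V (suc i) t
      colwise  : ∀ i t → Cell (suc i) (suc t) → Cell i t → V (suc i) (suc t) < V i t
      distinct : ∀ i t j s → Cell i t → Cell j s → V i t ≡ V j s → i ≡ j × t ≡ s

  -- As `h x i` decreases with `x`, this is the first `x` with `h x i < t`, that is the number,
  -- counted from 1, of the central column that brings level `i` below `t`. The range `suc D` admits
  -- all `x ≤ D`.
  value : (ℕ → ℕ → ℕ) → ℕ → ℕ → ℕ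
  value h i t = count (λ x → t ℕₚ.≤? h x i) (suc D)

  module _ {h} (flow : Flow h) where
    open Flow flow

    value-threshold : ∀ i t x → i ≤ n → x ≤ D → t ≤ h x i ⇔ x < value h i t
    value-threshold i t x i≤n x≤D = threshold (λ x → t ℕₚ.≤? h x i) (suc D)
      (λ y y< t≤ → ℕₚ.≤-trans t≤ (increment-≤ (fall y i (ℕₚ.≤-pred y<) i≤n))) x (s≤s x≤D)

    value-range : ∀ i t → Cell i t → 1 ≤ value h i t × value h i t ≤ D
    value-range i t c@(_ , t≤A , i<) = to (value-threshold i t 0 i≤n z≤n) (subst (t ≤_) (sym (start i i≤n)) t≤A) ,
      ℕₚ.≮⇒≥ (λ D< → ℕₚ.<⇒≱ i< (subst (B i + t ≤_) (end i i≤n)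
        (ℕₚ.+-monoʳ-≤ (B i) (from (value-threshold i t D i≤n ℕₚ.≤-refl) D<))))
      where
      i≤n : i ≤ n
      i≤n = ℕₚ.<⇒≤ (cell<n c)

    value-fall : ∀ i t → Cell i t → ∀ x → value h i t ≡ suc x → x < D × t ≤ h x i × h (suc x) i < t
    value-fall i t c x eq = x<D ,
      from (value-threshold i t x i≤n (ℕₚ.<⇒≤ x<D)) (subst (x <_) (sym eq) ℕₚ.≤-refl) ,
      ℕₚ.≰⇒> (λ t≤ → ℕₚ.<-irrefl refl (subst (suc x <_) eq (to (value-threshold i t (suc x) i≤n x<D) t≤)))
      where
      i≤n : i ≤ n
      i≤n = ℕₚ.<⇒≤ (cell<n c)
      x<D : x < D
      x<D = subst (_≤ D) eq (proj₂ (value-range i t c))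

    -- Equal values mean two falls in the same step `x`. `SingleFall` makes the levels agree, and a
    -- fall by one leaves only the row `t = h (suc x) i + 1`.
    value-distinct : SingleFall h → ∀ i t j s → Cell i t → Cell j s → value h i t ≡ value h j s → i ≡ j × t ≡ s
    value-distinct single i t j s c c′ eq with value h i t in v | proj₁ (value-range i t c)
    ... | suc x | _ with value-fall i t c x v | value-fall j s c′ x (sym eq)
    ... | x<D , t≤ , <t | _ , s≤ , <s with single x i j x<D (ℕₚ.<⇒≤ (cell<n c)) (ℕₚ.<⇒≤ (cell<n c′))
      (ℕₚ.<-≤-trans <t t≤) (ℕₚ.<-≤-trans <s s≤)
    ... | refl = refl , trans (exact t≤ <t) (sym (exact s≤ <s))
      where
      exact : ∀ {t} → t ≤ h x i → h (suc x) i < t → t ≡ suc (h (suc x) i)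
      exact t≤ <t = ℕₚ.≤-antisym (ℕₚ.≤-trans t≤ (increment-≥ (fall x i x<D (ℕₚ.<⇒≤ (cell<n c))))) <t

    value-mono : ∀ i t j s → Cell i t → Cell j s → (∀ x → x ≤ D → t ≤ h x i → s ≤ h x j) → value h i t ≤ value h j s
    value-mono i t j s c c′ imp with value h i t in v
    ... | zero  = z≤n
    ... | suc x with value-fall i t c x v
    ... | x<D , t≤ , _ = to (value-threshold j s x (ℕₚ.<⇒≤ (cell<n c′)) (ℕₚ.<⇒≤ x<D)) (imp x (ℕₚ.<⇒≤ x<D) t≤)

    value-standard : SingleFall h → Standard (value h)
    value-standard single = record
      { range = value-range
      -- Since `h x` does not decrease from level `i` to `i+1`, a row still reached at level `i` is
      -- reached at level `i+1`. Strictness comes from distinctness.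
      ; rowwise = λ i t c c′ → ℕₚ.≤∧≢⇒<
          (value-mono i t (suc i) t c c′ (λ x x≤D t≤ → ℕₚ.≤-trans t≤ (increment-≤ (slope x i x≤D (cell<n c)))))
          (λ eq → ℕₚ.1+n≢n (sym (proj₁ (value-distinct single i t (suc i) t c c′ eq))))
      -- Here the other half of `slope` is used: `h x (i+1) ≥ t+1` forces `h x i ≥ t`.
      ; colwise = λ i t c c′ → ℕₚ.≤∧≢⇒<
          (value-mono (suc i) (suc t) i t c c′ (λ x x≤D t≤ →
            ℕₚ.≤-pred (ℕₚ.≤-trans t≤ (increment-≥ (slope x i x≤D (cell<n c′))))))
          (λ eq → ℕₚ.1+n≢n (proj₁ (value-distinct single (suc i) (suc t) i t c c′ eq)))
      ; distinct = value-distinct single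
      }

  -- If `h′ x i < h x i`, then `h x i` lies above the floor i - B_i and not above A_i, so it is the
  -- row of a cell. The equal values at this cell give `h x i ≤ h′ x i`.
  flow-≤ : ∀ {h h′} → Flow h → Flow h′ → (∀ i t → Cell i t → value h i t ≡ value h′ i t) →
    ∀ x i → x ≤ D → i ≤ n → h x i ≤ h′ x i
  flow-≤ {h} {h′} f f′ eq x i x≤D i≤n = ℕₚ.≮⇒≥ (λ lt →
    let c : Cell i (h x i)
        c = ℕₚ.≤-trans (s≤s z≤n) lt , Flow.upper f x≤D i≤n , ℕₚ.≤-<-trans (Flow.lower f′ x≤D i≤n)
          (ℕₚ.+-monoʳ-< (B i) lt)
    in ℕₚ.<⇒≱ lt (from (value-threshold f′ i (h x i) x i≤n x≤D)
         (subst (x <_) (eq i (h x i) c) (to (value-threshold f i (h x i) x i≤n x≤D) ℕₚ.≤-refl))))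

  flow-ext : ∀ {h h′} → Flow h → Flow h′ → (∀ i t → Cell i t → value h i t ≡ value h′ i t) →
    ∀ x i → x ≤ D → i ≤ n → h x i ≡ h′ x i
  flow-ext f f′ eq x i x≤D i≤n = ℕₚ.≤-antisym (flow-≤ f f′ eq x i x≤D i≤n) (flow-≤ f′ f (λ i t c → sym (eq i t c)) x i
    x≤D i≤n)

  -- Here `s` counts rows from 0, so the row is `t = s+1`. Rows up to the floor i - B_i contain no
  -- cell and always remain; a cell remains as long as its value exceeds `x`. Counting both kinds
  -- inverts `value`.
  Unfilled : (ℕ → ℕ → ℕ) → ℕ → ℕ → ℕ → Set
  Unfilled V x i s = B i + suc s ≤ i ⊎ x < V i (suc s)

  unfilled? : ∀ V x i → Decidable (Unfilled V x i)
  unfilled? V x i s = (B i + suc s ℕₚ.≤? i) ⊎-dec (x ℕₚ.<? V i (suc s))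

  remaining : (ℕ → ℕ → ℕ) → ℕ → ℕ → ℕ
  remaining V x i = count (unfilled? V x i) (A i)

  module _ {V} (std : Standard V) where
    open Standard std

    -- From `(i, t+1)` one step down and one step to the right lead to `(i, t)`. The intermediate
    -- cell lies in the shape because A and B grow by at most one per level.
    diagonal : ∀ i t → Cell i (suc t) → Cell i t → V i (suc t) < V i t
    diagonal zero    t (_ , t≤A , _)  _               = contradiction (ℕₚ.≤-trans t≤A (A≤ 0)) λ ()
    diagonal (suc i) t c@(_ , t<A , _) c′@(1≤t , _ , i<) = ℕₚ.<-trans (colwise i t c mid) (rowwise i t mid c′)
      where
      mid : Cell i t
      mid = 1≤t , ℕₚ.≤-pred (ℕₚ.≤-trans t<A (increment-≥ (A-inc i))) ,
        ℕₚ.≤-pred (ℕₚ.≤-trans i< (ℕₚ.+-monoˡ-≤ t (increment-≥ (B-inc i))))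

    -- The strict descent of the values within a level leaves room for one more step. With `y = x`
    -- this is downward closure in `s`; with `y = x+1` it shows that a step lowers a level by at
    -- most one.
    unfilled-pred : ∀ x y i s → y ≤ suc x → suc s < A i → Unfilled V x i (suc s) → Unfilled V y i s
    unfilled-pred x y i s y≤ s<A u with B i + suc s ℕₚ.≤? i
    ... | yes le = inj₁ le
    unfilled-pred x y i s y≤ s<A (inj₁ le) | no ≰ = contradiction (ℕₚ.≤-trans (ℕₚ.+-monoʳ-≤ (B i) (ℕₚ.n≤1+n _)) le) ≰
    unfilled-pred x y i s y≤ s<A (inj₂ lt) | no ≰ = inj₂ (ℕₚ.≤-<-trans (ℕₚ.≤-trans y≤ lt) (diagonal i (suc s)
      (s≤s z≤n , s<A , ℕₚ.<-≤-trans (ℕₚ.≰⇒> ≰) (ℕₚ.+-monoʳ-≤ (B i) (ℕₚ.n≤1+n _)))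
      (s≤s z≤n , ℕₚ.<⇒≤ s<A , ℕₚ.≰⇒> ≰)))

    remaining-threshold : ∀ x i s → s < A i → Unfilled V x i s ⇔ s < remaining V x i
    remaining-threshold x i s s<A = threshold (unfilled? V x i) (A i) (λ s → unfilled-pred x x i s (ℕₚ.n≤1+n x)) s s<A

    cell-threshold : ∀ x i t → Cell i t → x < V i t ⇔ t ≤ remaining V x i
    cell-threshold x i (suc s) (_ , s<A , i<) = mk⇔ (λ lt → to thr (inj₂ lt)) (λ le → strip (from thr le))
      where
      thr = remaining-threshold x i s s<A
      strip : Unfilled V x i s → x < V i (suc s)
      strip (inj₁ le) = contradiction i< (ℕₚ.≤⇒≯ le)
      strip (inj₂ lt) = lt

    remaining-≤ : ∀ x y i j → A j ≤ suc (A i) → (∀ s → suc s < A j → Unfilled V x j (suc s) → Unfilled V y i s) →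
      remaining V x j ≤ suc (remaining V y i)
    remaining-≤ x y i j A≤A imp with remaining V x j in eq
    ... | zero        = z≤n
    ... | suc zero    = s≤s z≤n
    ... | suc (suc s) = s≤s (to (remaining-threshold y i s (ℕₚ.≤-pred (ℕₚ.≤-trans s<A A≤A)))
          (imp s s<A (from (remaining-threshold x j (suc s) s<A) (ℕₚ.≤-reflexive (sym eq)))))
      where
      s<A : suc s < A j
      s<A = subst (_≤ A j) eq (count≤ (unfilled? V x j) (A j))

    remaining-mono : ∀ x y i j → A j ≤ A i → (∀ s → s < A j → Unfilled V x j s → Unfilled V y i s) →
      remaining V x j ≤ remaining V y i
    remaining-mono x y i j A≤A imp with remaining V x j in eq
    ... | zero  = z≤n
    ... | suc s = to (remaining-threshold y i s (ℕₚ.≤-trans s<A A≤A))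
          (imp s s<A (from (remaining-threshold x j s s<A) (ℕₚ.≤-reflexive (sym eq))))
      where
      s<A : s < A j
      s<A = subst (_≤ A j) eq (count≤ (unfilled? V x j) (A j))

    remaining-flow : Flow (remaining V)
    remaining-flow = record
      { start = λ i i≤n → count-≡ (unfilled? V 0 i) (A i) (A i) ℕₚ.≤-refl
        (λ s s<A → mk⇔ (λ _ → s<A) (λ _ → all-unfilled i s s<A))
      -- After `D` steps all cells are filled and only the floor of `i ∸ B i` rows is left; the
      -- Catalan condition puts it within `A i`.
      ; end   = λ i i≤n → trans (cong (_+_ (B i)) (count-≡ (unfilled? V D i) (A i) (i ∸ B i) (floor≤A i i≤n)
        (only-floor i i≤n)))
                  (ℕₚ.m+[n∸m]≡n (B≤ i))
      ; fall  = λ x i x<D i≤n → increment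
          (remaining-mono (suc x) x i i ℕₚ.≤-refl (λ { s _ (inj₁ le) → inj₁ le ; s _ (inj₂ lt) → inj₂ (ℕₚ.<⇒≤ lt) }))
          (remaining-≤ x (suc x) i i (ℕₚ.n≤1+n _) (λ s → unfilled-pred x (suc x) i s ℕₚ.≤-refl))
      -- By `rowwise` a row unfilled at level `i` stays unfilled at level `i+1`; by `colwise` an
      -- unfilled row `t+1` at level `i+1` gives the unfilled row `t` at level `i`. Rows on the
      -- floor behave alike since B grows by 0 or 1.
      ; slope = λ x i x≤D i<n → increment
          (remaining-mono x x (suc i) i (increment-≤ (A-inc i)) (raise x i))
          (remaining-≤ x x i (suc i) (increment-≥ (A-inc i)) (lowered x i))
      }
      where
      floor≤A : ∀ i → i ≤ n → i ∸ B i ≤ A i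
      floor≤A i i≤n = ℕₚ.≤-trans (ℕₚ.∸-monoˡ-≤ (B i) (catalan i i≤n)) (ℕₚ.≤-reflexive (ℕₚ.m+n∸n≡m (A i) (B i)))
      all-unfilled : ∀ i s → s < A i → Unfilled V 0 i s
      all-unfilled i s s<A with B i + suc s ℕₚ.≤? i
      ... | yes le = inj₁ le
      ... | no ≰   = inj₂ (proj₁ (range i (suc s) (s≤s z≤n , s<A , ℕₚ.≰⇒> ≰)))
      only-floor : ∀ i → i ≤ n → ∀ s → s < A i → Unfilled V D i s ⇔ s < i ∸ B i
      only-floor i i≤n s s<A = mk⇔ fwd
        (λ lt → inj₁ (ℕₚ.≤-trans (ℕₚ.+-monoʳ-≤ (B i) lt) (ℕₚ.≤-reflexive (ℕₚ.m+[n∸m]≡n (B≤ i)))))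
        where
        fwd : Unfilled V D i s → s < i ∸ B i
        fwd (inj₁ le) = ℕₚ.m+n≤o⇒m≤o∸n (suc s) (subst (_≤ i) (ℕₚ.+-comm (B i) (suc s)) le)
        fwd (inj₂ lt) with B i + suc s ℕₚ.≤? i
        ... | yes le = ℕₚ.m+n≤o⇒m≤o∸n (suc s) (subst (_≤ i) (ℕₚ.+-comm (B i) (suc s)) le)
        ... | no ≰   = contradiction (proj₂ (range i (suc s) (s≤s z≤n , s<A , ℕₚ.≰⇒> ≰))) (ℕₚ.<⇒≱ lt)
      raise : ∀ x i s → s < A i → Unfilled V x i s → Unfilled V x (suc i) s
      raise x i s s<A u with B (suc i) + suc s ℕₚ.≤? suc i | B i + suc s ℕₚ.≤? i
      ... | yes le | _ = inj₁ le
      ... | no ≰ | yes le = contradiction (ℕₚ.≤-trans (ℕₚ.+-monoˡ-≤ (suc s) (increment-≥ (B-inc i))) (s≤s le)) ≰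
      raise x i s s<A (inj₁ le) | no _ | no ≰ = contradiction le ≰
      raise x i s s<A (inj₂ lt) | no ≰₁ | no ≰ = inj₂ (ℕₚ.<-trans lt (rowwise i (suc s) (s≤s z≤n , s<A , ℕₚ.≰⇒> ≰)
        (s≤s z≤n , ℕₚ.≤-trans s<A (increment-≤ (A-inc i)) , ℕₚ.≰⇒> ≰₁)))
      lowered : ∀ x i s → suc s < A (suc i) → Unfilled V x (suc i) (suc s) → Unfilled V x i s
      lowered x i s s<A u with B i + suc s ℕₚ.≤? i
      ... | yes le = inj₁ le
      lowered x i s s<A (inj₁ le) | no ≰ = contradiction (ℕₚ.≤-trans (ℕₚ.+-monoˡ-≤ (suc s) (increment-≤ (B-inc i)))
        (ℕₚ.≤-pred (subst (_≤ suc i) (ℕₚ.+-suc (B (suc i)) (suc s)) le))) ≰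
      lowered x i s s<A (inj₂ lt) | no ≰ = inj₂ (ℕₚ.<-trans lt (colwise i (suc s)
        (s≤s z≤n , s<A , subst (suc i <_) (sym (ℕₚ.+-suc (B (suc i)) (suc s)))
          (s≤s (ℕₚ.<-≤-trans (ℕₚ.≰⇒> ≰) (ℕₚ.+-monoˡ-≤ (suc s) (increment-≤ (B-inc i))))))
        (s≤s z≤n , ℕₚ.≤-pred (ℕₚ.≤-trans s<A (increment-≥ (A-inc i))) , ℕₚ.≰⇒> ≰)))

    remaining-moves : ∀ x → (∀ i → i ≤ n → remaining V x i ≡ remaining V (suc x) i) → ∀ i t → Cell i t → V i t ≢ suc x
    remaining-moves x same i t c eq = ℕₚ.<-irrefl refl (subst (suc x <_) eq (from (cell-threshold (suc x) i t c)
      (subst (t ≤_) (same i (ℕₚ.<⇒≤ (cell<n c))) (to (cell-threshold x i t c) (subst (x <_) (sym eq) ℕₚ.≤-refl)))))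

  standard-ext : ∀ {V V′} → Standard V → Standard V′ →
    (∀ x i → x ≤ D → i ≤ n → remaining V x i ≡ remaining V′ x i) → ∀ i t → Cell i t → V i t ≡ V′ i t
  standard-ext {V} {V′} std std′ same i t c = ℕₚ.≤-antisym (le std std′ same)
    (le std′ std (λ x i x≤D i≤n → sym (same x i x≤D i≤n)))
    where
    le : ∀ {V V′} → Standard V → Standard V′ → (∀ x i → x ≤ D → i ≤ n → remaining V x i ≡ remaining V′ x i) →
      V i t ≤ V′ i t
    le {V} {V′} std std′ same = ℕₚ.≮⇒≥ (λ lt → ℕₚ.<-irrefl refl (from (cell-threshold std′ (V′ i t) i t c)
      (subst (t ≤_) (same (V′ i t) i (proj₂ (Standard.range std′ i t c)) (ℕₚ.<⇒≤ (cell<n c)))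
        (to (cell-threshold std (V′ i t) i t c) lt))))

-- Trapezoids in the extremal case

Σ<≡1-unique : ∀ k (f : ℕ → ℕ) → Σ< k f ≡ 1 → ∀ i j → i < k → j < k → 1 ≤ f i → 1 ≤ f j → i ≡ j
Σ<≡1-unique (suc k) f eq zero    zero    _ _ _ _ = refl
Σ<≡1-unique (suc k) f eq (suc i) (suc j) (s≤s i<k) (s≤s j<k) fi fj with f 0 in f0
... | zero     = cong suc (Σ<≡1-unique k (f ∘ suc) eq i j i<k j<k fi fj)
... | suc zero = contradiction fi (ℕₚ.<⇒≱ (s≤s (ℕₚ.≤-reflexive (Σ<≡0 k (f ∘ suc) (ℕₚ.suc-injective eq) i i<k))))
Σ<≡1-unique (suc k) f eq zero (suc j) _ (s≤s j<k) fi fj with f 0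
... | suc zero = contradiction fj (ℕₚ.<⇒≱ (s≤s (ℕₚ.≤-reflexive (Σ<≡0 k (f ∘ suc) (ℕₚ.suc-injective eq) j j<k))))
Σ<≡1-unique (suc k) f eq (suc i) zero (s≤s i<k) _ fi fj with f 0
... | suc zero = contradiction fi (ℕₚ.<⇒≱ (s≤s (ℕₚ.≤-reflexive (Σ<≡0 k (f ∘ suc) (ℕₚ.suc-injective eq) i i<k))))

excesses-take : ∀ {n} i (C : List (Vec ℤ n)) x → x < length C →
  excesses i (take (suc x) C) ≡ excesses i (take x C) + excess i (nth C x)
excesses-take i (c ∷ C) zero    _         = ℕₚ.+-identityʳ _
excesses-take i (c ∷ C) (suc x) (s≤s x<) = trans (cong (_+_ (excess i c)) (excesses-take i C x x<))
  (sym (ℕₚ.+-assoc (excess i c) _ _))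

excesses-take≤ : ∀ {n} i (C : List (Vec ℤ n)) x → excesses i (take x C) ≤ excesses i C
excesses-take≤ i C       zero    = z≤n
excesses-take≤ i []      (suc x) = z≤n
excesses-take≤ i (c ∷ C) (suc x) = ℕₚ.+-monoʳ-≤ (excess i c) (excesses-take≤ i C x)

nth-all : ∀ {n} {P : Vec ℤ n → Set} {C} → All P C → ∀ x → x < length C → P (nth C x)
nth-all (p ∷ ps) zero    _        = p
nth-all (p ∷ ps) (suc x) (s≤s x<) = nth-all ps x x<

nth-ext : ∀ {n} (C C′ : List (Vec ℤ n)) → length C ≡ length C′ → (∀ x → x < length C → nth C x ≡ nth C′ x) → C ≡ C′
nth-ext []      []        _   _  = refl
nth-ext (c ∷ C) (c′ ∷ C′) len eq =
  cong₂ _∷_ (eq 0 z<s) (nth-ext C C′ (ℕₚ.suc-injective len) (λ x x< → eq (suc x) (s≤s x<)))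

walk-prefix : ∀ {s} xs {ys} → Bit s → Walk s (xs ++ ys) → Bit (s ℤ.+ sumℤ xs)
walk-prefix {s} []       b _       = subst Bit (sym (ℤₚ.+-identityʳ s)) b
walk-prefix {s} (x ∷ xs) b (c , w) = subst Bit (ℤₚ.+-assoc s x (sumℤ xs)) (walk-prefix xs c w)

walk-++ : ∀ {s} xs {ys} → Walk s xs → Walk (s ℤ.+ sumℤ xs) ys → Walk s (xs ++ ys)
walk-++ {s} []       {ys} _       w = subst (λ s → Walk s ys) (ℤₚ.+-identityʳ s) w
walk-++ {s} (x ∷ xs) {ys} (b , v) w = b , walk-++ xs v (subst (λ s → Walk s ys) (sym (ℤₚ.+-assoc s x (sumℤ xs))) w)

bit-increment : ∀ {a b : ℕ} {z} → Bit z → + b ≡ + a ℤ.+ z → Increment a b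
bit-increment {a} (inj₁ refl) eq = inj₁ (ℤₚ.+-injective (trans eq (ℤₚ.+-identityʳ (+ a))))
bit-increment {a} (inj₂ refl) eq = inj₂ (trans (ℤₚ.+-injective eq) (ℕₚ.+-comm a 1))

increment-bit : ∀ {a b} → Increment a b → Bit (+ b ℤ.- + a)
increment-bit {a} (inj₁ refl) = inj₁ (ℤₚ.+-inverseʳ (+ a))
increment-bit {a} (inj₂ refl) =
  inj₂ (trans (ℤₚ.m-n≡m⊖n (suc a) a) (trans (ℤₚ.⊖-≥ (ℕₚ.n≤1+n a)) (cong +_ (ℕₚ.m+n∸n≡m 1 a))))

pos-∸ : ∀ {a b} → a ≤ b → + (b ∸ a) ≡ + b ℤ.- + a
pos-∸ {a} {b} a≤b = sym (trans (ℤₚ.m-n≡m⊖n b a) (ℤₚ.⊖-≥ a≤b))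

module TrapezoidFlow {n} {α β : ℕ → ℕ} (profile : Profile n (acc α) (acc β)) where
  D : ℕ
  D = area n α β

  open Profile profile
  open Flows profile D

  -- In the extremal case the left side has height A_i exactly and the excesses of the centre do not
  -- exceed A_i, so the truncated subtraction is the height of the left side with the first `x`
  -- central columns.
  flowOf : Trapezoid n → ℕ → ℕ → ℕ
  flowOf (C , _) x i = acc α i ∸ excesses i (take x C)

  module _ {C L R : List (Vec ℤ n)} (good : Good α β (C , L , R)) (lenL : length L ≡ n) (lenR : length R ≡ n)
    (C≢0 : All (_≢ zeroColumn n) C) (lenC : length C ≡ D) where
    open Reduced good lenL lenR C≢0
    open Tight lenC

    centralC : All Central C
    centralC = proj₁ (proj₂ (proj₂ good))

    excesses≤ : ∀ i → i ≤ n → ∀ x → excesses i (take x C) ≤ acc α i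
    excesses≤ i i≤n x = ℕₚ.≤-trans (excesses-take≤ i C x) (ℕₚ.+-cancelˡ-≤ i _ _ (begin
      i + excesses i C      ≡⟨ eC-area i i≤n ⟩
      acc α i + acc β i     ≡⟨ ℕₚ.+-comm (acc α i) _ ⟩
      acc β i + acc α i     ≤⟨ ℕₚ.+-monoˡ-≤ (acc α i) (B≤ i) ⟩
      i + acc α i           ∎))
      where open ℕₚ.≤-Reasoning

    flowOf-height : ∀ x i → i ≤ n → + flowOf (C , L , R) x i ≡ height i (reverse L ++ take x C)
    flowOf-height x i i≤n = begin
      + (acc α i ∸ excesses i (take x C))           ≡⟨ pos-∸ (excesses≤ i i≤n x) ⟩
      + acc α i ℤ.- + excesses i (take x C)         ≡⟨ cong₂ ℤ._-_ (sym (height-L i i≤n)) refl ⟩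
      height i L ℤ.- + excesses i (take x C)        ≡⟨ cong (ℤ._+_ (height i L)) (trans (sym (0+ (ℤ.- e)))
                                                        (trans (cong (ℤ._- e) (trans (sym
                                                          (central-height (Allₚ.take⁺ x centralC) i))
                                                            (ℤₚ.+-comm (height i (take x C)) e)))
                                                          (cancel e (height i (take x C))))) ⟩
      height i L ℤ.+ height i (take x C)            ≡⟨ cong (ℤ._+ height i (take x C)) (sym (height-reverse i L)) ⟩
      height i (reverse L) ℤ.+ height i (take x C)  ≡⟨ height-++ i (reverse L) (take x C) ⟨
      height i (reverse L ++ take x C) ∎
      where
      open ≡-Reasoning
      e : ℤ
      e = + excesses i (take x C)

    flowOf-step : ∀ x i → x < D → i ≤ n → flowOf (C , L , R) x i ≡ flowOf (C , L , R) (suc x) i + excess i (nth C x)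
    flowOf-step x i x<D i≤n = ℕₚ.+-cancelʳ-≡ E _ _ (begin
      (acc α i ∸ E) + E                    ≡⟨ ℕₚ.m∸n+n≡m (excesses≤ i i≤n x) ⟩
      acc α i                              ≡⟨ ℕₚ.m∸n+n≡m (subst (_≤ acc α i) step (excesses≤ i i≤n (suc x))) ⟨
      (acc α i ∸ (E + e)) + (E + e)        ≡⟨ cong (_+_ (acc α i ∸ (E + e))) (ℕₚ.+-comm E e) ⟩
      (acc α i ∸ (E + e)) + (e + E)        ≡⟨ ℕₚ.+-assoc (acc α i ∸ (E + e)) e E ⟨
      (acc α i ∸ (E + e)) + e + E          ≡⟨ cong (λ z → (acc α i ∸ z) + e + E) (sym step) ⟩
      (acc α i ∸ excesses i (take (suc x) C)) + e + E ∎)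
      where
      open ≡-Reasoning
      E e : ℕ
      E = excesses i (take x C)
      e = excess i (nth C x)
      step : excesses i (take (suc x) C) ≡ E + e
      step = excesses-take i C x (subst (x <_) (sym lenC) x<D)

    flowOf-flow : Flow (flowOf (C , L , R))
    flowOf-flow = record
      { start = λ i i≤n → refl
      ; end   = λ i i≤n → ℕₚ.+-cancelʳ-≡ (excesses i C) _ _
        (trans (end′ i i≤n) (trans (ℕₚ.+-comm (acc β i) _) (sym (eC-area i i≤n))))
      ; fall  = fall
      ; slope = slope
      }
      where
      take-D : take D C ≡ C
      take-D = Listₚ.take-all D C (ℕₚ.≤-reflexive lenC)
      end′ : ∀ i → i ≤ n → acc β i + flowOf (C , L , R) D i + excesses i C ≡ acc β i + acc α i
      end′ i i≤n = trans (ℕₚ.+-assoc (acc β i) _ _) (cong (_+_ (acc β i)) (trans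
        (cong (λ c → (acc α i ∸ excesses i (take D C)) + excesses i c) (sym take-D))
          (ℕₚ.m∸n+n≡m (excesses≤ i i≤n D))))
      fall : ∀ x i → x < D → i ≤ n → Increment (flowOf (C , L , R) (suc x) i) (flowOf (C , L , R) x i)
      fall x i x<D i≤n = subst (Increment _) (sym (flowOf-step x i x<D i≤n)) (increment (ℕₚ.m≤m+n _ _)
        (subst (flowOf (C , L , R) (suc x) i + excess i (nth C x) ≤_) (ℕₚ.+-comm (flowOf (C , L , R) (suc x) i) 1)
          (ℕₚ.+-monoʳ-≤ _ (excess≤1 (nth C x) (proj₁ (nth-all centralC x (subst (x <_) (sym lenC) x<D))) i))))
      -- The difference between levels `i+1` and `i` is a partial sum of row `i`, taken over the
      -- left side and the first `x` central columns, hence 0 or 1.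
      slope : ∀ x i → x ≤ D → i < n → Increment (flowOf (C , L , R) x i) (flowOf (C , L , R) x (suc i))
      slope x i x≤D i<n = bit-increment {z = sumℤ (row r Y)} bit (begin
        + flowOf (C , L , R) x (suc i)          ≡⟨ flowOf-height x (suc i) i<n ⟩
        height (suc i) Y                        ≡⟨ cong (λ k → height (suc k) Y) (sym r≡i) ⟩
        height (suc (toℕ r)) Y                  ≡⟨ height-suc Y r ⟩
        height (toℕ r) Y ℤ.+ sumℤ (row r Y)     ≡⟨ cong (λ k → height k Y ℤ.+ sumℤ (row r Y)) r≡i ⟩
        height i Y ℤ.+ sumℤ (row r Y)           ≡⟨ cong (ℤ._+ sumℤ (row r Y)) (sym (flowOf-height x i (ℕₚ.<⇒≤ i<n))) ⟩
        + flowOf (C , L , R) x i ℤ.+ sumℤ (row r Y) ∎)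
        where
        open ≡-Reasoning
        r = fromℕ< i<n
        r≡i : toℕ r ≡ i
        r≡i = Finₚ.toℕ-fromℕ< i<n
        Y = reverse L ++ take x C
        split : columns (C , L , R) ≡ Y ++ (drop x C ++ R)
        split = trans (cong (λ c → reverse L ++ (c ++ R)) (sym (Listₚ.take++drop≡id x C)))
          (trans (cong (reverse L ++_) (Listₚ.++-assoc (take x C) (drop x C) R))
            (sym (Listₚ.++-assoc (reverse L) (take x C) _)))
        bit : Bit (sumℤ (row r Y))
        bit = subst Bit (0+ _) (walk-prefix (row r Y) (inj₁ refl)
          (subst (Walk (+ 0)) (trans (cong (row r) split) (Listₚ.map-++ _ Y _)) (proj₁ (proj₁ good r))))

    -- Column `x` has weight 1, so its excess is positive at a single level.
    flowOf-single : SingleFall (flowOf (C , L , R))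
    flowOf-single x i j x<D i≤n j≤n fi fj = Σ<≡1-unique (suc n) (λ i → excess i (nth C x))
      (nth-all single x (subst (x <_) (sym lenC) x<D)) i j (s≤s i≤n) (s≤s j≤n) (positive′ i i≤n fi)
        (positive′ j j≤n fj)
      where
      positive′ : ∀ i → i ≤ n → flowOf (C , L , R) (suc x) i < flowOf (C , L , R) x i → 1 ≤ excess i (nth C x)
      positive′ i i≤n lt = ℕₚ.+-cancelˡ-≤ (flowOf (C , L , R) (suc x) i) _ _
        (ℕₚ.≤-trans (ℕₚ.≤-reflexive (ℕₚ.+-comm _ 1)) (subst (flowOf (C , L , R) (suc x) i <_)
          (flowOf-step x i x<D i≤n) lt))

  -- Sides without defect depend on `α` and `β` alone. A central column is determined by its
  -- excesses, and these are the falls of the flow.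
  flowOf-injective : ∀ {C L R C′ L′ R′} → Good α β (C , L , R) → length L ≡ n → length R ≡ n →
    All (_≢ zeroColumn n) C → length C ≡ D →
    Good α β (C′ , L′ , R′) → length L′ ≡ n → length R′ ≡ n → All (_≢ zeroColumn n) C′ → length C′ ≡ D →
    (∀ x i → x ≤ D → i ≤ n → flowOf (C , L , R) x i ≡ flowOf (C′ , L′ , R′) x i) → (C , L , R) ≡ (C′ , L′ , R′)
  flowOf-injective {C} {L} {R} {C′} {L′} {R′} g lenL lenR nz lenC g′ lenL′ lenR′ nz′ lenC′ eq =
    cong₂ _,_ (nth-ext C C′ (trans lenC (sym lenC′)) (λ x x< → nth-eq x (subst (x <_) lenC x<)))
      (cong₂ _,_
        (tight-side-unique α 0 L L′ (trans lenL (sym lenL′)) (proj₁ (proj₂ g)) (proj₁ (proj₂ g′))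
          (Reduced.Tight.dL≡0 g lenL lenR nz lenC) (Reduced.Tight.dL≡0 g′ lenL′ lenR′ nz′ lenC′))
        (tight-side-unique β 0 R R′ (trans lenR (sym lenR′)) (proj₂ (proj₂ (proj₂ g))) (proj₂ (proj₂ (proj₂ g′)))
          (Reduced.Tight.dR≡0 g lenL lenR nz lenC) (Reduced.Tight.dR≡0 g′ lenL′ lenR′ nz′ lenC′)))
    where
    nth-eq : ∀ x → x < D → nth C x ≡ nth C′ x
    nth-eq x x<D = central-ext
      (nth-all (proj₁ (proj₂ (proj₂ g))) x (subst (x <_) (sym lenC) x<D))
      (nth-all (proj₁ (proj₂ (proj₂ g′))) x (subst (x <_) (sym lenC′) x<D))
      (λ i i≤n → ℕₚ.+-cancelˡ-≡ (flowOf (C , L , R) (suc x) i) _ _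
        (trans (sym (flowOf-step g lenL lenR nz lenC x i x<D i≤n)) (trans (eq x i (ℕₚ.<⇒≤ x<D) i≤n)
          (trans (flowOf-step g′ lenL′ lenR′ nz′ lenC′ x i x<D i≤n)
            (cong (_+ excess i (nth C′ x)) (sym (eq (suc x) i x<D i≤n)))))))

-- The trapezoid of a flow

fromBelow : ∀ n → (ℕ → ℤ) → Vec ℤ n
fromBelow n G = Vec.tabulate (λ r → G (suc (toℕ r)) ℤ.- G (toℕ r))

below-fromBelow : ∀ n (G : ℕ → ℤ) i → i ≤ n → below i (fromBelow n G) ≡ G i ℤ.- G 0
below-fromBelow n       G zero    _         = sym (ℤₚ.+-inverseʳ (G 0))
below-fromBelow (suc n) G (suc i) (s≤s i≤n) = trans (cong (ℤ._+_ (G 1 ℤ.- G 0)) (below-fromBelow n (G ∘ suc) i i≤n))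
  (solve 3 (λ a b c → (b :- a) :+ (c :- b) := c :- a) refl (G 0) (G 1) (G (suc i)))
  where open Data.Integer.Solver.+-*-Solver

below-all : ∀ {n} (x : Vec ℤ n) → below n x ≡ colSum x
below-all {n} x = cong sumℤ (Listₚ.take-all n (Vec.toList x) (ℕₚ.≤-reflexive (Vecₚ.length-toList x)))

suffixes-below : ∀ {n} (x : Vec ℤ n) → (∀ i → i ≤ n → Bit (colSum x ℤ.- below i x)) → BitSuffixes (Vec.toList x)
suffixes-below []      h = tt
suffixes-below (a ∷ x) h = subst Bit (ℤₚ.+-identityʳ _) (h 0 z≤n) , suffixes-below x (λ i i≤n → subst Bit
  (solve 3 (λ a s b → (a :+ s) :- (a :+ b) := s :- b) refl a (colSum x) (below i x)) (h (suc i) (s≤s i≤n)))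
  where open Data.Integer.Solver.+-*-Solver

suffixes⇒columnsOver : ∀ {n} (x : Vec ℤ n) → BitSuffixes (Vec.toList x) → x ∈ columnsOver n
suffixes⇒columnsOver x b = ∈-vecsOver⁺ x (lookup-all x (suffix-entries (Vec.toList x) b))

NonNegative : ℤ → Set
NonNegative z = ∃ λ k → z ≡ + k

nonneg-sum : ∀ {xs} → All NonNegative xs → NonNegative (sumℤ xs)
nonneg-sum [] = 0 , refl
nonneg-sum ((k , refl) ∷ ps) with nonneg-sum ps
... | K , eq = k + K , cong (ℤ._+_ (+ k)) eq

-- With nonnegative entries the partial sums increase, so only the two end values have to be
-- checked. The pieces of a row inside the side columns are of this kind.
walk-nonneg : ∀ {s xs} → Bit s → All NonNegative xs → Bit (s ℤ.+ sumℤ xs) → Walk s xs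
walk-nonneg b [] _ = tt
walk-nonneg {s} {x ∷ xs} b ((k , refl) ∷ ps) total = bit , walk-nonneg bit ps total′
  where
  total′ : Bit ((s ℤ.+ + k) ℤ.+ sumℤ xs)
  total′ = subst Bit (sym (ℤₚ.+-assoc s (+ k) (sumℤ xs))) total
  low : ∀ {a K} → Bit (+ (a + K)) → Bit (+ a)
  low {zero}        _         = inj₁ refl
  low {suc zero}    _         = inj₂ refl
  low {suc (suc a)} (inj₁ ())
  low {suc (suc a)} (inj₂ ())
  bits : ∀ {s t} → Bit s → NonNegative t → Bit ((s ℤ.+ + k) ℤ.+ t) → Bit (s ℤ.+ + k)
  bits (inj₁ refl) (K , refl) t = low {k} t
  bits (inj₂ refl) (K , refl) t = low {suc k} t
  bit : Bit (s ℤ.+ + k)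
  bit = bits b (nonneg-sum ps) total′

cut-mono : ∀ c i e → cut c i e ≤ cut c (suc i) e
cut-mono c i e with ℕₚ.≤-<-connex i c
... | inj₁ i≤c = subst (_≤ cut c (suc i) e) (sym (cut-≥ e i≤c)) z≤n
... | inj₂ c<i = ℕₚ.≤-reflexive (trans (cut-< e c<i) (sym (cut-< e (ℕₚ.m≤n⇒m≤1+n c<i))))

-- A single entry `τ c` in row `c`, the lowest row that reaches this column: the shape forced by
-- `tight-side-unique`.
sideColumn : ∀ n → (ℕ → ℕ) → ℕ → Vec ℤ n
sideColumn n τ c = fromBelow n (λ i → + cut c i (τ c))

sideColumns : ∀ n → (ℕ → ℕ) → ℕ → ℕ → List (Vec ℤ n)
sideColumns n τ c zero    = []
sideColumns n τ c (suc k) = sideColumn n τ c ∷ sideColumns n τ (suc c) k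

below-sideColumn : ∀ n τ c i → i ≤ n → below i (sideColumn n τ c) ≡ + cut c i (τ c)
below-sideColumn n τ c i i≤n = trans (below-fromBelow n (λ i → + cut c i (τ c)) i i≤n)
  (trans (cong (λ e → + cut c i (τ c) ℤ.- + e) (cut-≥ {c} {0} (τ c) z≤n)) (ℤₚ.+-identityʳ _))

colSum-sideColumn : ∀ n τ c → c < n → colSum (sideColumn n τ c) ≡ + τ c
colSum-sideColumn n τ c c<n = trans (sym (below-all (sideColumn n τ c)))
  (trans (below-sideColumn n τ c n ℕₚ.≤-refl) (cong +_ (cut-< (τ c) c<n)))

sideColumn-side : ∀ n τ c → τ c ≤ 1 → c < n → SideColumn τ c (sideColumn n τ c)
sideColumn-side n τ c τ≤1 c<n =
  suffixes-below (sideColumn n τ c) (λ i i≤n → subst Bit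
    (sym (cong₂ ℤ._-_ (colSum-sideColumn n τ c c<n) (below-sideColumn n τ c i i≤n))) (bit i)) ,
  colSum-sideColumn n τ c c<n ,
  λ r r<c → trans (Vecₚ.lookup∘tabulate _ r) (cong₂ (λ a b → + a ℤ.- + b) (cut-≥ (τ c) r<c)
    (cut-≥ (τ c) (ℕₚ.<⇒≤ r<c)))
  where
  small : ∀ {e} → e ≤ 1 → Bit (+ e)
  small {zero}     _         = inj₁ refl
  small {suc zero} _         = inj₂ refl
  small {suc (suc _)} (s≤s ())
  bit : ∀ i → Bit (+ τ c ℤ.- + cut c i (τ c))
  bit i with ℕₚ.≤-<-connex i c
  ... | inj₁ i≤c = subst (λ e → Bit (+ τ c ℤ.- + e)) (sym (cut-≥ (τ c) i≤c))
    (subst Bit (sym (ℤₚ.+-identityʳ _)) (small τ≤1))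
  ... | inj₂ c<i = subst (λ e → Bit (+ τ c ℤ.- + e)) (sym (cut-< (τ c) c<i)) (inj₁ (ℤₚ.+-inverseʳ (+ τ c)))

sideColumns-side : ∀ n τ → (∀ c → τ c ≤ 1) → ∀ c k → k + c ≤ n → Side τ c (sideColumns n τ c k)
sideColumns-side n τ τ≤1 c zero    _  = tt
sideColumns-side n τ τ≤1 c (suc k) le = sideColumn-side n τ c (τ≤1 c) (ℕₚ.≤-trans (s≤s (ℕₚ.m≤n+m c k)) le) ,
  sideColumns-side n τ τ≤1 (suc c) k (subst (_≤ n) (sym (ℕₚ.+-suc k c)) le)

sideColumns-defect : ∀ n τ → (∀ c → τ c ≤ 1) → ∀ i → i ≤ n → ∀ c k → k + c ≤ n → sideDefect i c (sideColumns n τ c k)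
  ≡ 0
sideColumns-defect n τ τ≤1 i i≤n c zero    _  = refl
sideColumns-defect n τ τ≤1 i i≤n c (suc k) le = cong₂ _+_ here′
  (sideColumns-defect n τ τ≤1 i i≤n (suc c) k (subst (_≤ n) (sym (ℕₚ.+-suc k c)) le))
  where
  x = sideColumn n τ c
  here′ : cut c i (excess i x) ≡ 0
  here′ = ℤₚ.+-injective (begin
    + cut c i (excess i x)                                    ≡⟨ cancel (below i x) (+ cut c i (excess i x)) ⟨
    (below i x ℤ.+ + cut c i (excess i x)) ℤ.- below i x
      ≡⟨ cong₂ ℤ._-_ (sideColumn-below τ c x (sideColumn-side n τ c (τ≤1 c) (ℕₚ.≤-trans (s≤s (ℕₚ.m≤n+m c k)) le)) i
        i≤n) (below-sideColumn n τ c i i≤n) ⟩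
    + cut c i (τ c) ℤ.- + cut c i (τ c)                       ≡⟨ ℤₚ.+-inverseʳ (+ cut c i (τ c)) ⟩
    + 0 ∎)
    where open ≡-Reasoning

length-sideColumns : ∀ n τ c k → length (sideColumns n τ c k) ≡ k
length-sideColumns n τ c zero    = refl
length-sideColumns n τ c (suc k) = cong suc (length-sideColumns n τ (suc c) k)

side-all : ∀ {n} τ c (xs : List (Vec ℤ n)) → Side τ c xs → All (λ x → BitSuffixes (Vec.toList x)) xs
side-all τ c []       _                 = []
side-all τ c (x ∷ xs) ((b , _) , sides) = b ∷ side-all τ (suc c) xs sides

height-sideColumns : ∀ n τ → (∀ c → τ c ≤ 1) → ∀ i → i ≤ n → height i (sideColumns n τ 0 n) ≡ + acc τ i
height-sideColumns n τ τ≤1 i i≤n = trans (sym (ℤₚ.+-identityʳ _))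
  (trans (cong (λ d → height i (sideColumns n τ 0 n) ℤ.+ + d) (sym (sideColumns-defect n τ τ≤1 i i≤n 0 n le)))
    (side-height τ (sideColumns n τ 0 n) (length-sideColumns n τ 0 n) (sideColumns-side n τ τ≤1 0 n le) i i≤n))
  where
  le : n + 0 ≤ n
  le = ℕₚ.≤-reflexive (ℕₚ.+-identityʳ n)

sideColumns-nonneg : ∀ n τ r c k → All NonNegative (row r (sideColumns n τ c k))
sideColumns-nonneg n τ r c zero    = []
sideColumns-nonneg n τ r c (suc k) = (cut c (suc (toℕ r)) (τ c) ∸ cut c (toℕ r) (τ c) ,
  trans (Vecₚ.lookup∘tabulate _ r) (sym (pos-∸ (cut-mono c (toℕ r) (τ c))))) ∷ sideColumns-nonneg n τ r (suc c) k

sum-row : ∀ {n} (X : List (Vec ℤ n)) r → sumℤ (row r X) ≡ height (suc (toℕ r)) X ℤ.- height (toℕ r) X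
sum-row X r = sym (trans (cong (ℤ._- height (toℕ r) X) (height-suc X r)) (cancel (height (toℕ r) X) _))

module FlowTrapezoid {n} {α β : ℕ → ℕ} (profile : Profile n (acc α) (acc β)) where
  open Profile profile
  open TrapezoidFlow profile using (D)
  open Flows profile D

  acc-inc⇒≤1 : ∀ τ → (∀ i → Increment (acc τ i) (acc τ (suc i))) → ∀ c → τ c ≤ 1
  acc-inc⇒≤1 τ inc c = ℕₚ.+-cancelˡ-≤ (acc τ c) _ _
    (ℕₚ.≤-trans (increment-≥ (inc c)) (ℕₚ.≤-reflexive (ℕₚ.+-comm 1 _)))

  α≤1 : ∀ c → α c ≤ 1
  α≤1 = acc-inc⇒≤1 α A-inc

  β≤1 : ∀ c → β c ≤ 1
  β≤1 = acc-inc⇒≤1 β B-inc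

  L R : List (Vec ℤ n)
  L = sideColumns n α 0 n
  R = sideColumns n β 0 n

  -- The column whose sums from below are the changes of the flow in step `y`; its entries are mixed
  -- second differences of `h`.
  centralColumn : (ℕ → ℕ → ℕ) → ℕ → Vec ℤ n
  centralColumn h y = fromBelow n (λ i → + h (suc y) i ℤ.- + h y i)

  centralColumns : (ℕ → ℕ → ℕ) → ℕ → ℕ → List (Vec ℤ n)
  centralColumns h y zero    = []
  centralColumns h y (suc k) = centralColumn h y ∷ centralColumns h (suc y) k

  length-centralColumns : ∀ h y k → length (centralColumns h y k) ≡ k
  length-centralColumns h y zero    = refl
  length-centralColumns h y (suc k) = cong suc (length-centralColumns h (suc y) k)

  trapezoidOf : (ℕ → ℕ → ℕ) → Trapezoid n
  trapezoidOf h = centralColumns h 0 D , L , R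

  module _ {h} (flow : Flow h) where
    open Flow flow

    h-zero : ∀ {x} → x ≤ D → h x 0 ≡ 0
    h-zero x≤D = ℕₚ.n≤0⇒n≡0 (upper x≤D z≤n)

    -- At level `n` the floor n - B_n is at least A_n, so the flow is constant there. Hence the
    -- columns built from it have sum 0.
    h-n : ∀ {x} → x ≤ D → h x n ≡ acc α n
    h-n {x} x≤D = ℕₚ.≤-antisym (upper x≤D ℕₚ.≤-refl) (ℕₚ.+-cancelˡ-≤ (acc β n) _ _
      (ℕₚ.≤-trans (ℕₚ.≤-reflexive (ℕₚ.+-comm (acc β n) _)) (ℕₚ.≤-trans (bounded n) (lower x≤D ℕₚ.≤-refl))))

    below-centralColumn : ∀ y → y < D → ∀ i → i ≤ n → below i (centralColumn h y) ≡ + h (suc y) i ℤ.- + h y i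
    below-centralColumn y y<D i i≤n = trans (below-fromBelow n (λ i → + h (suc y) i ℤ.- + h y i) i i≤n)
      (trans (cong (ℤ._-_ (+ h (suc y) i ℤ.- + h y i)) (cong₂ (λ a b → + a ℤ.- + b) (h-zero y<D)
        (h-zero (ℕₚ.<⇒≤ y<D)))) (ℤₚ.+-identityʳ _))

    centralColumn-central : ∀ y → y < D → Central (centralColumn h y)
    centralColumn-central y y<D = suffixes-below (centralColumn h y) (λ i i≤n → subst Bit
        (sym (trans (cong₂ ℤ._-_ sum≡0 (below-centralColumn y y<D i i≤n)) (neg (+ h (suc y) i) (+ h y i))))
          (increment-bit (fall y i y<D i≤n))) , sum≡0
      where
      neg : ∀ a b → + 0 ℤ.- (a ℤ.- b) ≡ b ℤ.- a
      neg = solve 2 (λ a b → con (+ 0) :- (a :- b) := b :- a) refl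
        where open Data.Integer.Solver.+-*-Solver
      sum≡0 : colSum (centralColumn h y) ≡ + 0
      sum≡0 = trans (sym (below-all (centralColumn h y))) (trans (below-centralColumn y y<D n ℕₚ.≤-refl)
        (trans (cong₂ (λ a b → + a ℤ.- + b) (h-n y<D) (h-n (ℕₚ.<⇒≤ y<D))) (ℤₚ.+-inverseʳ (+ acc α n))))

    centralColumns-all : ∀ {P : Vec ℤ n → Set} → (∀ y → y < D → P (centralColumn h y)) → ∀ y k → k + y ≤ D →
      All P (centralColumns h y k)
    centralColumns-all p y zero    _  = []
    centralColumns-all p y (suc k) le = p y (ℕₚ.≤-trans (s≤s (ℕₚ.m≤n+m y k)) le) ∷
      centralColumns-all p (suc y) k (subst (_≤ D) (sym (ℕₚ.+-suc k y)) le)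

    -- The sum of row `r` over the left side and the first `y` central columns; `slope` makes it 0
    -- or 1.
    state : ℕ → Fin n → ℤ
    state y r = + h y (suc (toℕ r)) ℤ.- + h y (toℕ r)

    state-bit : ∀ y r → y ≤ D → Bit (state y r)
    state-bit y r y≤D = increment-bit (slope y (toℕ r) y≤D (Finₚ.toℕ<n r))

    state-step : ∀ y r → state y r ℤ.+ Vec.lookup (centralColumn h y) r ≡ state (suc y) r
    state-step y r = trans (cong (ℤ._+_ (state y r)) (Vecₚ.lookup∘tabulate _ r))
      (solve 4 (λ a b c d → (a :- b) :+ ((c :- a) :- (d :- b)) := c :- d) refl
        (+ h y (suc (toℕ r))) (+ h y (toℕ r)) (+ h (suc y) (suc (toℕ r))) (+ h (suc y) (toℕ r)))
      where open Data.Integer.Solver.+-*-Solver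

    centralColumns-walk : ∀ r y k → k + y ≤ D → Walk (state y r) (row r (centralColumns h y k)) ×
      state y r ℤ.+ sumℤ (row r (centralColumns h y k)) ≡ state (k + y) r
    centralColumns-walk r y zero    _  = tt , ℤₚ.+-identityʳ _
    centralColumns-walk r y (suc k) le with centralColumns-walk r (suc y) k (subst (_≤ D) (sym (ℕₚ.+-suc k y)) le)
    ... | w , s = subst (λ z → Bit z × Walk z (row r (centralColumns h (suc y) k))) (sym (state-step y r))
        (state-bit (suc y) r (ℕₚ.≤-trans (s≤s (ℕₚ.m≤n+m y k)) le) , w) ,
      trans (sym (ℤₚ.+-assoc (state y r) _ _))
        (trans (cong (ℤ._+ sumℤ (row r (centralColumns h (suc y) k))) (state-step y r))
        (trans s (cong (λ z → state z r) (ℕₚ.+-suc k y))))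

    -- A row runs through three pieces: nonnegative entries up to `state 0 r`, then the successive
    -- states, then nonnegative entries up to 1. All partial sums are therefore 0 or 1.
    trapezoidOf-rows : Rows (columns (trapezoidOf h))
    trapezoidOf-rows r = subst (λ xs → Walk (+ 0) xs × sumℤ xs ≡ + 1) (sym split)
      (walk-++ rowL walkL (walk-++ rowC walkC walkR) , sum-all)
      where
      C = centralColumns h 0 D
      rowL = row r (reverse L)
      rowC = row r C
      rowR = row r R
      split : row r (reverse L ++ (C ++ R)) ≡ rowL ++ (rowC ++ rowR)
      split = trans (Listₚ.map-++ _ (reverse L) (C ++ R)) (cong (rowL ++_) (Listₚ.map-++ _ C R))
      r<n = Finₚ.toℕ<n r
      D+0 : D + 0 ≤ D
      D+0 = ℕₚ.≤-reflexive (ℕₚ.+-identityʳ D)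
      sumL : sumℤ rowL ≡ state 0 r
      sumL = trans (sum-row (reverse L) r) (cong₂ ℤ._-_ (at (suc (toℕ r)) r<n) (at (toℕ r) (ℕₚ.<⇒≤ r<n)))
        where
        at : ∀ i → i ≤ n → height i (reverse L) ≡ + h 0 i
        at i i≤n = trans (height-reverse i L) (trans (height-sideColumns n α α≤1 i i≤n) (cong +_ (sym (start i i≤n))))
      walkL : Walk (+ 0) rowL
      walkL = walk-nonneg (inj₁ refl) (subst (All NonNegative) (sym (Listₚ.reverse-map _ L))
        (all-reverse (sideColumns-nonneg n α r 0 n)))
        (subst Bit (sym (trans (0+ _) sumL)) (state-bit 0 r z≤n))
      walkC : Walk (+ 0 ℤ.+ sumℤ rowL) rowC
      walkC = subst (λ s → Walk s rowC) (sym (trans (0+ _) sumL)) (proj₁ (centralColumns-walk r 0 D D+0))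
      sumLC : (+ 0 ℤ.+ sumℤ rowL) ℤ.+ sumℤ rowC ≡ state D r
      sumLC = trans (cong (ℤ._+ sumℤ rowC) (trans (0+ _) sumL)) (trans (proj₂ (centralColumns-walk r 0 D D+0))
        (cong (λ y → state y r) (ℕₚ.+-identityʳ D)))
      -- By `end` the final flow and `acc β` add up to the level itself, so passing from level `i`
      -- to `i+1` contributes 1.
      sumLCR : ((+ 0 ℤ.+ sumℤ rowL) ℤ.+ sumℤ rowC) ℤ.+ sumℤ rowR ≡ + 1
      sumLCR = begin
        ((+ 0 ℤ.+ sumℤ rowL) ℤ.+ sumℤ rowC) ℤ.+ sumℤ rowR
          ≡⟨ cong₂ ℤ._+_ sumLC (trans (sum-row R r) (cong₂ ℤ._-_ (height-sideColumns n β β≤1 (suc i) r<n)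
            (height-sideColumns n β β≤1 i (ℕₚ.<⇒≤ r<n)))) ⟩
        (+ h D (suc i) ℤ.- + h D i) ℤ.+ (+ acc β (suc i) ℤ.- + acc β i)
          ≡⟨ solve 4 (λ a b c d → (a :- b) :+ (c :- d) := (c :+ a) :- (d :+ b)) refl (+ h D (suc i)) (+ h D i)
            (+ acc β (suc i)) (+ acc β i) ⟩
        (+ acc β (suc i) ℤ.+ + h D (suc i)) ℤ.- (+ acc β i ℤ.+ + h D i)
          ≡⟨ cong₂ (λ a b → + a ℤ.- + b) (end (suc i) r<n) (end i (ℕₚ.<⇒≤ r<n)) ⟩
        + suc i ℤ.- + i
          ≡⟨ sym (pos-∸ (ℕₚ.n≤1+n i)) ⟩
        + (suc i ∸ i)
          ≡⟨ cong +_ (ℕₚ.m+n∸n≡m 1 i) ⟩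
        + 1 ∎
        where
        i = toℕ r
        open ≡-Reasoning
        open Data.Integer.Solver.+-*-Solver
      walkR : Walk ((+ 0 ℤ.+ sumℤ rowL) ℤ.+ sumℤ rowC) rowR
      walkR = walk-nonneg (subst Bit (sym sumLC) (state-bit D r ℕₚ.≤-refl)) (sideColumns-nonneg n β r 0 n)
        (inj₂ sumLCR)
      sum-all : sumℤ (rowL ++ (rowC ++ rowR)) ≡ + 1
      sum-all = trans (sumℤ-++ rowL _) (trans (cong (ℤ._+_ (sumℤ rowL)) (sumℤ-++ rowC rowR))
        (trans (sym (ℤₚ.+-assoc (sumℤ rowL) (sumℤ rowC) (sumℤ rowR)))
          (trans (cong (λ z → (z ℤ.+ sumℤ rowC) ℤ.+ sumℤ rowR) (sym (0+ (sumℤ rowL)))) sumLCR)))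

    trapezoidOf-∈ : (∀ x → x < D → ¬ (∀ i → i ≤ n → h x i ≡ h (suc x) i)) → trapezoidOf h ∈ goodOver n α β
      (nonzeroColumns n) D
    trapezoidOf-∈ moves = ∈-goodOver⁺ (centralColumns h 0 D) L R
      (trapezoidOf-rows , sideL , central , sideR)
      (length-centralColumns h 0 D) (centralColumns-all nonzero 0 D D+0)
      (length-sideColumns n α 0 n) (All.map (λ {x} → suffixes⇒columnsOver x) (side-all α 0 L sideL))
      (length-sideColumns n β 0 n) (All.map (λ {x} → suffixes⇒columnsOver x) (side-all β 0 R sideR))
      where
      D+0 : D + 0 ≤ D
      D+0 = ℕₚ.≤-reflexive (ℕₚ.+-identityʳ D)
      n+0 : n + 0 ≤ n
      n+0 = ℕₚ.≤-reflexive (ℕₚ.+-identityʳ n)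
      sideL : Side α 0 L
      sideL = sideColumns-side n α α≤1 0 n n+0
      sideR : Side β 0 R
      sideR = sideColumns-side n β β≤1 0 n n+0
      central : All Central (centralColumns h 0 D)
      central = centralColumns-all centralColumn-central 0 D D+0
      nonzero : ∀ y → y < D → centralColumn h y ∈ nonzeroColumns n
      nonzero y y<D = ∈-filter⁺ nonzero? (suffixes⇒columnsOver _ (proj₁ (centralColumn-central y y<D)))
        (λ eq → moves y y<D (λ i i≤n →
        sym (ℤₚ.+-injective (ℤₚ.i-j≡0⇒i≡j _ _ (trans (sym (below-centralColumn y y<D i i≤n))
          (trans (cong (below i) eq) (below-zeroColumn n i)))))))

  centralColumns-injective : ∀ {h h′} → ∀ y k → centralColumns h y k ≡ centralColumns h′ y k →
    ∀ x → y ≤ x → x < k + y → centralColumn h x ≡ centralColumn h′ x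
  centralColumns-injective y zero    eq x y≤x x< = contradiction x< (ℕₚ.≤⇒≯ y≤x)
  centralColumns-injective y (suc k) eq x y≤x x< with ℕₚ.m≤n⇒m<n∨m≡n y≤x
  ... | inj₂ refl = Listₚ.∷-injectiveˡ eq
  ... | inj₁ y<x  = centralColumns-injective (suc y) k (Listₚ.∷-injectiveʳ eq) x y<x
    (subst (x <_) (sym (ℕₚ.+-suc k y)) x<)

  trapezoidOf-injective : ∀ {h h′} → Flow h → Flow h′ → trapezoidOf h ≡ trapezoidOf h′ →
    ∀ x i → x ≤ D → i ≤ n → h x i ≡ h′ x i
  trapezoidOf-injective {h} {h′} f f′ eq zero    i _   i≤n = trans (Flow.start f i i≤n) (sym (Flow.start f′ i i≤n))
  trapezoidOf-injective {h} {h′} f f′ eq (suc x) i x<D i≤n = ℤₚ.+-injective (begin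
    + h (suc x) i                                   ≡⟨ solve 2 (λ a b → a := (a :- b) :+ b) refl (+ h (suc x) i)
      (+ h x i) ⟩
    (+ h (suc x) i ℤ.- + h x i) ℤ.+ + h x i          ≡⟨ cong₂ ℤ._+_ diff
      (cong +_ (trapezoidOf-injective f f′ eq x i (ℕₚ.<⇒≤ x<D) i≤n)) ⟩
    (+ h′ (suc x) i ℤ.- + h′ x i) ℤ.+ + h′ x i       ≡⟨ solve 2 (λ a b → (a :- b) :+ b := a) refl (+ h′ (suc x) i)
      (+ h′ x i) ⟩
    + h′ (suc x) i ∎)
    where
    open ≡-Reasoning
    open Data.Integer.Solver.+-*-Solver
    diff : + h (suc x) i ℤ.- + h x i ≡ + h′ (suc x) i ℤ.- + h′ x i
    diff = trans (sym (below-centralColumn f x x<D i i≤n)) (trans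
      (cong (below i) (centralColumns-injective 0 D (cong proj₁ eq) x z≤n
        (subst (x <_) (sym (ℕₚ.+-identityʳ D)) x<D)))
      (below-centralColumn f′ x x<D i i≤n))

-- The skew shape of a centred Catalan set

bool : Bool → ℕ
bool b = if b then 1 else 0

len : ∀ {A : Set} → (A → Bool) → List A → ℕ
len p xs = length (filterᵇ p xs)

len-∷ : ∀ {A : Set} (p : A → Bool) x xs → len p (x ∷ xs) ≡ bool (p x) + len p xs
len-∷ p x xs with p x
... | true  = refl
... | false = refl

len-split : ∀ {A : Set} (p q r : A → Bool) → (∀ z → bool (p z) ≡ bool (q z) + bool (r z)) → ∀ xs →
  len p xs ≡ len q xs + len r xs
len-split p q r eq []       = refl
len-split p q r eq (x ∷ xs) = begin
  len p (x ∷ xs)                                          ≡⟨ len-∷ p x xs ⟩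
  bool (p x) + len p xs                                   ≡⟨ cong₂ _+_ (eq x) (len-split p q r eq xs) ⟩
  bool (q x) + bool (r x) + (len q xs + len r xs)
    ≡⟨ solve 4 (λ a b c d → a :+ b :+ (c :+ d) := a :+ c :+ (b :+ d)) refl (bool (q x)) (bool (r x)) (len q xs)
      (len r xs) ⟩
  bool (q x) + len q xs + (bool (r x) + len r xs)         ≡⟨ cong₂ _+_ (len-∷ q x xs) (len-∷ r x xs) ⟨
  len q (x ∷ xs) + len r (x ∷ xs) ∎
  where
  open ≡-Reasoning
  open Data.Nat.Solver.+-*-Solver

len-filter : ∀ {A : Set} {P : A → Set} (P? : Decidable P) xs → length (filter P? xs) ≡ len (does ∘ P?) xs
len-filter P? [] = refl
len-filter P? (x ∷ xs) with does (P? x)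
... | true  = cong suc (len-filter P? xs)
... | false = len-filter P? xs

len≤ : ∀ {A : Set} (p : A → Bool) xs → len p xs ≤ length xs
len≤ p xs = Listₚ.length-filter _ xs

len-within : ∀ {A : Set} (p q : A → Bool) → (∀ z → q z ≡ true → p z ≡ true) → ∀ xs → len q (filterᵇ p xs) ≡ len q xs
len-within p q imp [] = refl
len-within p q imp (x ∷ xs) with p x in px
... | true  = trans (len-∷ q x (filterᵇ p xs)) (trans (cong (_+_ (bool (q x))) (len-within p q imp xs))
  (sym (len-∷ q x xs)))
... | false = trans (len-within p q imp xs) (sym (trans (len-∷ q x xs)
      (cong (λ b → bool b + len q xs) (not-true⇒false (λ qx → true≢false (trans (sym (imp x qx)) px))))))

len-member : ∀ {S} → Unique S → ∀ z → len (λ y → z ≡ᶻ y) S ≡ member S z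
len-member [] z = refl
len-member {x ∷ S} (x∉ ∷ S!) z with z ℤ.≟ x
... | yes refl = cong suc (trans (len-member S! x) (absent (λ x∈ → All.lookup x∉ x∈ refl)))
  where
  absent : ∀ {S} → x ∉ S → member S x ≡ 0
  absent {S} x∉S with x ∈ᶻ S in eq
  ... | true  = contradiction (∈ᶻ⁻ eq) x∉S
  ... | false = refl
... | no _ = len-member S! z

neg≤ pos≤ : ℕ → ℤ → Bool
neg≤ i (+ _)      = false
neg≤ i -[1+ c ]   = c <ᵇ i
pos≤ i (+ zero)   = false
pos≤ i (+ suc c)  = c <ᵇ i
pos≤ i -[1+ _ ]   = false

<ᵇ-true⁻ : ∀ {m n} → (m <ᵇ n) ≡ true → m < n
<ᵇ-true⁻ {m} {n} eq = ℕₚ.<ᵇ⇒< m n (from T-≡ eq)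

<ᵇ-true⁺ : ∀ {m n} → m < n → (m <ᵇ n) ≡ true
<ᵇ-true⁺ lt = to T-≡ (ℕₚ.<⇒<ᵇ lt)

<ᵇ-false : ∀ {m n} → n ≤ m → (m <ᵇ n) ≡ false
<ᵇ-false n≤m = not-true⇒false (λ eq → ℕₚ.≤⇒≯ n≤m (<ᵇ-true⁻ eq))

bool-<ᵇ-suc : ∀ c i b → (b ≡ true ⇔ c ≡ i) → bool (c <ᵇ suc i) ≡ bool (c <ᵇ i) + bool b
bool-<ᵇ-suc c i b b⇔ with ℕₚ.<-cmp c i
... | tri< c<i c≢i _ rewrite <ᵇ-true⁺ c<i | <ᵇ-true⁺ (ℕₚ.m≤n⇒m≤1+n c<i) | not-true⇒false (λ e → c≢i (to b⇔ e)) = refl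
... | tri≈ _ refl _ rewrite <ᵇ-false {c} {c} ℕₚ.≤-refl | <ᵇ-true⁺ (ℕₚ.n<1+n c) | from b⇔ refl = refl
... | tri> _ c≢i i<c rewrite <ᵇ-false (ℕₚ.<⇒≤ i<c) | <ᵇ-false i<c | not-true⇒false (λ e → c≢i (to b⇔ e)) = refl

acc-neg : ∀ {S} → Unique S → ∀ i → acc (λ c → member S -[1+ c ]) i ≡ len (neg≤ i) S
acc-neg {S} S! zero    = sym (empty S)
  where
  empty : ∀ S → len (neg≤ 0) S ≡ 0
  empty []             = refl
  empty (+ _ ∷ S)      = empty S
  empty (-[1+ _ ] ∷ S) = empty S
acc-neg {S} S! (suc i) = trans (cong₂ _+_ (acc-neg S! i) (sym (len-member S! -[1+ i ])))
  (sym (len-split (neg≤ (suc i)) (neg≤ i) (λ y → -[1+ i ] ≡ᶻ y) pointwise S))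
  where
  pointwise : ∀ z → bool (neg≤ (suc i) z) ≡ bool (neg≤ i z) + bool (-[1+ i ] ≡ᶻ z)
  pointwise (+ _)     = refl
  pointwise -[1+ c ] = bool-<ᵇ-suc c i _ (mk⇔ (λ e → sym (ℤₚ.-[1+-injective (≡ᶻ-true⁻ { -[1+ i ]} { -[1+ c ]} e)))
    (λ { refl → ≡ᶻ-true⁺ { -[1+ i ]} refl }))

acc-pos : ∀ {S} → Unique S → ∀ i → acc (λ c → member S (+ suc c)) i ≡ len (pos≤ i) S
acc-pos {S} S! zero    = sym (empty S)
  where
  empty : ∀ S → len (pos≤ 0) S ≡ 0
  empty []             = refl
  empty (+ zero ∷ S)   = empty S
  empty (+ suc _ ∷ S)  = empty S
  empty (-[1+ _ ] ∷ S) = empty S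
acc-pos {S} S! (suc i) = trans (cong₂ _+_ (acc-pos S! i) (sym (len-member S! (+ suc i))))
  (sym (len-split (pos≤ (suc i)) (pos≤ i) (λ y → + suc i ≡ᶻ y) pointwise S))
  where
  pointwise : ∀ z → bool (pos≤ (suc i) z) ≡ bool (pos≤ i z) + bool (+ suc i ≡ᶻ z)
  pointwise (+ zero)  = refl
  pointwise (+ suc c) = bool-<ᵇ-suc c i _
    (mk⇔ (λ e → sym (ℕₚ.suc-injective (ℤₚ.+-injective (≡ᶻ-true⁻ {+ suc i} {+ suc c} e))))
    (λ { refl → ≡ᶻ-true⁺ {+ suc i} refl }))
  pointwise -[1+ c ]  = refl

len-abs : ∀ {S} → Unique S → ∀ i → length (filter (λ z → ℤ.∣ z ∣ ℕₚ.≤? i) S) ≡ member S (+ 0) +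
  (len (neg≤ i) S + len (pos≤ i) S)
len-abs {S} S! i = begin
  length (filter (λ z → ℤ.∣ z ∣ ℕₚ.≤? i) S) ≡⟨ len-filter (λ z → ℤ.∣ z ∣ ℕₚ.≤? i) S ⟩
  len (λ z → ℤ.∣ z ∣ ≤ᵇ i) S
    ≡⟨ len-split (λ z → ℤ.∣ z ∣ ≤ᵇ i) (λ z → + 0 ≡ᶻ z) (λ z → neg≤ i z ∨ pos≤ i z) pointwise S ⟩
  len (λ z → + 0 ≡ᶻ z) S + len (λ z → neg≤ i z ∨ pos≤ i z) S
    ≡⟨ cong₂ _+_ (len-member S! (+ 0)) (len-split _ (neg≤ i) (pos≤ i) pointwise′ S) ⟩
  member S (+ 0) + (len (neg≤ i) S + len (pos≤ i) S) ∎
  where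
  open ≡-Reasoning
  pointwise : ∀ z → bool (ℤ.∣ z ∣ ≤ᵇ i) ≡ bool (+ 0 ≡ᶻ z) + bool (neg≤ i z ∨ pos≤ i z)
  pointwise (+ zero)  = refl
  pointwise (+ suc c) = refl
  pointwise -[1+ c ]  = cong bool (sym (Boolₚ.∨-identityʳ (c <ᵇ i)))
  pointwise′ : ∀ z → bool (neg≤ i z ∨ pos≤ i z) ≡ bool (neg≤ i z) + bool (pos≤ i z)
  pointwise′ (+ zero)  = refl
  pointwise′ (+ suc c) = refl
  pointwise′ -[1+ c ] with c <ᵇ i
  ... | true  = refl
  ... | false = refl

at : ∀ {A : Set} → A → List A → ℕ → A
at d []       k       = d
at d (x ∷ xs) zero    = x
at d (x ∷ xs) (suc k) = at d xs k

at-all : ∀ {A : Set} {P : A → Set} d {xs} → All P xs → ∀ k → k < length xs → P (at d xs k)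
at-all d (p ∷ ps) zero    _        = p
at-all d (p ∷ ps) (suc k) (s≤s k<) = at-all d ps k k<

at-suc : ∀ {A : Set} {R : A → A → Set} d {xs} → AllPairs R xs → ∀ k → suc k < length xs →
  R (at d xs k) (at d xs (suc k))
at-suc d (r ∷ rs) zero    (s≤s k<) = at-all d r 0 k<
at-suc d (r ∷ rs) (suc k) (s≤s k<) = at-suc d rs k k<

len-count : ∀ {A : Set} (p : A → Bool) d xs → len p xs ≡ count (λ k → p (at d xs k) Boolₚ.≟ true) (length xs)
len-count p d [] = refl
len-count p d (x ∷ xs) with p x
... | true  = cong suc (len-count p d xs)
... | false = len-count p d xs

falling : ∀ {A : Set} (p : A → Bool) d xs → (∀ k → suc k < length xs → p (at d xs (suc k)) ≡ true →
  p (at d xs k) ≡ true) →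
  ∀ c → (c < length xs × p (at d xs c) ≡ true) ⇔ c < len p xs
falling p d xs down c rewrite len-count p d xs = mk⇔
  (λ (c< , pc) → to (thr c c<) pc)
  (λ lt → let c< = ℕₚ.<-≤-trans lt (count≤ (λ k → p (at d xs k) Boolₚ.≟ true) (length xs)) in c< , from (thr c c<) lt)
  where thr = threshold (λ k → p (at d xs k) Boolₚ.≟ true) (length xs) down

len-all : ∀ {A : Set} (p : A → Bool) {xs} → All (λ x → p x ≡ true) xs → len p xs ≡ length xs
len-all p [] = refl
len-all p {x ∷ xs} (px ∷ ps) = trans (len-∷ p x xs) (cong₂ _+_ (cong bool px) (len-all p ps))

-- A property that persists along the list holds exactly on a final segment of `len p xs` elements.
rising : ∀ {A : Set} (p : A → Bool) d {xs} → AllPairs (λ x y → p x ≡ true → p y ≡ true) xs →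
  ∀ r → r < length xs → p (at d xs r) ≡ true ⇔ length xs ∸ r ≤ len p xs
rising p d {x ∷ xs} (up ∷ ups) r r< with p x in px
... | true = mk⇔ (λ _ → ℕₚ.≤-trans (ℕₚ.m∸n≤m (suc (length xs)) r) (s≤s (ℕₚ.≤-reflexive (sym (len-all p up′)))))
                 (λ _ → at-all d (px ∷ up′) r r<)
  where
  up′ : All (λ y → p y ≡ true) xs
  up′ = All.map (λ f → f refl) up
rising p d {x ∷ xs} (up ∷ ups) zero r< | false = mk⇔ (λ e → contradiction (trans (sym e) px) true≢false)
  (λ le → contradiction le (ℕₚ.<⇒≱ (s≤s (len≤ p xs))))
rising p d {x ∷ xs} (up ∷ ups) (suc r) (s≤s r<) | false = rising p d ups r r<

at-map-indexed : ∀ {A B : Set} (g : ℕ × A → B) d e xs k → k < length xs → at e (map g (indexed xs)) k ≡ g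
  (k , at d xs k)
at-map-indexed {A} {B} g d e xs k k< = go id xs k k<
  where
  go : ∀ (f : ℕ → ℕ) xs k → k < length xs → at e (map g (zip (applyUpTo f (length xs)) xs)) k ≡ g (f k , at d xs k)
  go f (x ∷ xs) zero    _        = refl
  go f (x ∷ xs) (suc k) (s≤s k<) = go (f ∘ suc) xs k k<

length-map-indexed : ∀ {A B : Set} (g : ℕ × A → B) xs → length (map g (indexed xs)) ≡ length xs
length-map-indexed g xs = trans (Listₚ.length-map g (indexed xs))
  (trans (Listₚ.length-zipWith _,_ (upTo (length xs)) xs)
  (trans (cong (_⊓ length xs) (Listₚ.length-upTo (length xs))) (ℕₚ.⊓-idem (length xs))))

partAt≡at : ∀ xs k → partAt xs k ≡ at 0 xs k
partAt≡at []       k       = refl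
partAt≡at (x ∷ xs) zero    = refl
partAt≡at (x ∷ xs) (suc k) = partAt≡at xs k

at-beyond : ∀ {A : Set} (d : A) xs k → length xs ≤ k → at d xs k ≡ d
at-beyond d []       k       _        = refl
at-beyond d (x ∷ xs) (suc k) (s≤s le) = at-beyond d xs k le

-- This is also true past the largest part, where `partAt` returns its default 0 and no part exceeds
-- `r`; the length of the conjugate can thus be forgotten.
partAt-conjugate : ∀ ν r → partAt (conjugate ν) r ≡ len (r <ᵇ_) ν
partAt-conjugate ν r = trans (partAt≡at (conjugate ν) r)
  (trans (cong (λ xs → at 0 xs r) (Listₚ.map-upTo (λ r → len (r <ᵇ_) ν) M)) (go r))
  where
  M = Data.List.foldr _⊔_ 0 ν
  at-applyUpTo : ∀ (f : ℕ → ℕ) M r → r < M → at 0 (applyUpTo f M) r ≡ f r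
  at-applyUpTo f (suc M) zero    _        = refl
  at-applyUpTo f (suc M) (suc r) (s≤s r<) = at-applyUpTo (f ∘ suc) M r r<
  empty : ∀ ν r → Data.List.foldr _⊔_ 0 ν ≤ r → len (r <ᵇ_) ν ≡ 0
  empty []      r _  = refl
  empty (x ∷ ν) r le = trans (len-∷ (r <ᵇ_) x ν) (cong₂ _+_ (cong bool (<ᵇ-false (ℕₚ.m⊔n≤o⇒m≤o x _ le)))
    (empty ν r (ℕₚ.m⊔n≤o⇒n≤o x _ le)))
  go : ∀ r → at 0 (applyUpTo (λ r → len (r <ᵇ_) ν) M) r ≡ len (r <ᵇ_) ν
  go r with ℕₚ.≤-<-connex M r
  ... | inj₂ r<M = at-applyUpTo (λ r → len (r <ᵇ_) ν) M r r<M
  ... | inj₁ M≤r = trans (at-beyond 0 (applyUpTo (λ r → len (r <ᵇ_) ν) M) r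
    (ℕₚ.≤-trans (ℕₚ.≤-reflexive (Listₚ.length-applyUpTo _ M)) M≤r)) (sym (empty ν r M≤r))

-- Cells of a skew shape, row by row

blocks : (ℕ → List ℕ) → ℕ → List (ℕ × ℕ)
blocks g k = concat (applyUpTo (λ r → map (r ,_) (g r)) k)

∈-blocks⁻ : ∀ g k {r c} → (r , c) ∈ blocks g k → r < k × c ∈ g r
∈-blocks⁻ g k p∈ with ∈-concat⁻′ (applyUpTo (λ r → map (r ,_) (g r)) k) p∈
... | ys , p∈ys , ys∈ with ∈-applyUpTo⁻ (λ r → map (r ,_) (g r)) ys∈
... | r , r<k , refl with ∈-map⁻ (r ,_) p∈ys
... | c , c∈ , refl = r<k , c∈

∈-blocks⁺ : ∀ g k {r c} → r < k → c ∈ g r → (r , c) ∈ blocks g k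
∈-blocks⁺ g k {r} r<k c∈ = ∈-concat⁺′ (∈-map⁺ (r ,_) c∈) (∈-applyUpTo⁺ (λ r → map (r ,_) (g r)) r<k)

-- The order in which `skewCells` lists the cells. It shows that no cell is repeated, and it later
-- numbers the cells by a standard filling.
Lex : ℕ × ℕ → ℕ × ℕ → Set
Lex (r , c) (r′ , c′) = r < r′ ⊎ (r ≡ r′ × c < c′)

blocks-sorted : ∀ g k → (∀ r → AllPairs _<_ (g r)) → AllPairs Lex (blocks g k)
blocks-sorted g k sorted = AllPairsₚ.concat⁺
  (Allₚ.applyUpTo⁺₂ _ k (λ r → AllPairsₚ.map⁺ (AllPairs.map (λ c<c′ → inj₂ (refl , c<c′)) (sorted r))))
  (AllPairsₚ.applyUpTo⁺₁ _ k (λ i<j _ → Allₚ.map⁺ (All.tabulate (λ _ → Allₚ.map⁺ (All.tabulate (λ _ → inj₁ i<j))))))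

skewCells≡blocks : ∀ lam mu → skewCells lam mu ≡ blocks (λ r → filterᵇ (λ c → partAt mu r ≤ᵇ c) (upTo (partAt lam r)))
  (length lam)
skewCells≡blocks lam mu = go (λ r lr → map (r ,_) (filterᵇ (λ c → partAt mu r ≤ᵇ c) (upTo lr))) id lam
  where
  go : (F : ℕ → ℕ → List (ℕ × ℕ)) (f : ℕ → ℕ) (lam : List ℕ) →
    concatMap (λ { (r , lr) → F r lr }) (zip (applyUpTo f (length lam)) lam) ≡ concat
      (applyUpTo (λ k → F (f k) (partAt lam k)) (length lam))
  go F f []        = refl
  go F f (x ∷ lam) = cong (F (f 0) x ++_) (go F (f ∘ suc) lam)

skewCells-sorted : ∀ lam mu → AllPairs Lex (skewCells lam mu)
skewCells-sorted lam mu = subst (AllPairs Lex) (sym (skewCells≡blocks lam mu))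
  (blocks-sorted _ (length lam) (λ r → AllPairsₚ.filter⁺ _ (AllPairsₚ.applyUpTo⁺₁ id (partAt lam r) (λ i<j _ → i<j))))

∈-skewCells : ∀ lam mu r c → (r , c) ∈ skewCells lam mu ⇔ (partAt mu r ≤ c × c < partAt lam r)
∈-skewCells lam mu r c = mk⇔ fwd bwd
  where
  g : ℕ → List ℕ
  g r = filterᵇ (λ c → partAt mu r ≤ᵇ c) (upTo (partAt lam r))
  fwd : (r , c) ∈ skewCells lam mu → partAt mu r ≤ c × c < partAt lam r
  fwd p∈ with ∈-blocks⁻ g (length lam) (subst ((r , c) ∈_) (skewCells≡blocks lam mu) p∈)
  ... | _ , c∈ with ∈-filter⁻ _ {xs = upTo (partAt lam r)} c∈
  ... | c∈′ , le = ℕₚ.≤ᵇ⇒≤ _ _ le , ∈-upTo⁻ c∈′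
  bwd : partAt mu r ≤ c × c < partAt lam r → (r , c) ∈ skewCells lam mu
  bwd (le , lt) = subst ((r , c) ∈_) (sym (skewCells≡blocks lam mu)) (∈-blocks⁺ g (length lam) r<
    (∈-filter⁺ _ (∈-upTo⁺ lt) (ℕₚ.≤⇒≤ᵇ le)))
    where
    r< : r < length lam
    r< with ℕₚ.≤-<-connex (length lam) r
    ... | inj₂ r<len = r<len
    ... | inj₁ len≤r = contradiction (subst (c <_) (trans (partAt≡at lam r) (at-beyond 0 lam r len≤r)) lt) λ ()

abs-∸ : ∀ {a b} → b ≤ a → ℤ.∣ + a ℤ.- + b ∣ ≡ a ∸ b
abs-∸ b≤a = cong ℤ.∣_∣ (sym (pos-∸ b≤a))

data Negative : ℤ → Set where
  isNeg : ∀ a → Negative -[1+ a ]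

data Positive : ℤ → Set where
  isPos : ∀ b → Positive (+ suc b)

negative⁻ : ∀ z → (z <ᶻ + 0) ≡ true → Negative z
negative⁻ (+ k) eq with subst (λ j → (+ j ≤ᶻ + 0) ≡ true) (ℕₚ.+-comm k 1) eq
... | ()
negative⁻ -[1+ a ] _ = isNeg a

positive⁻ : ∀ z → (+ 0 <ᶻ z) ≡ true → Positive z
positive⁻ (+ suc b) _ = isPos b
positive⁻ (+ zero) ()
positive⁻ -[1+ _ ] ()

negative⁺ : ∀ a → (-[1+ a ] <ᶻ + 0) ≡ true
negative⁺ zero    = refl
negative⁺ (suc a) = refl

-- The shape of a centred Catalan set in terms of A and B

module CatalanSet (n : ℕ) (S : List ℤ) (cc : CentredCatalan (suc n) S) where
  open CentredCatalan cc

  α β A B : ℕ → ℕ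
  α c = member S -[1+ c ]
  β c = member S (+ suc c)
  A = acc α
  B = acc β

  S! : Unique S
  S! = AllPairs.map (λ lt eq → ℤₚ.<-irrefl eq lt) increasing

  filter-abs : ∀ i → length (filter (λ z → ℤ.∣ z ∣ ℕₚ.≤? i) S) ≡ member S (+ 0) + (A i + B i)
  filter-abs i = trans (len-abs S! i) (cong (_+_ (member S (+ 0))) (sym (cong₂ _+_ (acc-neg S! i) (acc-pos S! i))))

  -- The Catalan condition at `i = 0` can only be met by the element 0.
  member-0 : member S (+ 0) ≡ 1
  member-0 with member S (+ 0) | member-bit S (+ 0) | subst (1 ≤_) (filter-abs 0) (catalan 0 z<s)
  ... | _ | inj₁ refl | ()
  ... | _ | inj₂ refl | _ = refl

  0∈S : + 0 ∈ S
  0∈S = member⁻ member-0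

  ranged : ∀ {z} → z ∈ S → Ranged n z
  ranged {z} z∈ with All.lookup inRange z∈
  ... | lo , hi = go z lo hi
    where
    go : ∀ z → (ℤ.- (+ suc n)) ℤ.+ + 1 ℤ.≤ z → z ℤ.≤ (+ suc n ℤ.- + 1) → Ranged n z
    go (+ zero)  _  _ = origin
    go (+ suc c) _  hi = positive (ℤₚ.drop‿+≤+ hi)
    go -[1+ c ]  lo _ = negative (ℤₚ.drop‿+≤+ (ℤₚ.neg-cancel-≤ (subst (ℤ._≤ -[1+ c ]) (shift n) lo)))
      where
      shift : ∀ n → (ℤ.- (+ suc n)) ℤ.+ + 1 ≡ ℤ.- (+ n)
      shift zero    = refl
      shift (suc n) = refl

  profile : Profile n A B
  profile = record
    { A-zero  = refl
    ; B-zero  = refl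
    ; A-inc   = λ i → inc (A i) (member-bit S -[1+ i ])
    ; B-inc   = λ i → inc (B i) (member-bit S (+ suc i))
    -- One of the n+1 elements of `S` is 0, which is counted neither in A nor in B.
    ; bounded = λ i → ℕₚ.≤-pred (subst₂ _≤_ (trans (filter-abs i) (cong (_+ (A i + B i)) member-0)) size
      (Listₚ.length-filter _ S))
    ; catalan = λ i i≤n → ℕₚ.≤-pred (subst (suc i ≤_) (trans (filter-abs i) (cong (_+ (A i + B i)) member-0))
      (catalan i (s≤s i≤n)))
    }
    where
    inc : ∀ a {k} → Bit (+ k) → Increment a (a + k)
    inc a (inj₁ refl) = inj₁ (ℕₚ.+-identityʳ a)
    inc a (inj₂ refl) = inj₂ (ℕₚ.+-comm a 1)

  open Flows profile (area n α β) using (A≤; B≤)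

  u v : ℕ
  u = uOf S
  v = length (positives S)

  negatives-increasing : AllPairs ℤ._<_ (negatives S)
  negatives-increasing = AllPairsₚ.filter⁺ _ increasing

  positives-increasing : AllPairs ℤ._<_ (positives S)
  positives-increasing = AllPairsₚ.filter⁺ _ increasing

  negs : All Negative (negatives S)
  negs = All.map (λ {z} t → negative⁻ z (to T-≡ t)) (Allₚ.all-filter _ S)

  poss : All Positive (positives S)
  poss = All.map (λ {z} t → positive⁻ z (to T-≡ t)) (Allₚ.all-filter _ S)

  A-negatives : ∀ i → len (neg≤ i) (negatives S) ≡ A i
  A-negatives i = trans (len-within (λ z → z <ᶻ + 0) (neg≤ i) (λ { -[1+ a ] _ → negative⁺ a }) S) (sym (acc-neg S! i))

  B-positives : ∀ i → len (pos≤ i) (positives S) ≡ B i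
  B-positives i = trans (len-within (λ z → + 0 <ᶻ z) (pos≤ i) (λ { (+ suc b) _ → refl }) S) (sym (acc-pos S! i))

  A≤u : ∀ i → A i ≤ u
  A≤u i = subst (_≤ u) (A-negatives i) (len≤ (neg≤ i) (negatives S))

  -- The r-th negative element is -a r, the k-th positive one is b k (counting from 0).
  a b : ℕ → ℕ
  a r = ℤ.∣ at (+ 0) (negatives S) r ∣
  b k = ℤ.∣ at (+ 0) (positives S) k ∣

  at-negatives : ∀ r → r < u → at (+ 0) (negatives S) r ≡ ℤ.- (+ a r)
  at-negatives r r<u with at (+ 0) (negatives S) r | at-all (+ 0) negs r r<u
  ... | _ | isNeg c = refl

  at-positives : ∀ k → k < v → at (+ 0) (positives S) k ≡ + b k × 1 ≤ b k
  at-positives k k<v with at (+ 0) (positives S) k | at-all (+ 0) poss k k<v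
  ... | _ | isPos c = refl , s≤s z≤n

  b-increasing : ∀ k → suc k < v → b k < b (suc k)
  b-increasing k k< = ℤₚ.drop‿+<+ (subst₂ ℤ._<_ (proj₁ (at-positives k (ℕₚ.<⇒≤ k<))) (proj₁ (at-positives (suc k) k<))
    (at-suc (+ 0) positives-increasing k k<))

  -- The negative elements increase, so their absolute values decrease, and those at most `i` are
  -- the last `A i` entries of the list.
  a-threshold : ∀ r i → r < u → a r ≤ i ⇔ u ∸ r ≤ A i
  a-threshold r i r<u = mk⇔ (λ le → subst (u ∸ r ≤_) (A-negatives i) (to rise (fwd le)))
    (λ le → bwd (from rise (subst (u ∸ r ≤_) (sym (A-negatives i)) le)))
    where
    neg≤-mono : ∀ {x y} → x ℤ.< y → Negative y → neg≤ i x ≡ true → neg≤ i y ≡ true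
    neg≤-mono (ℤ.-<- n<m) (isNeg _) e = <ᵇ-true⁺ {_} {i} (ℕₚ.<-trans n<m (<ᵇ-true⁻ {_} {i} e))
    mono : ∀ {xs} → AllPairs ℤ._<_ xs → All Negative xs → AllPairs (λ x y → neg≤ i x ≡ true → neg≤ i y ≡ true) xs
    mono []       []       = []
    mono (r ∷ rs) (_ ∷ ns) = All.zipWith (λ (lt , n) → neg≤-mono lt n) (r , ns) ∷ mono rs ns
    rise = rising (neg≤ i) (+ 0) (mono negatives-increasing negs) r r<u
    fwd : a r ≤ i → neg≤ i (at (+ 0) (negatives S) r) ≡ true
    fwd le with at (+ 0) (negatives S) r | at-all (+ 0) negs r r<u
    ... | _ | isNeg c = <ᵇ-true⁺ le
    bwd : neg≤ i (at (+ 0) (negatives S) r) ≡ true → a r ≤ i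
    bwd e with at (+ 0) (negatives S) r | at-all (+ 0) negs r r<u
    ... | _ | isNeg c = <ᵇ-true⁻ e

  pos≤⇔ : ∀ i k → k < v → pos≤ i (at (+ 0) (positives S) k) ≡ true ⇔ b k ≤ i
  pos≤⇔ i k k<v with b k | at-positives k k<v
  ... | suc c | eq , _ rewrite eq = mk⇔ <ᵇ-true⁻ <ᵇ-true⁺

  b-threshold : ∀ k i → (k < v × b k ≤ i) ⇔ k < B i
  b-threshold k i = mk⇔ (λ (k<v , le) → subst (k <_) (B-positives i) (to fall (k<v , from (pos≤⇔ i k k<v) le)))
    (λ lt → let (k<v , e) = from fall (subst (k <_) (sym (B-positives i)) lt) in k<v , to (pos≤⇔ i k k<v) e)
    where
    fall = falling (pos≤ i) (+ 0) (positives S) (λ j j< e → from (pos≤⇔ i j (ℕₚ.<⇒≤ j<))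
      (ℕₚ.≤-trans (ℕₚ.<⇒≤ (b-increasing j j<)) (to (pos≤⇔ i (suc j) j<) e))) k

  t≤a : ∀ r → r < u → u ∸ r ≤ a r
  t≤a r r<u = ℕₚ.≤-trans (to (a-threshold r (a r) r<u) ℕₚ.≤-refl) (A≤ (a r))

  k<b : ∀ k → k < v → k < b k
  k<b k k<v = ℕₚ.<-≤-trans (to (b-threshold k (b k)) (k<v , ℕₚ.≤-refl)) (B≤ (b k))

  B-b≤ : ∀ k → k < v → B (b k) ≤ suc k
  B-b≤ k k<v = ℕₚ.≮⇒≥ (λ lt → let (k′<v , le) = from (b-threshold (suc k) (b k)) lt in ℕₚ.<⇒≱ (b-increasing k k′<v) le)

  b≤n : ∀ k → k < v → b k ≤ n
  b≤n k k<v = go (ranged (proj₁ (∈-filter⁻ _ {xs = S} (at-∈ k k<v)))) (proj₁ (at-positives k k<v))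
    (proj₂ (at-positives k k<v))
    where
    at-∈ : ∀ k → k < v → at (+ 0) (positives S) k ∈ positives S
    at-∈ = at-all (+ 0) (All.tabulate id)
    go : ∀ {z c} → Ranged n z → z ≡ + c → 1 ≤ c → c ≤ n
    go origin refl ()
    go (positive c<n) refl _ = c<n

  -- The Catalan condition at `i = b k`, where at most `u` negative and exactly the first `k+1`
  -- positive elements can be counted. It makes the parts of the conjugate of λ nonnegative, so that
  -- the absolute value in `λ-conj` is harmless.
  b≤u+k+1 : ∀ k → k < v → b k ≤ u + 1 + k
  b≤u+k+1 k k<v = begin
    b k                 ≤⟨ Profile.catalan profile (b k) (b≤n k k<v) ⟩
    A (b k) + B (b k)   ≤⟨ ℕₚ.+-mono-≤ (A≤u (b k)) (B-b≤ k k<v) ⟩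
    u + suc k           ≡⟨ ℕₚ.+-assoc u 1 k ⟨
    u + 1 + k           ∎
    where open ℕₚ.≤-Reasoning

  ν : ℕ → ℕ
  ν k = (u + 1 + k) ∸ b k

  at-λ-conj : ∀ k → k < v → at 0 (λ-conj S) k ≡ ν k
  at-λ-conj k k<v = trans (at-map-indexed _ (+ 0) 0 (positives S) k k<v)
    (trans (cong (λ s → ℤ.∣ + (u + 1 + k) ℤ.- s ∣) (proj₁ (at-positives k k<v))) (abs-∸ (b≤u+k+1 k k<v)))

  partAt-μ : ∀ r → r < u → partAt μ⟨ S ⟩ r ≡ a r ∸ (u ∸ r)
  partAt-μ r r<u = trans (partAt≡at μ⟨ S ⟩ r) (trans (at-map-indexed _ (+ 0) 0 (negatives S) r r<u)
    (trans (cong (λ s → ℤ.∣ (ℤ.- s) ℤ.- + (u ∸ r) ∣) (at-negatives r r<u))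
      (trans (cong (λ s → ℤ.∣ s ℤ.- + (u ∸ r) ∣) (ℤₚ.neg-involutive (+ a r))) (abs-∸ (t≤a r r<u)))))

  partAt-λ : ∀ r c → c < partAt λ⟨ S ⟩ r ⇔ (c < v × r < ν c)
  partAt-λ r c rewrite partAt-conjugate (λ-conj S) r = mk⇔
    (λ lt → let (c< , e) = from fall lt ; c<v = subst (c <_) (length-map-indexed _ (positives S)) c< in
      c<v , subst (r <_) (at-λ-conj c c<v) (<ᵇ-true⁻ e))
    (λ (c<v , lt) → to fall (subst (c <_) (sym (length-map-indexed _ (positives S))) c<v , <ᵇ-true⁺
      (subst (r <_) (sym (at-λ-conj c c<v)) lt)))
    where
    ν-decreasing : ∀ k → suc k < v → ν (suc k) ≤ ν k
    ν-decreasing k k< = ℕₚ.≤-trans (ℕₚ.∸-monoʳ-≤ (u + 1 + suc k) (b-increasing k k<))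
      (ℕₚ.≤-reflexive (cong (_∸ suc (b k)) (ℕₚ.+-suc (u + 1) k)))
    fall = falling (r <ᵇ_) 0 (λ-conj S) (λ k k< e → let k<v = subst (suc k <_) (length-map-indexed _ (positives S)) k< in
      <ᵇ-true⁺ (subst (r <_) (sym (at-λ-conj k (ℕₚ.<⇒≤ k<v)))
        (ℕₚ.<-≤-trans (subst (r <_) (at-λ-conj (suc k) k<v) (<ᵇ-true⁻ e)) (ν-decreasing k k<v)))) c

  IsCell : ℕ → ℕ → Set
  IsCell r c = r < u × u ∸ r ≤ A (u ∸ r + c) × c < B (u ∸ r + c)

  cells : List (ℕ × ℕ)
  cells = skewCells λ⟨ S ⟩ μ⟨ S ⟩

  r<ν⇔ : ∀ r c → r < u → r < ν c ⇔ b c ≤ u ∸ r + c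
  r<ν⇔ r c r<u = mk⇔
    (λ lt → ℕₚ.≤-pred (ℕₚ.+-cancelˡ-≤ r _ _ (begin
      r + suc (b c)             ≡⟨ ℕₚ.+-suc r (b c) ⟩
      suc r + b c               ≤⟨ ℕₚ.m≤o∸n⇒m+n≤o (suc r) (ℕₚ.<⇒≤ (ℕₚ.m∸n≢0⇒n<m (λ e → ℕₚ.n≮0 (subst (r <_) e lt))))
        lt ⟩
      u + 1 + c                 ≡⟨ eq ⟩
      r + suc (u ∸ r + c)       ∎)))
    (λ le → ℕₚ.m+n≤o⇒m≤o∸n (suc r) (begin
      suc r + b c               ≡⟨ ℕₚ.+-suc r (b c) ⟨
      r + suc (b c)             ≤⟨ ℕₚ.+-monoʳ-≤ r (s≤s le) ⟩
      r + suc (u ∸ r + c)       ≡⟨ eq ⟨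
      u + 1 + c                 ∎))
    where
    open ℕₚ.≤-Reasoning
    eq : u + 1 + c ≡ r + suc (u ∸ r + c)
    eq = trans (ℕₚ.+-assoc u 1 c) (trans (cong (_+ suc c) (sym (ℕₚ.m+[n∸m]≡n (ℕₚ.<⇒≤ r<u))))
      (trans (ℕₚ.+-assoc r (u ∸ r) (suc c)) (cong (_+_ r) (ℕₚ.+-suc (u ∸ r) c))))

  -- With t = u - r and i = t + c, the left bound μ_r ≤ c says `a r ≤ i`, that is t ≤ A_i, and the
  -- right bound c < λ_r says `b c ≤ i`, that is c < B_i. Hence the description of the cells by i -
  -- B_i < t ≤ A_i.
  ∈-cells : ∀ r c → (r , c) ∈ cells ⇔ IsCell r c
  ∈-cells r c = mk⇔ fwd bwd
    where
    mem = ∈-skewCells λ⟨ S ⟩ μ⟨ S ⟩ r c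
    fwd : (r , c) ∈ cells → IsCell r c
    fwd p∈ with to mem p∈
    ... | μ≤c , c<λ with to (partAt-λ r c) c<λ
    ... | c<v , r<ν = r<u , to (a-threshold r _ r<u)
      (ℕₚ.≤-trans (ℕₚ.m≤n+m∸n (a r) (u ∸ r)) (ℕₚ.+-monoʳ-≤ (u ∸ r) (subst (_≤ c) (partAt-μ r r<u) μ≤c))) ,
        to (b-threshold c _) (c<v , to (r<ν⇔ r c r<u) r<ν)
      where
      -- Since `b c` exceeds `c`, each part `ν c` is at most `u`, so the shape has at most `u` rows.
      r<u : r < u
      r<u = ℕₚ.<-≤-trans r<ν (ℕₚ.≤-trans (ℕₚ.∸-monoʳ-≤ (u + 1 + c) (k<b c c<v))
        (ℕₚ.≤-reflexive (trans (cong (_∸ suc c) (ℕₚ.+-assoc u 1 c)) (ℕₚ.m+n∸n≡m u (suc c)))))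
    bwd : IsCell r c → (r , c) ∈ cells
    bwd (r<u , t≤A , c<B) with from (b-threshold c _) c<B
    ... | c<v , b≤ = from mem (
      subst (_≤ c) (sym (partAt-μ r r<u)) (ℕₚ.m≤n+o⇒m∸n≤o (a r) (u ∸ r) (from (a-threshold r _ r<u) t≤A)) ,
      from (partAt-λ r c) (c<v , from (r<ν⇔ r c r<u) b≤))

  cells-unique : Unique cells
  cells-unique = AllPairs.map (λ { (inj₁ lt) refl → ℕₚ.<-irrefl refl lt ; (inj₂ (_ , lt)) refl →
    ℕₚ.<-irrefl refl lt })
    (skewCells-sorted λ⟨ S ⟩ μ⟨ S ⟩)

-- Standard Young tableaux

≡ᵇ-true⁻ : ∀ {m n} → (m ≡ᵇ n) ≡ true → m ≡ n
≡ᵇ-true⁻ {m} {n} eq = ℕₚ.≡ᵇ⇒≡ m n (from T-≡ eq)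

≡ᵇ-true⁺ : ∀ {m n} → m ≡ n → (m ≡ᵇ n) ≡ true
≡ᵇ-true⁺ {m} {n} eq = to T-≡ (ℕₚ.≡⇒≡ᵇ m n eq)

not-true⁻ : ∀ {b} → not b ≡ true → b ≢ true
not-true⁻ {false} _ ()

not-true⁺ : ∀ {b} → b ≢ true → not b ≡ true
not-true⁺ {false} _ = refl
not-true⁺ {true}  h = contradiction refl h

pairwiseDistinct⇒unique : ∀ xs → pairwiseDistinct xs ≡ true → Unique xs
pairwiseDistinct⇒unique []       _  = []
pairwiseDistinct⇒unique (x ∷ xs) eq with ∧-true⁻ {all (λ y → not (x ≡ᵇ y)) xs} eq
... | h , t = All.tabulate (λ {y} y∈ e → not-true⁻ (all⁻ (λ y → not (x ≡ᵇ y)) xs h y∈) (≡ᵇ-true⁺ e)) ∷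
  pairwiseDistinct⇒unique xs t

unique⇒pairwiseDistinct : ∀ {xs} → Unique xs → pairwiseDistinct xs ≡ true
unique⇒pairwiseDistinct []       = refl
unique⇒pairwiseDistinct {x ∷ xs} (x∉ ∷ xs!) =
  ∧-true⁺ (all⁺ (λ y → not (x ≡ᵇ y)) xs (λ y∈ → not-true⁺ (λ e → All.lookup x∉ y∈ (≡ᵇ-true⁻ e))))
    (unique⇒pairwiseDistinct xs!)

isStandard⇔ : ∀ cs vs → isStandard cs vs ≡ true ⇔
  (Unique vs × (∀ p a q b → (p , a) ∈ zip cs vs → (q , b) ∈ zip cs vs → rightOrBelow p q ≡ true → a < b))
isStandard⇔ cs vs = mk⇔
  (λ eq → let (d , o) = ∧-true⁻ {pairwiseDistinct vs} eq in pairwiseDistinct⇒unique vs d ,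
    λ p a q b p∈ q∈ rel → order rel (all⁻ _ (zip cs vs) (all⁻ _ (zip cs vs) o p∈) q∈))
  (λ (d , o) → ∧-true⁺ (unique⇒pairwiseDistinct d)
    (all⁺ _ (zip cs vs) (λ {(p , a)} p∈ → all⁺ _ (zip cs vs) (λ {(q , b)} q∈ → order⁻ (o p a q b p∈ q∈)))))
  where
  order : ∀ {r a b} → r ≡ true → not r ∨ (a <ᵇ b) ≡ true → a < b
  order refl e = <ᵇ-true⁻ e
  order⁻ : ∀ {r a b} → (r ≡ true → a < b) → not r ∨ (a <ᵇ b) ≡ true
  order⁻ {false} _ = refl
  order⁻ {true}  h = <ᵇ-true⁺ (h refl)

_≟ᶜ_ : (p q : ℕ × ℕ) → Dec (p ≡ q)
_≟ᶜ_ = Productₚ.≡-dec ℕₚ._≟_ ℕₚ._≟_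

assoc : List ((ℕ × ℕ) × ℕ) → ℕ × ℕ → ℕ
assoc []             p = 0
assoc ((q , a) ∷ xs) p = if does (p ≟ᶜ q) then a else assoc xs p

assoc-here : ∀ p a xs → assoc ((p , a) ∷ xs) p ≡ a
assoc-here p a xs = cong (λ b → if b then a else assoc xs p) (dec-true (p ≟ᶜ p) refl)

assoc-there : ∀ {p q} a xs → p ≢ q → assoc ((q , a) ∷ xs) p ≡ assoc xs p
assoc-there {p} {q} a xs p≢q = cong (λ b → if b then a else assoc xs p) (dec-false (p ≟ᶜ q) p≢q)

zip-fst : ∀ {A B : Set} {p : A} {a : B} cs vs → (p , a) ∈ zip cs vs → p ∈ cs × a ∈ vs
zip-fst (c ∷ cs) (v ∷ vs) (here refl) = here refl , here refl
zip-fst (c ∷ cs) (v ∷ vs) (there p∈) with zip-fst cs vs p∈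
... | p , a = there p , there a

map-assoc : ∀ {cs} → Unique cs → ∀ vs → length cs ≡ length vs → map (assoc (zip cs vs)) cs ≡ vs
map-assoc []         []       _   = refl
map-assoc {c ∷ cs} (c∉ ∷ cs!) (v ∷ vs) len = cong₂ _∷_ (assoc-here c v (zip cs vs))
  (trans (Listₚ.map-cong-local (All.map (λ c≢p → assoc-there v (zip cs vs) (λ e → c≢p (sym e))) c∉))
    (map-assoc cs! vs (ℕₚ.suc-injective len)))

zip-map : ∀ {A B : Set} (f : A → B) cs → zip cs (map f cs) ≡ map (λ p → p , f p) cs
zip-map f []       = refl
zip-map f (c ∷ cs) = cong ((c , f c) ∷_) (zip-map f cs)

map-unique : ∀ {A B : Set} (f : A → B) {xs} → Unique xs → (∀ {x y} → x ∈ xs → y ∈ xs → f x ≡ f y → x ≡ y) →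
  Unique (map f xs)
map-unique f []         _   = []
map-unique f (x∉ ∷ xs!) inj = Allₚ.map⁺ (All.tabulate (λ y∈ e → All.lookup x∉ y∈ (inj (here refl) (there y∈) e))) ∷
  map-unique f xs! (λ p q → inj (there p) (there q))

unique-map-injective : ∀ {A B : Set} (f : A → B) {xs} → Unique (map f xs) → ∀ {x y} → x ∈ xs → y ∈ xs → f x ≡ f y →
  x ≡ y
unique-map-injective f (_ ∷ _)   (here refl) (here refl) _ = refl
unique-map-injective f (x∉ ∷ _)  (here refl) (there y∈)  e = contradiction e (All.lookup x∉ (∈-map⁺ f y∈))
unique-map-injective f (x∉ ∷ _)  (there x∈)  (here refl) e = contradiction (sym e) (All.lookup x∉ (∈-map⁺ f x∈))
unique-map-injective f (_ ∷ xs!) (there x∈)  (there y∈)  e = unique-map-injective f xs! x∈ y∈ e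

map-≡⁻ : ∀ {A B : Set} {f g : A → B} {xs} → map f xs ≡ map g xs → ∀ {x} → x ∈ xs → f x ≡ g x
map-≡⁻ eq (here refl) = Listₚ.∷-injectiveˡ eq
map-≡⁻ eq (there x∈)  = map-≡⁻ (Listₚ.∷-injectiveʳ eq) x∈

length-blocks : ∀ (g : ℕ → List ℕ) k → length (blocks g k) ≡ Σ< k (length ∘ g)
length-blocks g k = go g (λ r → r) k
  where
  go : ∀ (g : ℕ → List ℕ) (f : ℕ → ℕ) k → length (concat (applyUpTo (λ r → map (f r ,_) (g r)) k)) ≡ Σ< k (length ∘ g)
  go g f zero    = refl
  go g f (suc k) = trans (Listₚ.length-++ (map (f 0 ,_) (g 0))) (cong₂ _+_ (Listₚ.length-map (f 0 ,_) (g 0))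
    (go (g ∘ suc) (f ∘ suc) k))

module Tableaux {n : ℕ} {α β : ℕ → ℕ} (profile : Profile n (acc α) (acc β)) (u : ℕ) (A≤u : ∀ i → acc α i ≤ u)
  (cells : List (ℕ × ℕ)) (cells-unique : Unique cells)
  (∈-cells : ∀ r c → (r , c) ∈ cells ⇔ (r < u × u ∸ r ≤ acc α (u ∸ r + c) × c < acc β (u ∸ r + c))) where

  A B : ℕ → ℕ
  A = acc α
  B = acc β

  D : ℕ
  D = area n α β

  open Flows profile D
  open TrapezoidFlow profile using (flowOf; flowOf-flow; flowOf-single; flowOf-injective)
  open FlowTrapezoid profile using (trapezoidOf; trapezoidOf-∈; trapezoidOf-injective)

  -- The coordinates `t` and `i` of `Cell`, with `cellOf` going back.
  rowOf levelOf : ℕ × ℕ → ℕ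
  rowOf   (r , c) = u ∸ r
  levelOf (r , c) = u ∸ r + c

  cellOf : ℕ → ℕ → ℕ × ℕ
  cellOf i t = u ∸ t , i ∸ t

  cell-t≤u : ∀ {i t} → Cell i t → t ≤ u
  cell-t≤u {i} (_ , t≤A , _) = ℕₚ.≤-trans t≤A (A≤u i)

  cell-t≤i : ∀ {i t} → Cell i t → t ≤ i
  cell-t≤i {i} (_ , t≤A , _) = ℕₚ.≤-trans t≤A (A≤ i)

  rowOf-cellOf : ∀ {i t} → Cell i t → rowOf (cellOf i t) ≡ t
  rowOf-cellOf c = ℕₚ.m∸[m∸n]≡n (cell-t≤u c)

  levelOf-cellOf : ∀ {i t} → Cell i t → levelOf (cellOf i t) ≡ i
  levelOf-cellOf {i} {t} c = trans (cong (_+ (i ∸ t)) (rowOf-cellOf c)) (ℕₚ.m+[n∸m]≡n (cell-t≤i c))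

  cellOf-∈ : ∀ {i t} → Cell i t → cellOf i t ∈ cells
  cellOf-∈ {i} {t} c@(1≤t , t≤A , i<) = from (∈-cells (u ∸ t) (i ∸ t))
    (ℕₚ.∸-monoʳ-< 1≤t (cell-t≤u c) ,
     subst₂ (λ t i → t ≤ A i) (sym (rowOf-cellOf c)) (sym (levelOf-cellOf c)) t≤A ,
     subst (λ i′ → i ∸ t < B i′) (sym (levelOf-cellOf c))
       (ℕₚ.+-cancelʳ-< t _ _ (subst (_< B i + t) (sym (ℕₚ.m∸n+n≡m (cell-t≤i c))) i<)))

  ∈-cells⇒cell : ∀ {p} → p ∈ cells → Cell (levelOf p) (rowOf p)
  ∈-cells⇒cell {r , c} p∈ with to (∈-cells r c) p∈
  ... | r<u , t≤A , c<B = ℕₚ.m<n⇒0<n∸m r<u , t≤A , subst (_< B (u ∸ r + c) + (u ∸ r)) (ℕₚ.+-comm c (u ∸ r))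
    (ℕₚ.+-monoˡ-< (u ∸ r) c<B)

  ∈-cells⇒< : ∀ {r c} → (r , c) ∈ cells → r < u
  ∈-cells⇒< {r} {c} p∈ = proj₁ (to (∈-cells r c) p∈)

  coordinates-injective : ∀ {p q} → p ∈ cells → q ∈ cells → levelOf p ≡ levelOf q → rowOf p ≡ rowOf q → p ≡ q
  coordinates-injective {r , c} {r′ , c′} p∈ q∈ eqi eqt = cong₂ _,_
    (ℕₚ.∸-cancelˡ-≡ (ℕₚ.<⇒≤ (∈-cells⇒< p∈)) (ℕₚ.<⇒≤ (∈-cells⇒< q∈)) eqt)
    (ℕₚ.+-cancelˡ-≡ (u ∸ r) c c′ (trans eqi (cong (_+ c′) (sym eqt))))

  cellOf-injective : ∀ {i t j s} → Cell i t → Cell j s → cellOf i t ≡ cellOf j s → i ≡ j × t ≡ s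
  cellOf-injective c c′ eq = trans (sym (levelOf-cellOf c)) (trans (cong levelOf eq) (levelOf-cellOf c′)) ,
    trans (sym (rowOf-cellOf c)) (trans (cong rowOf eq) (rowOf-cellOf c′))

  -- A model of the shape that has `D` elements by construction: level `i` holds the rows t with i -
  -- B_i < t ≤ A_i, which number A_i + B_i - i. `toLevel` counts them downwards from A_i.
  levels : List (ℕ × ℕ)
  levels = blocks (λ i → upTo (A i + B i ∸ i)) (suc n)

  length-levels : length levels ≡ D
  length-levels = trans (length-blocks (λ i → upTo (A i + B i ∸ i)) (suc n))
    (Σ<-cong (suc n) {length ∘ (λ i → upTo (A i + B i ∸ i))} (λ i _ → Listₚ.length-upTo (A i + B i ∸ i)))

  levels-unique : Unique levels
  levels-unique = AllPairs.map (λ { (inj₁ lt) refl → ℕₚ.<-irrefl refl lt ; (inj₂ (_ , lt)) refl →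
    ℕₚ.<-irrefl refl lt })
    (blocks-sorted (λ i → upTo (A i + B i ∸ i)) (suc n) (λ i → AllPairsₚ.applyUpTo⁺₁ id _ (λ i<j _ → i<j)))

  toLevel : ℕ × ℕ → ℕ × ℕ
  toLevel p = levelOf p , A (levelOf p) ∸ rowOf p

  fromLevel : ℕ × ℕ → ℕ × ℕ
  fromLevel (i , j) = cellOf i (A i ∸ j)

  toLevel-∈ : ∀ {p} → p ∈ cells → toLevel p ∈ levels
  toLevel-∈ {p} p∈ with ∈-cells⇒cell p∈
  ... | c@(_ , t≤A , i<) = ∈-blocks⁺ (λ i → upTo (A i + B i ∸ i)) (suc n) (ℕₚ.m≤n⇒m≤1+n (cell<n c))
    (∈-upTo⁺ (ℕₚ.m+n≤o⇒m≤o∸n (suc (A i ∸ t)) (begin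
      suc (A i ∸ t) + i           ≡⟨ ℕₚ.+-suc (A i ∸ t) i ⟨
      (A i ∸ t) + suc i           ≤⟨ ℕₚ.+-monoʳ-≤ (A i ∸ t) i< ⟩
      (A i ∸ t) + (B i + t)       ≡⟨ solve 3 (λ a b t → a :+ (b :+ t) := (a :+ t) :+ b) refl (A i ∸ t) (B i) t ⟩
      (A i ∸ t) + t + B i         ≡⟨ cong (_+ B i) (ℕₚ.m∸n+n≡m t≤A) ⟩
      A i + B i                   ∎)))
    where
    i = levelOf p
    t = rowOf p
    open ℕₚ.≤-Reasoning
    open Data.Nat.Solver.+-*-Solver

  toLevel-injective : ∀ {p q} → p ∈ cells → q ∈ cells → toLevel p ≡ toLevel q → p ≡ q
  toLevel-injective {p} {q} p∈ q∈ eq = coordinates-injective p∈ q∈ eqi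
    (ℕₚ.∸-cancelˡ-≡ (proj₁ (proj₂ (∈-cells⇒cell p∈)))
      (subst (λ i → rowOf q ≤ A i) (sym eqi) (proj₁ (proj₂ (∈-cells⇒cell q∈))))
      (trans (cong proj₂ eq) (cong (λ i → A i ∸ rowOf q) (sym eqi))))
    where
    eqi : levelOf p ≡ levelOf q
    eqi = cong proj₁ eq

  level-cell : ∀ {i j} → (i , j) ∈ levels → j < A i × Cell i (A i ∸ j)
  level-cell {i} {j} p∈ with ∈-blocks⁻ (λ i → upTo (A i + B i ∸ i)) (suc n) p∈
  ... | i<sn , j∈ = j<A , ℕₚ.m<n⇒0<n∸m j<A , ℕₚ.m∸n≤m (A i) j ,
      ℕₚ.+-cancelʳ-< j i _ (begin
        suc (i + j)               ≡⟨ cong suc (ℕₚ.+-comm i j) ⟩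
        suc j + i                 ≤⟨ ℕₚ.m≤o∸n⇒m+n≤o (suc j) (Profile.catalan profile i (ℕₚ.≤-pred i<sn)) j< ⟩
        A i + B i                 ≡⟨ ℕₚ.+-comm (A i) (B i) ⟩
        B i + A i                 ≡⟨ cong (_+_ (B i)) (ℕₚ.m∸n+n≡m (ℕₚ.<⇒≤ j<A)) ⟨
        B i + ((A i ∸ j) + j)     ≡⟨ ℕₚ.+-assoc (B i) (A i ∸ j) j ⟨
        (B i + (A i ∸ j)) + j     ∎)
    where
    open ℕₚ.≤-Reasoning
    j< : j < A i + B i ∸ i
    j< = ∈-upTo⁻ j∈
    j<A : j < A i
    j<A = ℕₚ.<-≤-trans j< (ℕₚ.m≤n+o⇒m∸n≤o (A i + B i) i (ℕₚ.≤-trans (ℕₚ.≤-reflexive (ℕₚ.+-comm (A i) (B i)))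
      (ℕₚ.+-monoˡ-≤ (A i) (B≤ i))))

  fromLevel-injective : ∀ {p q} → p ∈ levels → q ∈ levels → fromLevel p ≡ fromLevel q → p ≡ q
  fromLevel-injective {i , j} {i′ , j′} p∈ q∈ eq with level-cell p∈ | level-cell q∈
  ... | j<A , c | j′<A , c′ with cellOf-injective c c′ eq
  ... | refl , eqt = cong (i ,_) (ℕₚ.∸-cancelˡ-≡ (ℕₚ.<⇒≤ j<A) (ℕₚ.<⇒≤ j′<A) eqt)

  length-cells : length cells ≡ D
  length-cells = trans (length-≡-injections toLevel fromLevel cells-unique levels-unique toLevel-∈ toLevel-injective
    (λ p∈ → cellOf-∈ (proj₂ (level-cell p∈))) fromLevel-injective) length-levels

  N : ℕ
  N = length cells

  tableaux : List (Vec ℕ N)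
  tableaux = filterᵇ (λ v → isStandard cells (Vec.toList v)) (vecsOver (map suc (upTo N)) N)

  alphabet-unique : Unique (map suc (upTo N))
  alphabet-unique = Uniqueₚ.map⁺ ℕₚ.suc-injective (Uniqueₚ.upTo⁺ N)

  tableaux-unique : Unique tableaux
  tableaux-unique = Uniqueₚ.filter⁺ _ (vecsOver-unique alphabet-unique N)

  ∈-alphabet⁻ : ∀ {a} → a ∈ map suc (upTo N) → 1 ≤ a × a ≤ N
  ∈-alphabet⁻ a∈ with ∈-map⁻ suc a∈
  ... | k , k∈ , refl = s≤s z≤n , ∈-upTo⁻ k∈

  ∈-alphabet⁺ : ∀ {a} → 1 ≤ a → a ≤ N → a ∈ map suc (upTo N)
  ∈-alphabet⁺ {suc a} _ a≤N = ∈-map⁺ suc (∈-upTo⁺ a≤N)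

  fillingOf : (ℕ → ℕ → ℕ) → Vec ℕ N
  fillingOf V = Vec.map (λ p → V (levelOf p) (rowOf p)) (Vec.fromList cells)

  toList-fillingOf : ∀ V → Vec.toList (fillingOf V) ≡ map (λ p → V (levelOf p) (rowOf p)) cells
  toList-fillingOf V = trans (Vecₚ.toList-map _ (Vec.fromList cells)) (cong (map _) (Vecₚ.toList∘fromList cells))

  fillingOf-∈ : ∀ {V} → Standard V → fillingOf V ∈ tableaux
  fillingOf-∈ {V} std = ∈-filter⁺ _
    (∈-vecsOver⁺ (fillingOf V) (lookup-all (fillingOf V) (subst (All (_∈ map suc (upTo N))) (sym (toList-fillingOf V))
      (Allₚ.map⁺ (All.tabulate (λ {p} p∈ → let (lo , hi) = range _ _ (∈-cells⇒cell p∈) in ∈-alphabet⁺ lo (subst (V (levelOf p) (rowOf p) ≤_) (sym length-cells) hi)))))))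
    (from T-≡ (subst (λ vs → isStandard cells vs ≡ true) (sym (toList-fillingOf V))
      (from (isStandard⇔ cells (map f cells)) (distinct′ , ordered))))
    where
    open Standard std
    f : ℕ × ℕ → ℕ
    f p = V (levelOf p) (rowOf p)
    distinct′ : Unique (map f cells)
    distinct′ = map-unique f cells-unique (λ p∈ q∈ e →
      let (eqi , eqt) = distinct _ _ _ _ (∈-cells⇒cell p∈) (∈-cells⇒cell q∈) e in coordinates-injective p∈ q∈ eqi eqt)
    related : ∀ p q → p ∈ cells → q ∈ cells → rightOrBelow p q ≡ true → f p < f q
    related (r , c) (r′ , c′) p∈ q∈ rel with ∨-true⁻ {(r ≡ᵇ r′) ∧ (suc c ≡ᵇ c′)} rel
    ... | inj₁ e with ≡ᵇ-true⁻ {r} {r′} (proj₁ (∧-true⁻ e)) | ≡ᵇ-true⁻ {suc c} {c′} (proj₂ (∧-true⁻ {r ≡ᵇ r′} e))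
    ... | refl | refl = subst (λ i → f (r , c) < V i (u ∸ r)) (sym (ℕₚ.+-suc (u ∸ r) c))
          (rowwise _ _ (∈-cells⇒cell p∈) (subst (λ i → Cell i (u ∸ r)) (ℕₚ.+-suc (u ∸ r) c) (∈-cells⇒cell q∈)))
    related (r , c) (r′ , c′) p∈ q∈ rel | inj₂ e with ≡ᵇ-true⁻ {suc r} {r′} (proj₁ (∧-true⁻ e)) | ≡ᵇ-true⁻ {c} {c′}
      (proj₂ (∧-true⁻ {suc r ≡ᵇ r′} e))
    -- One row further down, both `t` and the level drop by one, so `colwise` applies.
    ... | refl | refl = subst (λ t → V (t + c) t < V (u ∸ suc r + c) (u ∸ suc r)) (sym t≡)
          (colwise _ _ (subst (λ t → Cell (t + c) t) t≡ (∈-cells⇒cell p∈)) (∈-cells⇒cell q∈))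
      where
      t≡ : u ∸ r ≡ suc (u ∸ suc r)
      t≡ = ℕₚ.+-∸-assoc 1 (∈-cells⇒< p∈)
    ordered : ∀ p a q b → (p , a) ∈ zip cells (map f cells) → (q , b) ∈ zip cells (map f cells) →
      rightOrBelow p q ≡ true → a < b
    ordered p a q b p∈ q∈ rel with ∈-map⁻ (λ p → p , f p) (subst ((p , a) ∈_) (zip-map f cells) p∈) | ∈-map⁻
      (λ p → p , f p) (subst ((q , b) ∈_) (zip-map f cells) q∈)
    ... | _ , p∈′ , refl | _ , q∈′ , refl = related _ _ p∈′ q∈′ rel

  fillingOf-injective : ∀ {V V′} → fillingOf V ≡ fillingOf V′ → ∀ i t → Cell i t → V i t ≡ V′ i t
  fillingOf-injective {V} {V′} eq i t c = subst₂ (λ i t → V i t ≡ V′ i t) (levelOf-cellOf c) (rowOf-cellOf c)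
    (map-≡⁻ lists (cellOf-∈ c))
    where
    lists : map (λ p → V (levelOf p) (rowOf p)) cells ≡ map (λ p → V′ (levelOf p) (rowOf p)) cells
    lists = trans (sym (toList-fillingOf V)) (trans (cong Vec.toList eq) (toList-fillingOf V′))

  -- What `assoc` returns off the shape has no effect: `remaining` only looks at rows up to A_i, and
  -- those among them that are not cells lie on the floor and count anyway.
  valuesOf : Vec ℕ N → ℕ → ℕ → ℕ
  valuesOf v i t = assoc (zip cells (Vec.toList v)) (cellOf i t)

  module _ {v : Vec ℕ N} (v∈ : v ∈ tableaux) where
    vs : List ℕ
    vs = Vec.toList v

    g : ℕ × ℕ → ℕ
    g = assoc (zip cells vs)

    map-g : map g cells ≡ vs
    map-g = map-assoc cells-unique vs (sym (Vecₚ.length-toList v))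

    zip-g : zip cells vs ≡ map (λ p → p , g p) cells
    zip-g = trans (cong (zip cells) (sym map-g)) (zip-map g cells)

    vs∈ : All (_∈ map suc (upTo N)) vs
    vs∈ = all-toList v (∈-vecsOver⁻ (proj₁ (∈-filter⁻ _ {xs = vecsOver (map suc (upTo N)) N} v∈)))

    standard-vs : Unique vs × (∀ p a q b → (p , a) ∈ zip cells vs → (q , b) ∈ zip cells vs → rightOrBelow p q ≡ true →
      a < b)
    standard-vs = to (isStandard⇔ cells vs) (to T-≡ (proj₂ (∈-filter⁻ _ {xs = vecsOver (map suc (upTo N)) N} v∈)))

    g-order : ∀ {p q} → p ∈ cells → q ∈ cells → rightOrBelow p q ≡ true → g p < g q
    g-order p∈ q∈ = proj₂ standard-vs _ _ _ _ (pair p∈) (pair q∈)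
      where
      pair : ∀ {p} → p ∈ cells → (p , g p) ∈ zip cells vs
      pair {p} p∈ = subst ((p , g p) ∈_) (sym zip-g) (∈-map⁺ (λ p → p , g p) p∈)

    valuesOf-standard : Standard (valuesOf v)
    valuesOf-standard = record
      { range    = λ i t c → let (lo , hi) = ∈-alphabet⁻ (All.lookup vs∈ (subst (g (cellOf i t) ∈_) map-g (∈-map⁺ g (cellOf-∈ c)))) in lo , subst (valuesOf v i t ≤_) length-cells hi
      ; rowwise  = λ i t c c′ → g-order (cellOf-∈ c) (cellOf-∈ c′)
        (∨-true⁺ (inj₁ (∧-true⁺ (≡ᵇ-true⁺ {u ∸ t} refl) (≡ᵇ-true⁺ (sym (ℕₚ.+-∸-assoc 1 (cell-t≤i c)))))))
      ; colwise  = λ i t c c′ → g-order (cellOf-∈ c) (cellOf-∈ c′)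
        (∨-true⁺ {(u ∸ suc t ≡ᵇ u ∸ t) ∧ (suc (i ∸ t) ≡ᵇ i ∸ t)}
                     (inj₂ (∧-true⁺ (≡ᵇ-true⁺ (sym (ℕₚ.+-∸-assoc 1 (cell-t≤u c)))) (≡ᵇ-true⁺ {i ∸ t} refl))))
      ; distinct = λ i t j s c c′ e →
        cellOf-injective c c′ (unique-map-injective g (subst Unique (sym map-g) (proj₁ standard-vs)) (cellOf-∈ c)
          (cellOf-∈ c′) e)
      }

    -- The `N` distinct entries come from an alphabet of `N` letters and exhaust it. This excludes
    -- idle steps in the flow built from the tableau.
    valuesOf-onto : ∀ x → x < D → ¬ (∀ i t → Cell i t → valuesOf v i t ≢ suc x)
    valuesOf-onto x x<D missed = injective⇒surjective id vs (map suc (upTo N)) (proj₁ standard-vs) alphabet-unique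
      (trans (Vecₚ.length-toList v) (sym (trans (Listₚ.length-map suc (upTo N)) (Listₚ.length-upTo N))))
      (All.lookup vs∈) (λ _ _ e → e) {suc x} (∈-alphabet⁺ (s≤s z≤n) (subst (x <_) (sym length-cells) x<D)) absent
      where
      absent : ∀ {a} → a ∈ vs → a ≢ suc x
      absent {a} a∈ with ∈-map⁻ g (subst (a ∈_) (sym map-g) a∈)
      ... | (r , c) , p∈ , refl = λ e → missed _ _ (∈-cells⇒cell p∈)
        (trans (cong g (coordinates-injective (cellOf-∈ (∈-cells⇒cell p∈)) p∈
              (levelOf-cellOf (∈-cells⇒cell p∈)) (rowOf-cellOf (∈-cells⇒cell p∈)))) e)

  valuesOf-injective : ∀ {v w} → (∀ i t → Cell i t → valuesOf v i t ≡ valuesOf w i t) → v ≡ w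
  valuesOf-injective {v} {w} eq = trans (sym (Vecₚ.cast-is-id refl v)) (Vecₚ.toList-injective refl v w (begin
    Vec.toList v                                      ≡⟨ map-assoc cells-unique (Vec.toList v)
      (sym (Vecₚ.length-toList v)) ⟨
    map (assoc (zip cells (Vec.toList v))) cells      ≡⟨ Listₚ.map-cong-local (All.tabulate same) ⟩
    map (assoc (zip cells (Vec.toList w))) cells      ≡⟨ map-assoc cells-unique (Vec.toList w)
      (sym (Vecₚ.length-toList w)) ⟩
    Vec.toList w ∎))
    where
    open ≡-Reasoning
    same : ∀ {p} → p ∈ cells → assoc (zip cells (Vec.toList v)) p ≡ assoc (zip cells (Vec.toList w)) p
    same p∈ = subst (λ p → assoc (zip cells (Vec.toList v)) p ≡ assoc (zip cells (Vec.toList w)) p)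
      (coordinates-injective (cellOf-∈ (∈-cells⇒cell p∈)) p∈ (levelOf-cellOf (∈-cells⇒cell p∈))
        (rowOf-cellOf (∈-cells⇒cell p∈)))
      (eq _ _ (∈-cells⇒cell p∈))

  tight : List (Trapezoid n)
  tight = goodOver n α β (nonzeroColumns n) D

  tight-unique : Unique tight
  tight-unique = goodOver-unique n α β D (nonzeroColumns-unique n)

  record IsTight (C L R : List (Vec ℤ n)) : Set where
    field
      good : Good α β (C , L , R)
      lenL : length L ≡ n
      lenR : length R ≡ n
      C≢0  : All (_≢ zeroColumn n) C
      lenC : length C ≡ D

  ∈-tight⁻ : ∀ {C L R} → (C , L , R) ∈ tight → IsTight C L R
  ∈-tight⁻ {C} {L} {R} t∈ with ∈-goodOver⁻ {n} {α} {β} {nonzeroColumns n} {D} {C} {L} {R} t∈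
  ... | good , (lenC , C∈) , (lenL , _) , (lenR , _) = record
    { good = good ; lenL = lenL ; lenR = lenR ; lenC = lenC
    ; C≢0 = All.map (λ x∈ → proj₂ (∈-filter⁻ nonzero? {xs = columnsOver n} x∈)) C∈ }

  toTableau : Trapezoid n → Vec ℕ N
  toTableau t = fillingOf (value (flowOf t))

  tight-flow : ∀ {t} → t ∈ tight → Flow (flowOf t) × SingleFall (flowOf t)
  tight-flow {C , L , R} t∈ = flowOf-flow {L = L} {R} good lenL lenR C≢0 lenC , flowOf-single {L = L} {R} good lenL
    lenR C≢0 lenC
    where open IsTight (∈-tight⁻ {C} {L} {R} t∈)

  toTableau-∈ : ∀ {t} → t ∈ tight → toTableau t ∈ tableaux
  toTableau-∈ t∈ = fillingOf-∈ (value-standard (proj₁ (tight-flow t∈)) (proj₂ (tight-flow t∈)))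

  toTableau-injective : ∀ {t t′} → t ∈ tight → t′ ∈ tight → toTableau t ≡ toTableau t′ → t ≡ t′
  toTableau-injective {C , L , R} {C′ , L′ , R′} t∈ t′∈ eq =
    flowOf-injective T.good T.lenL T.lenR T.C≢0 T.lenC T′.good T′.lenL T′.lenR T′.C≢0 T′.lenC
      (flow-ext (proj₁ (tight-flow t∈)) (proj₁ (tight-flow t′∈)) (fillingOf-injective eq))
    where
    module T  = IsTight (∈-tight⁻ {C} {L} {R} t∈)
    module T′ = IsTight (∈-tight⁻ {C′} {L′} {R′} t′∈)

  fromTableau : Vec ℕ N → Trapezoid n
  fromTableau v = trapezoidOf (remaining (valuesOf v))

  fromTableau-∈ : ∀ {v} → v ∈ tableaux → fromTableau v ∈ tight
  fromTableau-∈ v∈ = trapezoidOf-∈ (remaining-flow (valuesOf-standard v∈))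
    (λ x x<D same → valuesOf-onto v∈ x x<D (remaining-moves (valuesOf-standard v∈) x same))

  fromTableau-injective : ∀ {v w} → v ∈ tableaux → w ∈ tableaux → fromTableau v ≡ fromTableau w → v ≡ w
  fromTableau-injective v∈ w∈ eq = valuesOf-injective (standard-ext (valuesOf-standard v∈) (valuesOf-standard w∈)
    (trapezoidOf-injective (remaining-flow (valuesOf-standard v∈)) (remaining-flow (valuesOf-standard w∈)) eq))

  reduced≡tableaux : reduced n α β D ≡ length tableaux
  reduced≡tableaux = length-≡-injections toTableau fromTableau tight-unique tableaux-unique
    toTableau-∈ toTableau-injective fromTableau-∈ fromTableau-injective

-- Polynomials in the binomial basis

fromℚᵘ-+ : ∀ p q → fromℚᵘ p ℚ.+ fromℚᵘ q ≡ fromℚᵘ (p ℚᵘ.+ q)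
fromℚᵘ-+ p q = ℚₚ.toℚᵘ-injective (ℚᵘₚ.≃-trans (ℚₚ.toℚᵘ-homo-+ (fromℚᵘ p) (fromℚᵘ q))
  (ℚᵘₚ.≃-trans (ℚᵘₚ.+-cong (ℚₚ.toℚᵘ-fromℚᵘ p) (ℚₚ.toℚᵘ-fromℚᵘ q)) (ℚᵘₚ.≃-sym (ℚₚ.toℚᵘ-fromℚᵘ (p ℚᵘ.+ q)))))

fromℚᵘ-* : ∀ p q → fromℚᵘ p ℚ.* fromℚᵘ q ≡ fromℚᵘ (p ℚᵘ.* q)
fromℚᵘ-* p q = ℚₚ.toℚᵘ-injective (ℚᵘₚ.≃-trans (ℚₚ.toℚᵘ-homo-* (fromℚᵘ p) (fromℚᵘ q))
  (ℚᵘₚ.≃-trans (ℚᵘₚ.*-cong (ℚₚ.toℚᵘ-fromℚᵘ p) (ℚₚ.toℚᵘ-fromℚᵘ q)) (ℚᵘₚ.≃-sym (ℚₚ.toℚᵘ-fromℚᵘ (p ℚᵘ.* q)))))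

half-+ : ∀ a b → (a / 2) ℚ.+ (b / 2) ≡ (a ℤ.+ b) / 2
half-+ a b = trans (fromℚᵘ-+ (mkℚᵘ a 1) (mkℚᵘ b 1)) (ℚₚ.fromℚᵘ-cong {mkℚᵘ a 1 ℚᵘ.+ mkℚᵘ b 1} {mkℚᵘ (a ℤ.+ b) 1}
  (*≡* (solve 2 (λ a b → (a :* con (+ 2) :+ b :* con (+ 2)) :* con (+ 2) := (a :+ b) :* con (+ 4)) refl a b)))
  where open Data.Integer.Solver.+-*-Solver

double-half : ∀ a → (a ℤ.+ a) / 2 ≡ a / 1
double-half a = ℚₚ.fromℚᵘ-cong {mkℚᵘ (a ℤ.+ a) 1} {mkℚᵘ a 0}
  (*≡* (solve 1 (λ a → (a :+ a) :* con (+ 1) := a :* con (+ 2)) refl a))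
  where open Data.Integer.Solver.+-*-Solver

ι : ℕ → ℚ
ι k = + k / 1

ι-+ : ∀ a b → ι a ℚ.+ ι b ≡ ι (a + b)
ι-+ a b = trans (fromℚᵘ-+ (mkℚᵘ (+ a) 0) (mkℚᵘ (+ b) 0)) (ℚₚ.fromℚᵘ-cong {mkℚᵘ (+ a) 0 ℚᵘ.+ mkℚᵘ (+ b) 0}
  {mkℚᵘ (+ (a + b)) 0}
  (*≡* (trans (solve 2 (λ a b → (a :* con (+ 1) :+ b :* con (+ 1)) :* con (+ 1) := (a :+ b) :* con (+ 1)) refl (+ a)
    (+ b)) (cong (ℤ._* + 1) (sym (ℤₚ.pos-+ a b))))))
  where open Data.Integer.Solver.+-*-Solver

ι-* : ∀ a b → ι a ℚ.* ι b ≡ ι (a * b)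
ι-* a b = trans (fromℚᵘ-* (mkℚᵘ (+ a) 0) (mkℚᵘ (+ b) 0)) (ℚₚ.fromℚᵘ-cong {mkℚᵘ (+ a) 0 ℚᵘ.* mkℚᵘ (+ b) 0}
  {mkℚᵘ (+ (a * b)) 0}
  (*≡* (cong (ℤ._* + 1) (sym (ℤₚ.pos-* a b)))))

fraction-* : ∀ f d .{{_ : NonZero d}} → (+ f / d) ℚ.* ι d ≡ ι f
fraction-* f (suc d) = trans (fromℚᵘ-* (mkℚᵘ (+ f) d) (mkℚᵘ (+ suc d) 0))
  (ℚₚ.fromℚᵘ-cong {mkℚᵘ (+ f) d ℚᵘ.* mkℚᵘ (+ suc d) 0} {mkℚᵘ (+ f) 0}
  (*≡* (trans (ℤₚ.*-identityʳ (+ f ℤ.* + suc d)) (cong (λ k → + f ℤ.* + suc k) (sym (ℕₚ.*-identityʳ d))))))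

ι-cancel : ∀ d .{{_ : NonZero d}} {x y} → x ℚ.* ι d ≡ y ℚ.* ι d → x ≡ y
ι-cancel d {x} {y} eq = trans (sym (undo x)) (trans (cong (ℚ._* (+ 1 / d)) eq) (undo y))
  where
  undo : ∀ x → (x ℚ.* ι d) ℚ.* (+ 1 / d) ≡ x
  undo x = trans (ℚₚ.*-assoc x (ι d) (+ 1 / d))
    (trans (cong (ℚ._*_ x) (trans (ℚₚ.*-comm (ι d) (+ 1 / d)) (fraction-* 1 d))) (ℚₚ.*-identityʳ x))

ι-injective-0 : ∀ f → ι f ≡ 0ℚ → f ≡ 0
ι-injective-0 f eq with ℚᵘₚ.≃-trans (ℚᵘₚ.≃-sym (ℚₚ.toℚᵘ-fromℚᵘ (mkℚᵘ (+ f) 0))) (ℚᵘₚ.≃-reflexive (cong ℚ.toℚᵘ eq))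
... | *≡* e = ℤₚ.+-injective (trans (sym (ℤₚ.*-identityʳ (+ f))) e)

leadingCoeff-* : ∀ f d → leadingCoeff f d ℚ.* ι (d !) ≡ ι f
leadingCoeff-* f d = fraction-* f (d !) {{d !≢0}}

leadingCoeff≢0 : ∀ f d → 1 ≤ f → leadingCoeff f d ≢ 0ℚ
leadingCoeff≢0 f d 1≤f eq = ℕₚ.<⇒≢ 1≤f
  (sym (ι-injective-0 f (trans (sym (leadingCoeff-* f d)) (trans (cong (ℚ._* ι (d !)) eq) (ℚₚ.*-zeroˡ (ι (d !)))))))

leadingCoeff-scale : ∀ f d → ι f ℚ.* leadingCoeff 1 d ≡ leadingCoeff f d
leadingCoeff-scale f d = ι-cancel (d !) {{d !≢0}} (trans (ℚₚ.*-assoc (ι f) (leadingCoeff 1 d) (ι (d !)))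
  (trans (cong (ℚ._*_ (ι f)) (leadingCoeff-* 1 d)) (trans (ℚₚ.*-identityʳ (ι f)) (sym (leadingCoeff-* f d)))))

leadingCoeff-suc : ∀ d → (+ 1 / suc d) ℚ.* leadingCoeff 1 d ≡ leadingCoeff 1 (suc d)
leadingCoeff-suc d = ι-cancel (suc d !) {{suc d !≢0}} (begin
  (s ℚ.* c) ℚ.* ι (suc d * d !)           ≡⟨ cong (ℚ._*_ (s ℚ.* c)) (sym (ι-* (suc d) (d !))) ⟩
  (s ℚ.* c) ℚ.* (ι (suc d) ℚ.* ι (d !))   ≡⟨ solve 4 (λ s c a b → (s :* c) :* (a :* b) := (s :* a) :* (c :* b)) refl s
    c (ι (suc d)) (ι (d !)) ⟩
  (s ℚ.* ι (suc d)) ℚ.* (c ℚ.* ι (d !))   ≡⟨ cong₂ ℚ._*_ (fraction-* 1 (suc d)) (leadingCoeff-* 1 d) ⟩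
  1ℚ ℚ.* 1ℚ                               ≡⟨ leadingCoeff-* 1 (suc d) ⟨
  leadingCoeff 1 (suc d) ℚ.* ι (suc d !) ∎)
  where
  open ≡-Reasoning
  open Data.Rational.Solver.+-*-Solver
  s c : ℚ
  s = + 1 / suc d
  c = leadingCoeff 1 d

-- f is given on positive integers by a polynomial with k lower coefficients and coefficient c at x^k.
record Polynomial (k : ℕ) (c : ℚ) (f : ℕ → ℚ) : Set where
  constructor polynomial
  field
    lower    : List ℚ
    length-k : length lower ≡ k
    eval     : ∀ l → 1 ≤ l → evalPoly (lower ++ c ∷ []) (ι l) ≡ f l

-- A polynomial of degree below `k`, padded to exactly `k` coefficients so that `zipWith` adds
-- without cutting anything off.
record LowerTerms (k : ℕ) (f : ℕ → ℚ) : Set where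
  constructor lowerTerms
  field
    coeffs   : List ℚ
    length-k : length coeffs ≡ k
    eval     : ∀ l → 1 ≤ l → evalPoly coeffs (ι l) ≡ f l

evalPoly-scale : ∀ s cs x → evalPoly (map (ℚ._*_ s) cs) x ≡ s ℚ.* evalPoly cs x
evalPoly-scale s []       x = sym (ℚₚ.*-zeroʳ s)
evalPoly-scale s (c ∷ cs) x = trans (cong (λ e → s ℚ.* c ℚ.+ x ℚ.* e) (evalPoly-scale s cs x))
  (solve 4 (λ s c x e → s :* c :+ x :* (s :* e) := s :* (c :+ x :* e)) refl s c x (evalPoly cs x))
  where open Data.Rational.Solver.+-*-Solver

evalPoly-add : ∀ cs ds c x → length cs ≡ length ds → evalPoly (zipWith ℚ._+_ cs ds ++ c ∷ []) x ≡ evalPoly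
  (cs ++ c ∷ []) x ℚ.+ evalPoly ds x
evalPoly-add []       []       c x _   = sym (ℚₚ.+-identityʳ _)
evalPoly-add (a ∷ cs) (b ∷ ds) c x len =
  trans (cong (λ e → (a ℚ.+ b) ℚ.+ x ℚ.* e) (evalPoly-add cs ds c x (ℕₚ.suc-injective len)))
  (solve 5 (λ a b x e f → (a :+ b) :+ x :* (e :+ f) := (a :+ x :* e) :+ (b :+ x :* f)) refl a b x
    (evalPoly (cs ++ c ∷ []) x) (evalPoly ds x))
  where open Data.Rational.Solver.+-*-Solver

polynomial-add : ∀ {k c f g} → Polynomial k c f → LowerTerms k g → Polynomial k c (λ l → f l ℚ.+ g l)
polynomial-add {k} {c} (polynomial cs lc ec) (lowerTerms ds ld ed) = polynomial (zipWith ℚ._+_ cs ds)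
  (trans (Listₚ.length-zipWith ℚ._+_ cs ds) (trans (cong₂ _⊓_ lc ld) (ℕₚ.⊓-idem k)))
  (λ l 1≤l → trans (evalPoly-add cs ds c (ι l) (trans lc (sym ld))) (cong₂ ℚ._+_ (ec l 1≤l) (ed l 1≤l)))

polynomial-scale : ∀ {k c f} s → Polynomial k c f → Polynomial k (s ℚ.* c) (λ l → s ℚ.* f l)
polynomial-scale {k} {c} s (polynomial cs lc ec) = polynomial (map (ℚ._*_ s) cs) (trans (Listₚ.length-map _ cs) lc)
  (λ l 1≤l → trans (cong (λ ds → evalPoly ds (ι l)) (sym (Listₚ.map-++ (ℚ._*_ s) cs (c ∷ []))))
    (trans (evalPoly-scale s (cs ++ c ∷ []) (ι l)) (cong (ℚ._*_ s) (ec l 1≤l))))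

polynomial-lower : ∀ {k c f} → Polynomial k c f → LowerTerms (suc k) f
polynomial-lower {k} {c} (polynomial cs lc ec) =
  lowerTerms (cs ++ c ∷ []) (trans (Listₚ.length-++ cs) (trans (cong (_+ 1) lc) (ℕₚ.+-comm k 1))) ec

polynomial-X : ∀ {k c f} → Polynomial k c f → Polynomial (suc k) c (λ l → ι l ℚ.* f l)
polynomial-X (polynomial cs lc ec) = polynomial (0ℚ ∷ cs) (cong suc lc)
  (λ l 1≤l → trans (ℚₚ.+-identityˡ _) (cong (ℚ._*_ (ι l)) (ec l 1≤l)))

polynomial-cong : ∀ {k c f g} → (∀ l → 1 ≤ l → f l ≡ g l) → Polynomial k c f → Polynomial k c g
polynomial-cong eq (polynomial cs lc ec) = polynomial cs lc (λ l 1≤l → trans (ec l 1≤l) (eq l 1≤l))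

-- The rule (k+1) C(m,k+1) = (m-k) C(m,k), with the subtraction moved to the other side to remain in
-- `ℕ`.
absorption : ∀ m k → suc k * (m choose suc k) + k * (m choose k) ≡ m * (m choose k)
absorption zero k = cong₂ _+_ (trans (cong (_*_ (suc k)) (k>n⇒nCk≡0 {0} {suc k} z<s)) (ℕₚ.*-zeroʳ (suc k))) (vanish k)
  where
  vanish : ∀ k → k * (0 choose k) ≡ 0
  vanish zero    = refl
  vanish (suc k) = trans (cong (_*_ (suc k)) (k>n⇒nCk≡0 {0} {suc k} z<s)) (ℕₚ.*-zeroʳ (suc k))
absorption (suc m) zero = trans (ℕₚ.+-identityʳ _)
  (trans (ℕₚ.+-identityʳ _) (trans (nC1≡n (suc m))
    (sym (trans (cong (_*_ (suc m)) (nC0≡1 (suc m))) (ℕₚ.*-identityʳ (suc m))))))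
absorption (suc m) (suc k) = begin
  suc (suc k) * (suc m choose suc (suc k)) + suc k * (suc m choose suc k)
    ≡⟨ cong₂ (λ a b → suc (suc k) * a + suc k * b) (sym (nCk+nC[k+1]≡[n+1]C[k+1] m (suc k)))
      (sym (nCk+nC[k+1]≡[n+1]C[k+1] m k)) ⟩
  suc (suc k) * (c₁ + c₂) + suc k * (c₀ + c₁)
    ≡⟨ solve 4 (λ k a b c → (con 2 :+ k) :* (b :+ c) :+ (con 1 :+ k) :* (a :+ b) :=
                 ((con 2 :+ k) :* c :+ (con 1 :+ k) :* b) :+ ((con 1 :+ k) :* b :+ k :* a) :+ (a :+ b)) refl k c₀ c₁
                   c₂ ⟩
  (suc (suc k) * c₂ + suc k * c₁) + (suc k * c₁ + k * c₀) + (c₀ + c₁)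
    ≡⟨ cong (_+ (c₀ + c₁)) (cong₂ _+_ (absorption m (suc k)) (absorption m k)) ⟩
  m * c₁ + m * c₀ + (c₀ + c₁)
    ≡⟨ solve 3 (λ m a b → m :* b :+ m :* a :+ (a :+ b) := (con 1 :+ m) :* (a :+ b)) refl m c₀ c₁ ⟩
  suc m * (c₀ + c₁) ≡⟨ cong (_*_ (suc m)) (nCk+nC[k+1]≡[n+1]C[k+1] m k) ⟩
  suc m * (suc m choose suc k) ∎
  where
  open ≡-Reasoning
  open Data.Nat.Solver.+-*-Solver
  c₀ c₁ c₂ : ℕ
  c₀ = m choose k
  c₁ = m choose suc k
  c₂ = m choose suc (suc k)

-- In the variable l = m+1 this reads C(l-1,k+1) = (l-(k+1)) C(l-1,k) / (k+1): a linear factor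
-- raises the degree by one and the leading coefficient is divided by k+1, which builds up the
-- factorial.
choose-step : ∀ m k → (+ 1 / suc k) ℚ.* (ι (suc m) ℚ.* ι (m choose k) ℚ.+ (ℚ.- ι (suc k)) ℚ.* ι (m choose k)) ≡ ι
  (m choose suc k)
choose-step m k = ι-cancel (suc k) (begin
  s ℚ.* (ι (suc m) ℚ.* c ℚ.+ (ℚ.- a) ℚ.* c) ℚ.* a
    ≡⟨ solve 4 (λ s x c a → s :* (x :* c :+ (:- a) :* c) :* a := (s :* a) :* (x :* c :- a :* c)) refl s (ι (suc m)) c
      a ⟩
  (s ℚ.* a) ℚ.* (ι (suc m) ℚ.* c ℚ.- a ℚ.* c)
    ≡⟨ trans (cong (ℚ._* (ι (suc m) ℚ.* c ℚ.- a ℚ.* c)) (fraction-* 1 (suc k))) (ℚₚ.*-identityˡ _) ⟩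
  ι (suc m) ℚ.* c ℚ.- a ℚ.* c
    ≡⟨ cong (ℚ._- (a ℚ.* c)) expand ⟩
  (c′ ℚ.* a ℚ.+ a ℚ.* c) ℚ.- a ℚ.* c
    ≡⟨ solve 3 (λ c d a → (d :* a :+ a :* c) :- a :* c := d :* a) refl c c′ a ⟩
  c′ ℚ.* a ∎)
  where
  open ≡-Reasoning
  open Data.Rational.Solver.+-*-Solver
  s a c c′ : ℚ
  s = + 1 / suc k
  a = ι (suc k)
  c = ι (m choose k)
  c′ = ι (m choose suc k)
  natural : suc m * (m choose k) ≡ (m choose suc k) * suc k + suc k * (m choose k)
  natural = trans (cong (_+_ (m choose k)) (sym (absorption m k)))
    (N.solve 3 (λ k b d → b N.:+ ((N.con 1 N.:+ k) N.:* d N.:+ k N.:* b) N.:= d N.:* (N.con 1 N.:+ k) N.:+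
      (N.con 1 N.:+ k) N.:* b) refl k (m choose k) (m choose suc k))
    where module N = Data.Nat.Solver.+-*-Solver
  expand : ι (suc m) ℚ.* c ≡ c′ ℚ.* a ℚ.+ a ℚ.* c
  expand = trans (ι-* (suc m) (m choose k))
    (trans (cong ι natural) (trans (sym (ι-+ ((m choose suc k) * suc k) (suc k * (m choose k))))
    (cong₂ ℚ._+_ (sym (ι-* (m choose suc k) (suc k))) (sym (ι-* (suc k) (m choose k))))))

binomial-polynomial : ∀ k → Polynomial k (leadingCoeff 1 k) (λ l → ι ((l ∸ 1) choose k))
binomial-polynomial zero    = polynomial [] refl (λ l _ → trans (cong (ℚ._+_ (leadingCoeff 1 0)) (ℚₚ.*-zeroʳ (ι l)))
  (cong ι (sym (nC0≡1 (l ∸ 1)))))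
binomial-polynomial (suc k) = subst (λ c → Polynomial (suc k) c (λ l → ι ((l ∸ 1) choose suc k))) (leadingCoeff-suc k)
  (polynomial-cong (λ { (suc m) _ → choose-step m k })
    (polynomial-scale (+ 1 / suc k)
      (polynomial-add (polynomial-X b) (polynomial-lower (polynomial-scale (ℚ.- ι (suc k)) b)))))
  where b = binomial-polynomial k

Σ<-last : ∀ k (f : ℕ → ℕ) → Σ< (suc k) f ≡ Σ< k f + f k
Σ<-last zero    f = ℕₚ.+-identityʳ (f 0)
Σ<-last (suc k) f = trans (cong (_+_ (f 0)) (Σ<-last k (f ∘ suc))) (sym (ℕₚ.+-assoc (f 0) _ _))

-- Only the last binomial reaches degree `k`, and it contributes `N k` times 1/k!; all earlier terms
-- are lower ones.
newton-step : ∀ (N : ℕ → ℕ) k → LowerTerms k (λ l → ι (Σ< k (λ i → ((l ∸ 1) choose i) * N i))) →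
  Polynomial k (leadingCoeff (N k) k) (λ l → ι (Σ< (suc k) (λ i → ((l ∸ 1) choose i) * N i)))
newton-step N k low = subst (λ c → Polynomial k c (λ l → ι (Σ< (suc k) (λ i → ((l ∸ 1) choose i) * N i))))
  (leadingCoeff-scale (N k) k)
  (polynomial-cong (λ l _ → begin
      ι (N k) ℚ.* ι ((l ∸ 1) choose k) ℚ.+ ι (Σ< k (term l))  ≡⟨ ℚₚ.+-comm (ι (N k) ℚ.* ι ((l ∸ 1) choose k))
        (ι (Σ< k (term l))) ⟩
      ι (Σ< k (term l)) ℚ.+ ι (N k) ℚ.* ι ((l ∸ 1) choose k)  ≡⟨ cong (ℚ._+_ (ι (Σ< k (term l))))
        (trans (ι-* (N k) ((l ∸ 1) choose k)) (cong ι (ℕₚ.*-comm (N k) ((l ∸ 1) choose k)))) ⟩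
      ι (Σ< k (term l)) ℚ.+ ι (term l k)                      ≡⟨ ι-+ (Σ< k (term l)) (term l k) ⟩
      ι (Σ< k (term l) + term l k)                            ≡⟨ cong ι (sym (Σ<-last k (term l))) ⟩
      ι (Σ< (suc k) (term l)) ∎)
    (polynomial-add (polynomial-scale (ι (N k)) (binomial-polynomial k)) low))
  where
  open ≡-Reasoning
  term : ℕ → ℕ → ℕ
  term l i = ((l ∸ 1) choose i) * N i

newton-lower : ∀ (N : ℕ → ℕ) k → LowerTerms k (λ l → ι (Σ< k (λ i → ((l ∸ 1) choose i) * N i)))
newton-lower N zero    = lowerTerms [] refl (λ _ _ → refl)
newton-lower N (suc k) = polynomial-lower (newton-step N k (newton-lower N k))

newton : ∀ (N : ℕ → ℕ) k → Polynomial k (leadingCoeff (N k) k) (λ l → ι (Σ< (suc k) (λ i → ((l ∸ 1) choose i) * N i)))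
newton N k = newton-step N k (newton-lower N k)

-- Existence of a standard filling

rightOrBelow⇒Lex : ∀ p q → rightOrBelow p q ≡ true → Lex p q
rightOrBelow⇒Lex (r , c) (r′ , c′) rel with ∨-true⁻ {(r ≡ᵇ r′) ∧ (suc c ≡ᵇ c′)} rel
... | inj₁ e = inj₂ (≡ᵇ-true⁻ {r} {r′} (proj₁ (∧-true⁻ e)) , ℕₚ.≤-reflexive
  (≡ᵇ-true⁻ {suc c} {c′} (proj₂ (∧-true⁻ {r ≡ᵇ r′} e))))
... | inj₂ e = inj₁ (ℕₚ.≤-reflexive (≡ᵇ-true⁻ {suc r} {r′} (proj₁ (∧-true⁻ e))))

Lex-asym : ∀ {p q} → Lex p q → Lex q p → ⊥
Lex-asym (inj₁ a)          (inj₁ b)          = ℕₚ.<-asym a b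
Lex-asym (inj₁ a)          (inj₂ (refl , _)) = ℕₚ.<-irrefl refl a
Lex-asym (inj₂ (refl , _)) (inj₁ b)          = ℕₚ.<-irrefl refl b
Lex-asym (inj₂ (_ , a))    (inj₂ (_ , b))    = ℕₚ.<-asym a b

Together : (ℕ × ℕ) × ℕ → (ℕ × ℕ) × ℕ → Set
Together (p , a) (q , b) = Lex p q × a < b

zip-sorted : ∀ {cs vs} → AllPairs Lex cs → AllPairs _<_ vs → AllPairs Together (zip cs vs)
zip-sorted []       _        = []
zip-sorted (_ ∷ _)  []       = []
zip-sorted {c ∷ cs} {v ∷ vs} (c< ∷ cs<) (v< ∷ vs<) =
  All.tabulate (λ {(p , a)} p∈ → let (p∈cs , a∈vs) = zip-fst cs vs p∈ in All.lookup c< p∈cs , All.lookup v< a∈vs) ∷ zip-sorted cs< vs<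

toList-tabulate : ∀ N (f : ℕ → ℕ) → Vec.toList (Vec.tabulate {n = N} (f ∘ toℕ)) ≡ applyUpTo f N
toList-tabulate zero    f = refl
toList-tabulate (suc N) f = cong (f 0 ∷_) (toList-tabulate N (f ∘ suc))

-- Numbering the cells row by row is a standard filling.
numSYT-positive : ∀ lam mu → 1 ≤ numSYT lam mu
numSYT-positive lam mu = ∈-length (∈-filter⁺ _ {xs = vecsOver (map suc (upTo N)) N}
  (∈-vecsOver⁺ v (λ i → subst (_∈ map suc (upTo N)) (sym (Vecₚ.lookup∘tabulate (suc ∘ toℕ) i))
    (∈-map⁺ suc (∈-upTo⁺ (Finₚ.toℕ<n i)))))
  (from T-≡ (subst (λ vs → isStandard cs vs ≡ true) (sym (toList-tabulate N suc))
    (from (isStandard⇔ cs (applyUpTo suc N)) (Uniqueₚ.applyUpTo⁺₁ suc N (λ i<j _ e → ℕₚ.<⇒≢ i<j (ℕₚ.suc-injective e))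
      , ordered)))))
  where
  cs = skewCells lam mu
  N = length cs
  v : Vec ℕ N
  v = Vec.tabulate (suc ∘ toℕ)
  sorted : AllPairs Together (zip cs (applyUpTo suc N))
  sorted = zip-sorted (skewCells-sorted lam mu) (AllPairsₚ.applyUpTo⁺₁ suc N (λ i<j _ → s≤s i<j))
  ordered : ∀ p a q b → (p , a) ∈ zip cs (applyUpTo suc N) → (q , b) ∈ zip cs (applyUpTo suc N) →
    rightOrBelow p q ≡ true → a < b
  ordered p a q b p∈ q∈ rel with ∈-AllPairs₂ sorted p∈ q∈
  ... | inj₁ refl = ⊥-elim (Lex-asym {p} {p} (rightOrBelow⇒Lex p p rel) (rightOrBelow⇒Lex p p rel))
  ... | inj₂ (inj₁ (_ , a<b)) = a<b
  ... | inj₂ (inj₂ (q<p , _)) = ⊥-elim (Lex-asym {p} {q} (rightOrBelow⇒Lex p q rel) q<p)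

-- The area under the Motzkin path

ΣFrom : ℕ → ℕ → (ℕ → ℤ) → ℤ
ΣFrom s zero    H = H s
ΣFrom s (suc k) H = H s ℤ.+ ΣFrom (suc s) k H

-- The trapezoidal rule: in the doubled sum of heights each inner height counts twice and the two
-- end heights once. The start `s` and the function `f` generalise `upTo` for the induction.
areaUnder-scanl : ∀ (m H : ℕ → ℤ) → (∀ i → H i ℤ.+ m i ≡ H (suc i)) → ∀ s k (f : ℕ → ℕ) → (∀ i → f i ≡ s + i) →
  areaUnder (scanl ℤ._+_ (H s) (applyUpTo (m ∘ f) k)) ≡ ((ΣFrom s k H ℤ.+ ΣFrom s k H) ℤ.- (H s ℤ.+ H (k + s))) / 2
areaUnder-scanl m H step s zero    f f≗ = cong (λ z → z / 2) (sym (ℤₚ.+-inverseʳ (H s ℤ.+ H s)))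
areaUnder-scanl m H step s (suc k) f f≗ = begin
  areaUnder (H s ∷ scanl ℤ._+_ (H s ℤ.+ m (f 0)) (applyUpTo (m ∘ f ∘ suc) k))
    ≡⟨ cong (λ z → areaUnder (H s ∷ scanl ℤ._+_ z (applyUpTo (m ∘ f ∘ suc) k)))
      (trans (cong (λ i → H s ℤ.+ m i) (trans (f≗ 0) (ℕₚ.+-identityʳ s))) (step s)) ⟩
  areaUnder (H s ∷ scanl ℤ._+_ (H (suc s)) (applyUpTo (m ∘ f ∘ suc) k))
    ≡⟨ unfold (H s) (H (suc s)) (applyUpTo (m ∘ f ∘ suc) k) ⟩
  ((H s ℤ.+ H (suc s)) / 2) ℚ.+ areaUnder (scanl ℤ._+_ (H (suc s)) (applyUpTo (m ∘ f ∘ suc) k))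
    ≡⟨ cong (ℚ._+_ ((H s ℤ.+ H (suc s)) / 2)) (areaUnder-scanl m H step (suc s) k (f ∘ suc)
      (λ i → trans (f≗ (suc i)) (ℕₚ.+-suc s i))) ⟩
  ((H s ℤ.+ H (suc s)) / 2) ℚ.+ (((T ℤ.+ T) ℤ.- (H (suc s) ℤ.+ H (k + suc s))) / 2)
    ≡⟨ half-+ (H s ℤ.+ H (suc s)) _ ⟩
  ((H s ℤ.+ H (suc s)) ℤ.+ ((T ℤ.+ T) ℤ.- (H (suc s) ℤ.+ H (k + suc s)))) / 2
    ≡⟨ cong (λ z → z / 2) (trans (solve 4 (λ a b c t → (a :+ b) :+ ((t :+ t) :- (b :+ c)) := ((a :+ t) :+ (a :+ t)) :-
      (a :+ c)) refl (H s) (H (suc s)) (H (k + suc s)) T)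
         (cong (λ i → ((H s ℤ.+ T) ℤ.+ (H s ℤ.+ T)) ℤ.- (H s ℤ.+ H i)) (ℕₚ.+-suc k s))) ⟩
  (((H s ℤ.+ T) ℤ.+ (H s ℤ.+ T)) ℤ.- (H s ℤ.+ H (suc k + s))) / 2 ∎
  where
  open ≡-Reasoning
  open Data.Integer.Solver.+-*-Solver
  T = ΣFrom (suc s) k H
  unfold : ∀ a b ms → areaUnder (a ∷ scanl ℤ._+_ b ms) ≡ ((a ℤ.+ b) / 2) ℚ.+ areaUnder (scanl ℤ._+_ b ms)
  unfold a b []       = refl
  unfold a b (m ∷ ms) = refl

module Area (n : ℕ) (S : List ℤ) (cc : CentredCatalan (suc n) S) where
  open CatalanSet n S cc

  motzkinStep-αβ : ∀ k → motzkinStep S (suc k) ≡ + (α k + β k) ℤ.- + 1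
  motzkinStep-αβ k = cong (λ j → + j ℤ.- + 1) (trans
    (len-split _ (λ z → -[1+ k ] ≡ᶻ z) (λ z → + suc k ≡ᶻ z) pointwise S)
    (cong₂ _+_ (len-member S! -[1+ k ]) (len-member S! (+ suc k))))
    where
    swap : ∀ x y → (x ≡ᶻ y) ≡ (y ≡ᶻ x)
    swap x y with x ℤ.≟ y | y ℤ.≟ x
    ... | yes _ | yes _ = refl
    ... | no _  | no _  = refl
    ... | yes p | no ¬q = contradiction (sym p) ¬q
    ... | no ¬p | yes q = contradiction (sym q) ¬p
    pointwise : ∀ z → bool ((z ≡ᶻ + suc k) ∨ (z ≡ᶻ -[1+ k ])) ≡ bool (-[1+ k ] ≡ᶻ z) + bool (+ suc k ≡ᶻ z)
    pointwise z rewrite swap z (+ suc k) | swap z -[1+ k ] with + suc k ℤ.≟ z | -[1+ k ] ℤ.≟ z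
    ... | yes refl | yes ()
    ... | yes _    | no _  = refl
    ... | no _     | yes _ = refl
    ... | no _     | no _  = refl

  -- The height of the Motzkin path after `i` steps.
  H : ℕ → ℤ
  H i = + (A i + B i) ℤ.- + i

  H-step : ∀ i → H i ℤ.+ motzkinStep S (suc i) ≡ H (suc i)
  H-step i = begin
    H i ℤ.+ motzkinStep S (suc i)                                        ≡⟨ cong (ℤ._+_ (H i)) (motzkinStep-αβ i) ⟩
    (+ (A i + B i) ℤ.- + i) ℤ.+ (+ (α i + β i) ℤ.- + 1)                   ≡⟨ solve 4 (λ a i b o →
      (a :- i) :+ (b :- o) := (a :+ b) :- (o :+ i)) refl (+ (A i + B i)) (+ i) (+ (α i + β i)) (+ 1) ⟩
    (+ (A i + B i) ℤ.+ + (α i + β i)) ℤ.- + suc i                         ≡⟨ cong (λ k → + k ℤ.- + suc i)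
      (N.solve 4 (λ a b c d → (a N.:+ b) N.:+ (c N.:+ d) N.:= (a N.:+ c) N.:+ (b N.:+ d)) refl (A i) (B i) (α i)
        (β i)) ⟩
    H (suc i) ∎
    where
    open ≡-Reasoning
    open Data.Integer.Solver.+-*-Solver
    module N = Data.Nat.Solver.+-*-Solver

  ΣFrom-area : ∀ s k (f : ℕ → ℕ) → (∀ i → f i ≡ s + i) → k + s ≤ n →
    ΣFrom s k H ≡ + Σ< (suc k) (λ i → A (f i) + B (f i) ∸ f i)
  ΣFrom-area s zero f f≗ le rewrite trans (f≗ 0) (ℕₚ.+-identityʳ s) =
    trans (sym (pos-∸ (Profile.catalan profile s le))) (cong +_ (sym (ℕₚ.+-identityʳ _)))
  ΣFrom-area s (suc k) f f≗ le = trans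
    (cong₂ ℤ._+_ (trans (sym (pos-∸ (Profile.catalan profile s (ℕₚ.≤-trans (ℕₚ.m≤n+m s (suc k)) le))))
        (cong (λ i → + (A i + B i ∸ i)) (sym (trans (f≗ 0) (ℕₚ.+-identityʳ s)))))
      (ΣFrom-area (suc s) k (f ∘ suc) (λ i → trans (f≗ (suc i)) (ℕₚ.+-suc s i))
        (subst (_≤ n) (sym (ℕₚ.+-suc k s)) le)))
    (sym (ℤₚ.pos-+ (A (f 0) + B (f 0) ∸ f 0) _))

  H-n : H n ≡ + 0
  H-n = trans (cong (λ k → + k ℤ.- + n) (ℕₚ.≤-antisym (Profile.bounded profile n)
    (Profile.catalan profile n ℕₚ.≤-refl))) (ℤₚ.+-inverseʳ (+ n))

  areaM≡area : areaM n S ≡ + area n α β / 1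
  areaM≡area = begin
    areaUnder (scanl ℤ._+_ (+ 0) (map (λ k → motzkinStep S (suc k)) (upTo n)))
      ≡⟨ cong (λ ms → areaUnder (scanl ℤ._+_ (+ 0) ms)) (Listₚ.map-upTo (λ k → motzkinStep S (suc k)) n) ⟩
    areaUnder (scanl ℤ._+_ (H 0) (applyUpTo (λ k → motzkinStep S (suc k)) n))
      ≡⟨ areaUnder-scanl (λ k → motzkinStep S (suc k)) H H-step 0 n id (λ _ → refl) ⟩
    ((T ℤ.+ T) ℤ.- (H 0 ℤ.+ H (n + 0))) / 2
      ≡⟨ cong (λ z → z / 2) (trans (cong (λ z → (T ℤ.+ T) ℤ.- (+ 0 ℤ.+ z)) (trans (cong H (ℕₚ.+-identityʳ n)) H-n))
        (ℤₚ.+-identityʳ (T ℤ.+ T))) ⟩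
    (T ℤ.+ T) / 2 ≡⟨ double-half T ⟩
    T / 1         ≡⟨ cong (λ z → z / 1) (ΣFrom-area 0 n id (λ _ → refl) (ℕₚ.≤-reflexive (ℕₚ.+-identityʳ n))) ⟩
    + area n α β / 1 ∎
    where
    open ≡-Reasoning
    T = ΣFrom 0 n H

-- The polynomial and its leading coefficient

module _ (n : ℕ) (S : List ℤ) (cc : CentredCatalan (suc n) S) where
  open CatalanSet n S cc

  open Tableaux profile u A≤u cells cells-unique ∈-cells using (length-cells; reduced≡tableaux)

  w-newton : ∀ m → w n (suc m) S ≡ Σ< (suc (area n α β)) (λ i → (m choose i) * reduced n α β i)
  w-newton m = trans (w≡length-trapezoids n m S 0∈S ranged)
    -- The number of terms is chosen above `m`, as the expansion requires, and beyond the area, so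
    -- that the terms past the area, which vanish by `reduced≡0`, can be cut off uniformly in `m`.
    (trans (goodOver-insert n α β m (suc (area n α β) + suc m) (ℕₚ.m≤n+m (suc m) (suc (area n α β))))
      (Σ<-truncate (suc (area n α β)) (suc m) _ (λ i lt → trans (cong (_*_ (m choose i)) (reduced≡0 n α β i lt))
        (ℕₚ.*-zeroʳ (m choose i)))))

  w-polynomial : Polynomial (skewSize λ⟨ S ⟩ μ⟨ S ⟩) (leadingCoeff (numSYT λ⟨ S ⟩ μ⟨ S ⟩) (skewSize λ⟨ S ⟩ μ⟨ S ⟩))
    (λ l → ι (w n l S))
  w-polynomial = subst (λ k → Polynomial k (leadingCoeff (numSYT λ⟨ S ⟩ μ⟨ S ⟩) k) (λ l → ι (w n l S)))
    (sym length-cells)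
    (subst (λ f → Polynomial (area n α β) (leadingCoeff f (area n α β)) (λ l → ι (w n l S))) reduced≡tableaux
      (polynomial-cong (λ { (suc m) _ → cong ι (sym (w-newton m)) }) (newton (reduced n α β) (area n α β))))

theorem1p2 : (n : ℕ) → 1 ≤ n → (S : List ℤ) → CentredCatalan (suc n) S →
    ((+ skewSize λ⟨ S ⟩ μ⟨ S ⟩) / 1 ≡ areaM n S)
    × Σ (List ℚ) (λ cs → Σ ℚ (λ c →
    length cs ≡ skewSize λ⟨ S ⟩ μ⟨ S ⟩
    × c ≢ 0ℚ
    × c ≡ leadingCoeff (numSYT λ⟨ S ⟩ μ⟨ S ⟩) (skewSize λ⟨ S ⟩ μ⟨ S ⟩)
    × ((l : ℕ) → 1 ≤ l → evalPoly (cs ++ c ∷ []) ((+ l) / 1) ≡ (+ w n l S) / 1)))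
theorem1p2 n _ S cc =
  trans (cong (λ k → + k / 1) (Tableaux.length-cells profile u A≤u cells cells-unique ∈-cells)) (sym (Area.areaM≡area n S cc)) ,
  lower , leadingCoeff (numSYT λ⟨ S ⟩ μ⟨ S ⟩) (skewSize λ⟨ S ⟩ μ⟨ S ⟩) , length-k ,
  -- The leading coefficient is nonzero because at least one standard tableau exists, so the degree
  -- is exact.
  leadingCoeff≢0 (numSYT λ⟨ S ⟩ μ⟨ S ⟩) (skewSize λ⟨ S ⟩ μ⟨ S ⟩) (numSYT-positive λ⟨ S ⟩ μ⟨ S ⟩) , refl , eval
  where
  open CatalanSet n S cc
  open Polynomial (w-polynomial n S cc)
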